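{- Let $G\le\mathrm{Sym}(n)$ be a Frobenius group with Frobenius complement $H$ and Frobenius kernel $K$ (so $G=KH$). Then $G$ has the EKR property. Furthermore, $G$ has the strict EKR property if and only if $|H|=2$.
   Context: A transitive permutation group $G\le\mathrm{Sym}(n)$ is a Frobenius group if no non-identity element fixes more than one point of $[n]$ and some non-identity element fixes a point. A Frobenius complement is a non-trivial proper subgroup $H$ with $H\cap g^{ -1}Hg=\{\mathrm{id}\}$ for all $g\in G\setminus H$; the Frobenius kernel is $K=\big(G\setminus\bigcup_{g\in G}g^{ -1}Hg\big)\cup\{\mathrm{id}\}$. For $G\le\mathrm{Sym}(n)$ acting naturally on $[n]$: $\pi,\sigma\in G$ intersect if $\pi\sigma^{ -1}$ fixes a point; a subset is intersecting if all pairs intersect. $G$ has the EKR property if every intersecting subset has size at most the size of the largest point-stabilizer; it has the strict EKR property if it has the EKR property and every maximum-size intersecting subset is a coset of a point-stabilizer, i.e. of the form $\{\pi\in G:\pi(i)=j\}$. -}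

module Defs where

open import Data.Nat using (ℕ; _≤_; _⊔_)
open import Data.Fin using (Fin; _≟_)
open import Data.Fin.Permutation as P using (Permutation′; _⟨$⟩ʳ_; _∘ₚ_; flip)
open import Data.List using (List; length; filter; map; foldr; allFin)
open import Data.List.Relation.Unary.Any using (Any)
open import Data.List.Relation.Unary.All using (All)
open import Data.List.Relation.Unary.AllPairs using (AllPairs)
open import Data.List.Membership.Propositional using (_∈_)
open import Data.Product using (Σ; ∃; _×_; _,_)
open import Relation.Nullary using (¬_)
open import Relation.Binary.PropositionalEquality using (_≡_)
open import Function.Bundles using (_⇔_)

Perm : ℕ → Set
Perm n = Permutation′ n

_≈_ : ∀ {n} → Perm n → Perm n → Set
_≈_ = P._≈_

idP : ∀ {n} → Perm n
idP = P.id

-- Usual (right-to-left) composition: (π · σ)(x) = π (σ x).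
_·_ : ∀ {n} → Perm n → Perm n → Perm n
π · σ = σ ∘ₚ π

_⁻¹ : ∀ {n} → Perm n → Perm n
π ⁻¹ = flip π

_∈≈_ : ∀ {n} → Perm n → List (Perm n) → Set
π ∈≈ L = Any (π ≈_) L

-- A list without repetitions (up to pointwise equality): a finite set.
Distinct : ∀ {n} → List (Perm n) → Set
Distinct = AllPairs (λ π σ → ¬ (π ≈ σ))

record IsPermGroup {n : ℕ} (G : List (Perm n)) : Set where
  field
    distinct : Distinct G
    hasId    : idP ∈≈ G
    closed·  : ∀ π σ → π ∈≈ G → σ ∈≈ G → (π · σ) ∈≈ G
    closed⁻¹ : ∀ π → π ∈≈ G → (π ⁻¹) ∈≈ G

record IsSubgroup {n : ℕ} (G H : List (Perm n)) : Set where
  field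
    group  : IsPermGroup H
    subset : ∀ h → h ∈≈ H → h ∈≈ G

Transitive : ∀ {n} → List (Perm n) → Set
Transitive {n} G = ∀ (i j : Fin n) → ∃ λ π → π ∈≈ G × π ⟨$⟩ʳ i ≡ j

Fixes : ∀ {n} → Perm n → Fin n → Set
Fixes π i = π ⟨$⟩ʳ i ≡ i

record IsFrobenius {n : ℕ} (G : List (Perm n)) : Set where
  field
    group      : IsPermGroup G
    transitive : Transitive G
    atMostOneFixed : ∀ π → π ∈≈ G → ¬ (π ≈ idP) →
                     ∀ i j → Fixes π i → Fixes π j → i ≡ j
    someFixer  : ∃ λ π → π ∈≈ G × ¬ (π ≈ idP) × ∃ λ i → Fixes π i

record IsFrobeniusComplement {n : ℕ} (G H : List (Perm n)) : Set where
  field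
    subgroup   : IsSubgroup G H
    nontrivial : ∃ λ h → h ∈≈ H × ¬ (h ≈ idP)
    proper     : ∃ λ g → g ∈≈ G × ¬ (g ∈≈ H)
    malnormal  : ∀ g → g ∈≈ G → ¬ (g ∈≈ H) →
                 ∀ y → y ∈≈ H → (∃ λ h → h ∈≈ H × y ≈ ((g ⁻¹) · (h · g))) →
                 y ≈ idP

Intersect : ∀ {n} → Perm n → Perm n → Set
Intersect π σ = ∃ λ i → Fixes (π · (σ ⁻¹)) i

IsIntersecting : ∀ {n} → List (Perm n) → List (Perm n) → Set
IsIntersecting G S =
  Distinct S × (∀ π → π ∈ S → π ∈≈ G) ×
  (∀ π σ → π ∈ S → σ ∈ S → Intersect π σ)

stab : ∀ {n} → List (Perm n) → Fin n → List (Perm n)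
stab G i = filter (λ π → (π ⟨$⟩ʳ i) ≟ i) G

maxStabSize : ∀ {n} → List (Perm n) → ℕ
maxStabSize {n} G = foldr _⊔_ 0 (map (λ i → length (stab G i)) (allFin n))

EKR : ∀ {n} → List (Perm n) → Set
EKR G = ∀ S → IsIntersecting G S → length S ≤ maxStabSize G

IsStabCoset : ∀ {n} → List (Perm n) → List (Perm n) → Set
IsStabCoset {n} G S = ∃ λ (i : Fin n) → ∃ λ (j : Fin n) →
  ∀ π → (π ∈≈ S) ⇔ (π ∈≈ G × π ⟨$⟩ʳ i ≡ j)

IsMaxIntersecting : ∀ {n} → List (Perm n) → List (Perm n) → Set
IsMaxIntersecting G S =
  IsIntersecting G S × (∀ T → IsIntersecting G T → length T ≤ length S)

StrictEKR : ∀ {n} → List (Perm n) → Set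
StrictEKR G = EKR G × (∀ S → IsMaxIntersecting G S → IsStabCoset G S)

{-# OPTIONS --safe #-}
module Submission where

-- The kernel K = {x : x fixes a point only if x = 1} is shown to be a subgroup (Frobenius' theorem).
-- Then K is regular, G = KH with H a point stabiliser, and an intersecting family contains at most
-- one element of each coset of K, which gives the bound |H|; conversely every transversal of K is
-- intersecting, so that for |H| > 2 some maximum families are not cosets.
--
-- Frobenius' theorem is proved with characters over ℚ, avoiding splitting fields. For θ irreducible
-- on H, the class function φ = Ind (θ − θ(1)) + θ(1) extends θ, is constant on K, and is a difference
-- A − B of characters of G; after cancelling common constituents ⟨A,B⟩ = 0. Both ⟨A,A⟩ and ⟨B,B⟩ are
-- multiples of ⟨θ,θ⟩ by reciprocity, and their sum is ⟨φ,φ⟩ = ⟨θ,θ⟩, so B = 0 and φ is a character.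
-- Its representation is trivial on K, since the centraliser of a non-trivial element of K lies in K.
--
-- An arbitrary Frobenius complement is related to the point stabiliser only through order two: if a
-- malnormal subgroup has order two, its kernel is abelian, of index two and inverted by the
-- involution, and then every other malnormal subgroup has order two as well.

open import Defs
open import Level using (0ℓ)
open import Data.Bool using (Bool; true; false; if_then_else_; not)
import Data.Bool.Properties as Boolₚ
open import Data.Nat as ℕ using (ℕ; zero; suc; _≤_; _<_; s≤s; _⊔_)
open import Data.Nat.Divisibility using (_∣_; n∣m*n; ∣-refl; ∣m⇒∣m*n; ∣m∣n⇒∣m+n; ∣m+n∣m⇒∣n; ∣⇒≤)
open import Data.Nat.GeneralisedArithmetic using (fold)
import Data.Nat.Properties as ℕₚ
open import Data.Fin as Fin using (Fin; zero; suc; splitAt; remQuot)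
open import Data.Fin.Permutation as Perm using (_⟨$⟩ʳ_; _⟨$⟩ˡ_; permutation)
import Data.Fin.Properties as Finₚ
import Data.Rational as ℚ
import Data.Rational.Properties as ℚₚ
open import Data.List using (List; []; _∷_; length; map; foldr; lookup; tabulate; allFin)
import Data.List.Properties as Listₚ
open import Data.List.Membership.Propositional using () renaming (_∈_ to _∈ˡ_)
open import Data.List.Membership.Propositional.Properties using (∈-allFin; ∈-filter⁺; ∈-filter⁻; ∈-lookup; ∈-tabulate⁺; ∈-tabulate⁻)
open import Data.List.Relation.Unary.All as All using ([]; _∷_)
open import Data.List.Relation.Unary.AllPairs using ([]; _∷_)
import Data.List.Relation.Unary.AllPairs.Properties as AllPairsₚ
open import Data.List.Relation.Unary.Any as Any using (here; there)
import Data.List.Relation.Unary.Any.Properties as Anyₚ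
open import Data.Product using (∃; _×_; _,_; proj₁; proj₂)
open import Data.Sum using (_⊎_; inj₁; inj₂)
open import Function using (_∘_)
open import Function.Bundles using (_⇔_; mk⇔; Equivalence)
open import Relation.Nullary using (¬_; ¬?; Dec; yes; no; does; contradiction)
open import Relation.Nullary.Decidable using (dec-true; dec-false; _×-dec_)
open import Relation.Binary.Bundles using (Setoid)
open import Relation.Binary.Definitions using (DecidableEquality)
open import Relation.Binary.PropositionalEquality using (_≡_; _≢_; refl; sym; trans; cong; cong₂; subst; isEquivalence; module ≡-Reasoning)
import Relation.Binary.Reasoning.Setoid as SetoidReasoning
open import Algebra.Bundles using (CommutativeRing; Group)
open import Algebra.Structures using (IsCommutativeRing; IsGroup)
import Algebra.Properties.CommutativeSemigroup as CommutativeSemigroupProperties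
import Algebra.Properties.Group as GroupProperties
import Algebra.Properties.Ring as RingProperties
import Algebra.Properties.Semiring.Sum as SemiringSum

-- Working over ℚ removes three tools of the classical argument. Without complex conjugation,
-- positivity comes from idempotents: the trace of an idempotent matrix is a natural number that
-- vanishes only with the matrix, and degrees and norms of characters are such traces. Without
-- absolute irreducibility, s = ⟨θ,θ⟩ may exceed 1; what survives is that ⟨f,θ⟩ is a multiple of s
-- for every character f of H. The degree θ(1) is one of these multiples, and this disposes of the
-- correction terms θ(1)⟨·,1⟩ that reciprocity for φ produces. Without eigenvalues, triviality on K
-- cannot be read off from φ(x) = φ(1) at a single x; it is obtained by averaging over a subgroup on
-- which φ is constant. Moreover, irreducibility is never decided and no decomposition into
-- irreducibles is built: the inductions run on the degree of a character.

does⁻ : ∀ {A : Set} (a? : Dec A) → does a? ≡ true → A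
does⁻ (yes a) _ = a

-- Linear algebra

-- Decidable equality belongs to the structure because pivoting has to find non-zero entries and the
-- inductions branch on whether an inner product vanishes.
record CharZeroField : Set₁ where
  infixl 6 _+_
  infixl 7 _*_
  infix 8 -_
  infix 4 _≟_
  field
    F : Set
    _+_ _*_ : F → F → F
    -_ : F → F
    0# 1# : F
    isCommutativeRing : IsCommutativeRing _≡_ _+_ _*_ -_ 0# 1#
    _≟_ : DecidableEquality F
    recip : ∀ x → x ≢ 0# → ∃ λ y → x * y ≡ 1#

    fromℕ-suc≢0 : ∀ n → fold 0# (1# +_) (suc n) ≢ 0#

  commutativeRing : CommutativeRing 0ℓ 0ℓ
  commutativeRing = record { isCommutativeRing = isCommutativeRing }

  fromℕ : ℕ → F
  fromℕ = fold 0# (1# +_)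

module LinearAlgebra (𝔽 : CharZeroField) where
  open CharZeroField 𝔽 public
  open CommutativeRing commutativeRing public using (+-assoc; +-comm; +-identityˡ; +-identityʳ; *-assoc; *-comm; *-identityˡ; *-identityʳ; distribˡ; distribʳ; zeroˡ; zeroʳ; -‿inverseˡ; -‿inverseʳ)
  open RingProperties (CommutativeRing.ring commutativeRing) public using (-‿distribˡ-*; -‿distribʳ-*; -‿+-comm; -0#≈0#; +-cancelˡ; +-cancelʳ)
  private module S = SemiringSum (CommutativeRing.semiring commutativeRing)
  open CommutativeSemigroupProperties (CommutativeRing.*-commutativeSemigroup commutativeRing) public using () renaming (x∙yz≈y∙xz to x*yz≡y*xz; interchange to *-interchange)
  open ≡-Reasoning

  fromℕ-+ : ∀ m n → fromℕ (m ℕ.+ n) ≡ fromℕ m + fromℕ n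
  fromℕ-+ zero n = sym (+-identityˡ _)
  fromℕ-+ (suc m) n = trans (cong (1# +_) (fromℕ-+ m n)) (sym (+-assoc _ _ _))

  fromℕ-* : ∀ m n → fromℕ (m ℕ.* n) ≡ fromℕ m * fromℕ n
  fromℕ-* zero n = sym (zeroˡ _)
  fromℕ-* (suc m) n = begin
    fromℕ (n ℕ.+ m ℕ.* n)          ≡⟨ fromℕ-+ n (m ℕ.* n) ⟩
    fromℕ n + fromℕ (m ℕ.* n)      ≡⟨ cong₂ _+_ (sym (*-identityˡ _)) (fromℕ-* m n) ⟩
    1# * fromℕ n + fromℕ m * fromℕ n ≡⟨ distribʳ _ _ _ ⟨
    (1# + fromℕ m) * fromℕ n       ∎

  fromℕ-injective : ∀ m n → fromℕ m ≡ fromℕ n → m ≡ n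
  fromℕ-injective zero zero _ = refl
  fromℕ-injective zero (suc n) eq = contradiction (sym eq) (fromℕ-suc≢0 n)
  fromℕ-injective (suc m) zero eq = contradiction eq (fromℕ-suc≢0 m)
  fromℕ-injective (suc m) (suc n) eq = cong suc (fromℕ-injective m n (+-cancelˡ _ _ _ eq))

  1≢0 : 1# ≢ 0#
  1≢0 eq = fromℕ-suc≢0 0 (trans (+-identityʳ 1#) eq)

  x+y-y : ∀ x y → (x + y) + - y ≡ x
  x+y-y x y = trans (+-assoc _ _ _) (trans (cong (x +_) (-‿inverseʳ y)) (+-identityʳ x))

  x-y+y : ∀ x y → (x + - y) + y ≡ x
  x-y+y x y = trans (+-assoc _ _ _) (trans (cong (x +_) (-‿inverseˡ y)) (+-identityʳ x))

  -- Finite sums in the field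

  opaque
    sum : ∀ {n} → (Fin n → F) → F
    sum = S.sum

    sum-cong : ∀ {n} {f g : Fin n → F} → (∀ i → f i ≡ g i) → sum f ≡ sum g
    sum-cong = S.sum-cong-≗

    sum-+ : ∀ {n} (f g : Fin n → F) → sum (λ i → f i + g i) ≡ sum f + sum g
    sum-+ = S.∑-distrib-+

    sum-comm : ∀ {m n} (f : Fin m → Fin n → F) → sum (λ i → sum λ j → f i j) ≡ sum λ j → sum λ i → f i j
    sum-comm = S.∑-comm

    sum-bijection : ∀ {n} (f : Fin n → F) (π ρ : Fin n → Fin n) → (∀ i → π (ρ i) ≡ i) → (∀ i → ρ (π i) ≡ i) → sum f ≡ sum (λ i → f (π i))
    sum-bijection f π ρ πρ ρπ = S.sum-permute f (permutation π ρ πρ ρπ)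

    *-distribˡ-sum : ∀ {n} x (f : Fin n → F) → x * sum f ≡ sum λ i → x * f i
    *-distribˡ-sum = S.*-distribˡ-sum

    *-distribʳ-sum : ∀ {n} x (f : Fin n → F) → sum f * x ≡ sum λ i → f i * x
    *-distribʳ-sum = S.*-distribʳ-sum

    sum-zero : ∀ {n} {f : Fin n → F} → (∀ i → f i ≡ 0#) → sum f ≡ 0#
    sum-zero {n} f≡0 = trans (sum-cong f≡0) (S.sum-replicate-zero n)

    sum-pick : ∀ {n} (f : Fin n → F) k → (∀ i → i ≢ k → f i ≡ 0#) → sum f ≡ f k
    sum-pick {suc n} f zero others = trans (cong (f zero +_) (sum-zero λ i → others (suc i) λ ())) (+-identityʳ _)
    sum-pick {suc n} f (suc k) others = trans (cong₂ _+_ (others zero λ ()) (sum-pick (f ∘ suc) k λ i i≢k → others (suc i) (i≢k ∘ Finₚ.suc-injective))) (+-identityˡ _)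

    sum-neg : ∀ {n} (f : Fin n → F) → sum (λ i → - f i) ≡ - sum f
    sum-neg {zero} f = sym -0#≈0#
    sum-neg {suc n} f = trans (cong (- f zero +_) (sum-neg (f ∘ suc))) (-‿+-comm _ _)

    sum-≢0 : ∀ {n} (f : Fin n → F) → sum f ≢ 0# → ∃ λ i → f i ≢ 0#
    sum-≢0 {zero} f ≢0 = contradiction refl ≢0
    sum-≢0 {suc n} f ≢0 with f zero ≟ 0#
    ... | no f0≢0 = zero , f0≢0
    ... | yes f0≡0 with i , fi≢0 ← sum-≢0 (f ∘ suc) (λ eq → ≢0 (trans (cong₂ _+_ f0≡0 eq) (+-identityˡ _))) = suc i , fi≢0

    sum-splitAt : ∀ m {n} (f : Fin m ⊎ Fin n → F) → sum (f ∘ splitAt m) ≡ sum (f ∘ inj₁) + sum (f ∘ inj₂)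
    sum-splitAt zero f = sym (+-identityˡ _)
    sum-splitAt (suc m) {n} f = begin
      f (inj₁ zero) + sum (λ i → f (splitAt (suc m) (suc i)))
        ≡⟨ cong (f (inj₁ zero) +_) (trans (sum-cong shift) (sum-splitAt m g)) ⟩
      f (inj₁ zero) + (sum (λ i → f (inj₁ (suc i))) + sum (f ∘ inj₂))
        ≡⟨ +-assoc _ _ _ ⟨
      f (inj₁ zero) + sum (λ i → f (inj₁ (suc i))) + sum (f ∘ inj₂) ∎
      where
      g : Fin m ⊎ Fin n → F
      g (inj₁ i) = f (inj₁ (suc i))
      g (inj₂ j) = f (inj₂ j)
      shift : ∀ i → f (splitAt (suc m) (suc i)) ≡ g (splitAt m i)
      shift i with splitAt m i
      ... | inj₁ _ = refl
      ... | inj₂ _ = refl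

    sum-remQuot : ∀ m n (f : Fin m × Fin n → F) → sum (f ∘ remQuot {m} n) ≡ sum (λ i → sum (λ j → f (i , j)))
    sum-remQuot zero n f = refl
    sum-remQuot (suc m) n f = begin
      sum (λ p → f (remQuot {suc m} n p))       ≡⟨ sum-cong shift ⟩
      sum (g ∘ splitAt n)                       ≡⟨ sum-splitAt n g ⟩
      sum (λ j → f (zero , j)) + sum (λ q → g (inj₂ q)) ≡⟨ cong (sum (λ j → f (zero , j)) +_) (sum-remQuot m n λ (i , j) → f (suc i , j)) ⟩
      sum (λ j → f (zero , j)) + sum (λ i → sum (λ j → f (suc i , j))) ∎
      where
      g : Fin n ⊎ Fin (m ℕ.* n) → F
      g (inj₁ j) = f (zero , j)
      g (inj₂ q) = f (suc (proj₁ (remQuot {m} n q)) , proj₂ (remQuot {m} n q))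
      shift : ∀ p → f (remQuot {suc m} n p) ≡ g (splitAt n p)
      shift p with splitAt n p
      ... | inj₁ _ = refl
      ... | inj₂ _ = refl

    -- Cardinalities are counted inside the field. The last component serves twice: the order of a
    -- subgroup is non-zero, and a vanishing count of missed points means that none is missed.
    sum-indicator : ∀ {n} (b : Fin n → Bool) → ∃ λ k → sum (λ i → if b i then 1# else 0#) ≡ fromℕ k × (∀ i → b i ≡ true → k ≢ 0)
    sum-indicator {zero} b = 0 , refl , λ ()
    sum-indicator {suc n} b with b zero in b₀ | sum-indicator (b ∘ suc)
    ... | true | k , eq , _ = suc k , cong (1# +_) eq , λ _ _ ()
    ... | false | k , eq , nz = k , trans (+-identityˡ _) eq , λ where
      zero b≡true → contradiction (trans (sym b₀) b≡true) λ ()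
      (suc i) b≡true → nz i b≡true

  -- Matrices

  Mat : ℕ → ℕ → Set
  Mat m n = Fin m → Fin n → F

  private variable
    m n p q : ℕ

  infix 4 _≐_
  record _≐_ (A B : Mat m n) : Set where
    constructor mk≐
    field at : ∀ i j → A i j ≡ B i j
  open _≐_ public

  ≐-setoid : ℕ → ℕ → Setoid 0ℓ 0ℓ
  ≐-setoid m n = record
    { Carrier = Mat m n ; _≈_ = _≐_
    ; isEquivalence = record
      { refl = mk≐ λ _ _ → refl
      ; sym = λ A≐B → mk≐ λ i j → sym (at A≐B i j)
      ; trans = λ A≐B B≐C → mk≐ λ i j → trans (at A≐B i j) (at B≐C i j) } }

  module ≐ {m} {n} = Setoid (≐-setoid m n)
  private module ≐-Reasoning {m} {n} = SetoidReasoning (≐-setoid m n)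
  open ≐-Reasoning public using (step-≈-⟩; step-≈-⟨) renaming (begin_ to beginᴹ_; _∎ to _∎ᴹ)

  0ᴹ : Mat m n
  0ᴹ _ _ = 0#

  infixl 7 _⊡_
  infixl 6 _⊞_ _⊟_
  infixr 8 _•_

  _⊞_ : Mat m n → Mat m n → Mat m n
  (A ⊞ B) i j = A i j + B i j

  _⊟_ : Mat m n → Mat m n → Mat m n
  (A ⊟ B) i j = A i j + - B i j

  _•_ : F → Mat m n → Mat m n
  (c • A) i j = c * A i j

  tr : Mat n n → F
  tr A = sum λ i → A i i

  opaque
    _⊡_ : Mat m n → Mat n p → Mat m p
    (A ⊡ B) i j = sum λ k → A i k * B k j

    ⊡-at : (A : Mat m n) (B : Mat n p) → ∀ i j → (A ⊡ B) i j ≡ sum λ k → A i k * B k j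
    ⊡-at A B i j = refl

    ⊡-cong : {A A′ : Mat m n} {B B′ : Mat n p} → A ≐ A′ → B ≐ B′ → A ⊡ B ≐ A′ ⊡ B′
    ⊡-cong A≐ B≐ = mk≐ λ i j → sum-cong λ k → cong₂ _*_ (at A≐ i k) (at B≐ k j)

  ⊡-congˡ : {A : Mat m n} {B B′ : Mat n p} → B ≐ B′ → A ⊡ B ≐ A ⊡ B′
  ⊡-congˡ = ⊡-cong ≐.refl

  ⊡-congʳ : {A A′ : Mat m n} {B : Mat n p} → A ≐ A′ → A ⊡ B ≐ A′ ⊡ B
  ⊡-congʳ A≐ = ⊡-cong A≐ ≐.refl

  ⊞-cong : {A A′ B B′ : Mat m n} → A ≐ A′ → B ≐ B′ → A ⊞ B ≐ A′ ⊞ B′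
  ⊞-cong A≐ B≐ = mk≐ λ i j → cong₂ _+_ (at A≐ i j) (at B≐ i j)

  ⊟-cong : {A A′ B B′ : Mat m n} → A ≐ A′ → B ≐ B′ → A ⊟ B ≐ A′ ⊟ B′
  ⊟-cong A≐ B≐ = mk≐ λ i j → cong₂ (λ x y → x + - y) (at A≐ i j) (at B≐ i j)

  •-cong : ∀ c {A A′ : Mat m n} → A ≐ A′ → c • A ≐ c • A′
  •-cong c A≐ = mk≐ λ i j → cong (c *_) (at A≐ i j)

  opaque
    unfolding _⊡_

    ⊡-assoc : (A : Mat m n) (B : Mat n p) (C : Mat p q) → A ⊡ B ⊡ C ≐ A ⊡ (B ⊡ C)
    ⊡-assoc A B C = mk≐ λ i j → begin
      sum (λ k → sum (λ l → A i l * B l k) * C k j)   ≡⟨ sum-cong (λ k → *-distribʳ-sum (C k j) (λ l → A i l * B l k)) ⟩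
      sum (λ k → sum (λ l → A i l * B l k * C k j))   ≡⟨ sum-comm (λ k l → A i l * B l k * C k j) ⟩
      sum (λ l → sum (λ k → A i l * B l k * C k j))   ≡⟨ sum-cong (λ l → sum-cong λ k → *-assoc _ _ _) ⟩
      sum (λ l → sum (λ k → A i l * (B l k * C k j))) ≡⟨ sum-cong (λ l → *-distribˡ-sum (A i l) (λ k → B l k * C k j)) ⟨
      sum (λ l → A i l * sum (λ k → B l k * C k j))   ∎

    ⊡-distribˡ-⊞ : (A : Mat m n) (B C : Mat n p) → A ⊡ (B ⊞ C) ≐ A ⊡ B ⊞ A ⊡ C
    ⊡-distribˡ-⊞ A B C = mk≐ λ i j → trans (sum-cong λ k → distribˡ (A i k) (B k j) (C k j)) (sum-+ (λ k → A i k * B k j) (λ k → A i k * C k j))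

    ⊡-distribʳ-⊞ : (A B : Mat m n) (C : Mat n p) → (A ⊞ B) ⊡ C ≐ A ⊡ C ⊞ B ⊡ C
    ⊡-distribʳ-⊞ A B C = mk≐ λ i j → trans (sum-cong λ k → distribʳ (C k j) (A i k) (B i k)) (sum-+ (λ k → A i k * C k j) (λ k → B i k * C k j))

  private
    sum-diff : ∀ {n} (f g : Fin n → F) → sum (λ i → f i + - g i) ≡ sum f + - sum g
    sum-diff f g = trans (sum-+ f (λ i → - g i)) (cong (sum f +_) (sum-neg g))

  opaque
    unfolding _⊡_

    ⊡-distribˡ-⊟ : (A : Mat m n) (B C : Mat n p) → A ⊡ (B ⊟ C) ≐ A ⊡ B ⊟ A ⊡ C
    ⊡-distribˡ-⊟ A B C = mk≐ λ i j → trans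
      (sum-cong λ k → trans (distribˡ (A i k) (B k j) (- C k j)) (cong (A i k * B k j +_) (sym (-‿distribʳ-* (A i k) (C k j)))))
      (sum-diff (λ k → A i k * B k j) (λ k → A i k * C k j))

    ⊡-distribʳ-⊟ : (A B : Mat m n) (C : Mat n p) → (A ⊟ B) ⊡ C ≐ A ⊡ C ⊟ B ⊡ C
    ⊡-distribʳ-⊟ A B C = mk≐ λ i j → trans
      (sum-cong λ k → trans (distribʳ (C k j) (A i k) (- B i k)) (cong (A i k * C k j +_) (sym (-‿distribˡ-* (B i k) (C k j)))))
      (sum-diff (λ k → A i k * C k j) (λ k → B i k * C k j))

    ⊡-•ˡ : ∀ c (A : Mat m n) (B : Mat n p) → (c • A) ⊡ B ≐ c • (A ⊡ B)
    ⊡-•ˡ c A B = mk≐ λ i j → trans (sum-cong λ k → *-assoc c _ _) (sym (*-distribˡ-sum c (λ k → A i k * B k j)))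

    ⊡-•ʳ : ∀ c (A : Mat m n) (B : Mat n p) → A ⊡ (c • B) ≐ c • (A ⊡ B)
    ⊡-•ʳ c A B = mk≐ λ i j → trans (sum-cong λ k → x*yz≡y*xz _ c _) (sym (*-distribˡ-sum c (λ k → A i k * B k j)))

    ⊡-zeroʳ : (A : Mat m n) → A ⊡ 0ᴹ {n} {p} ≐ 0ᴹ
    ⊡-zeroʳ A = mk≐ λ i j → sum-zero λ k → zeroʳ (A i k)

  tr-cong : {A B : Mat n n} → A ≐ B → tr A ≡ tr B
  tr-cong A≐B = sum-cong λ i → at A≐B i i

  opaque
    unfolding _⊡_

    tr-⊡-comm : (A : Mat m n) (B : Mat n m) → tr (A ⊡ B) ≡ tr (B ⊡ A)
    tr-⊡-comm A B = trans (sum-comm (λ i k → A i k * B k i)) (sum-cong λ k → sum-cong λ i → *-comm (A i k) (B k i))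

  tr-⊟ : (A B : Mat n n) → tr (A ⊟ B) ≡ tr A + - tr B
  tr-⊟ A B = sum-diff (λ i → A i i) (λ i → B i i)

  tr-• : ∀ c (A : Mat n n) → tr (c • A) ≡ c * tr A
  tr-• c A = sym (*-distribˡ-sum c (λ i → A i i))

  opaque
    δ : Fin n → Fin n → F
    δ i j = if does (i Fin.≟ j) then 1# else 0#

    δ-refl : ∀ (i : Fin n) → δ i i ≡ 1#
    δ-refl i = cong (if_then 1# else 0#) (dec-true (i Fin.≟ i) refl)

    δ-≢ : ∀ {i j : Fin n} → i ≢ j → δ i j ≡ 0#
    δ-≢ {i = i} {j} i≢j = cong (if_then 1# else 0#) (dec-false (i Fin.≟ j) i≢j)

  unit : Fin m → Fin n → Mat m n
  unit k l i j = δ i k * δ l j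

  opaque
    unfolding _⊡_

    ⊡-unit : (A : Mat m n) (k : Fin n) (l : Fin p) → ∀ i j → (A ⊡ unit k l) i j ≡ A i k * δ l j
    ⊡-unit A k l i j = trans
      (sum-pick _ k λ r r≢k → trans (cong (λ d → A i r * (d * δ l j)) (δ-≢ r≢k)) (trans (cong (A i r *_) (zeroˡ _)) (zeroʳ _)))
      (cong (A i k *_) (trans (cong (_* δ l j) (δ-refl k)) (*-identityˡ _)))

    unit-⊡ : (k : Fin m) (l : Fin n) (B : Mat n p) → ∀ i j → (unit k l ⊡ B) i j ≡ δ i k * B l j
    unit-⊡ k l B i j = trans
      (sum-pick _ l λ r r≢l → trans (cong (λ d → δ i k * d * B r j) (δ-≢ (r≢l ∘ sym))) (trans (cong (_* B r j) (zeroʳ _)) (zeroˡ _)))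
      (cong (_* B l j) (trans (cong (δ i k *_) (δ-refl l)) (*-identityʳ _)))

  -- This is how products of matrix coefficients of two representations arise as entries of an
  -- intertwiner: a matrix unit is averaged between them.
  ⊡-unit-⊡ : (A : Mat m n) (k : Fin n) (l : Fin p) (B : Mat p q) → ∀ i j → (A ⊡ unit k l ⊡ B) i j ≡ A i k * B l j
  ⊡-unit-⊡ A k l B i j = begin
    (A ⊡ unit k l ⊡ B) i j               ≡⟨ ⊡-at (A ⊡ unit k l) B i j ⟩
    sum (λ r → (A ⊡ unit k l) i r * B r j) ≡⟨ sum-cong (λ r → cong (_* B r j) (⊡-unit A k l i r)) ⟩
    sum (λ r → A i k * δ l r * B r j)    ≡⟨ sum-pick _ l (λ r r≢l → trans (cong (λ d → A i k * d * B r j) (δ-≢ (r≢l ∘ sym))) (trans (cong (_* B r j) (zeroʳ _)) (zeroˡ _))) ⟩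
    A i k * δ l l * B l j                ≡⟨ cong (λ d → A i k * d * B l j) (δ-refl l) ⟩
    A i k * 1# * B l j                   ≡⟨ cong (_* B l j) (*-identityʳ _) ⟩
    A i k * B l j                        ∎

  -- Clearing a non-zero entry of X by Gaussian pivoting replaces X by X − XQX,
  -- where Q is the inverse pivot placed in the transposed position.
  module _ (P : Mat m n → Set)
    (base : ∀ X → X ≐ 0ᴹ → P X)
    (step : ∀ X (Q : Mat n m) → Q ⊡ X ⊡ Q ≐ Q → tr (Q ⊡ X) ≡ 1# → P (X ⊟ X ⊡ Q ⊡ X) → P X) where

    private
      -- Invariant: every row outside `rows` is zero. Clearing row `r` subtracts multiples of it
      -- from the other rows, and the multiple is zero for a row that is already zero.
      go : ∀ (rows : List (Fin m)) X → (∀ i → i ∈ˡ rows ⊎ (∀ j → X i j ≡ 0#)) → P X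
      go [] X cover = base X (mk≐ λ i j → zeroRow i (cover i) j)
        where
        zeroRow : ∀ i → i ∈ˡ [] ⊎ (∀ j → X i j ≡ 0#) → ∀ j → X i j ≡ 0#
        zeroRow i (inj₂ z) = z
      go (r ∷ rows) X cover with Finₚ.any? (λ j → ¬? (X r j ≟ 0#))
      ... | no none = go rows X cover′
        where
        zero-r : ∀ j → X r j ≡ 0#
        zero-r j with X r j ≟ 0#
        ... | yes eq = eq
        ... | no ≢0 = contradiction (j , ≢0) none
        cover′ : ∀ i → i ∈ˡ rows ⊎ (∀ j → X i j ≡ 0#)
        cover′ i with cover i
        ... | inj₁ (here refl) = inj₂ zero-r
        ... | inj₁ (there i∈) = inj₁ i∈
        ... | inj₂ z = inj₂ z
      ... | yes (c , x≢0) with u , xu≡1 ← recip (X r c) x≢0 = step X Q QXQ trQX (go rows (X ⊟ X ⊡ Q ⊡ X) cover′)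
        where
        Q : Mat n m
        Q = u • unit c r
        QX : ∀ i j → (Q ⊡ X) i j ≡ u * (δ i c * X r j)
        QX i j = trans (at (⊡-•ˡ u (unit c r) X) i j) (cong (u *_) (unit-⊡ c r X i j))
        XQX : ∀ i j → (X ⊡ Q ⊡ X) i j ≡ X i c * (u * X r j)
        XQX i j = begin
          (X ⊡ Q ⊡ X) i j                       ≡⟨ at (⊡-assoc X Q X) i j ⟩
          (X ⊡ (Q ⊡ X)) i j                     ≡⟨ ⊡-at X (Q ⊡ X) i j ⟩
          sum (λ k → X i k * (Q ⊡ X) k j)       ≡⟨ sum-cong (λ k → cong (X i k *_) (QX k j)) ⟩
          sum (λ k → X i k * (u * (δ k c * X r j))) ≡⟨ sum-pick _ c (λ k k≢c → trans (cong (λ d → X i k * (u * (d * X r j))) (δ-≢ k≢c)) (trans (cong (λ z → X i k * (u * z)) (zeroˡ _)) (trans (cong (X i k *_) (zeroʳ u)) (zeroʳ _)))) ⟩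
          X i c * (u * (δ c c * X r j))         ≡⟨ cong (λ d → X i c * (u * (d * X r j))) (δ-refl c) ⟩
          X i c * (u * (1# * X r j))            ≡⟨ cong (λ z → X i c * (u * z)) (*-identityˡ _) ⟩
          X i c * (u * X r j)                   ∎
        QXQ : Q ⊡ X ⊡ Q ≐ Q
        QXQ = mk≐ λ i j → begin
          (Q ⊡ X ⊡ Q) i j                  ≡⟨ at (⊡-•ʳ u (Q ⊡ X) (unit c r)) i j ⟩
          u * (Q ⊡ X ⊡ unit c r) i j       ≡⟨ cong (u *_) (⊡-unit (Q ⊡ X) c r i j) ⟩
          u * ((Q ⊡ X) i c * δ r j)        ≡⟨ cong (λ z → u * (z * δ r j)) (QX i c) ⟩
          u * (u * (δ i c * X r c) * δ r j) ≡⟨ cong (λ z → u * (z * δ r j)) (trans (x*yz≡y*xz u _ _) (trans (cong (δ i c *_) (trans (*-comm u _) xu≡1)) (*-identityʳ _))) ⟩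
          u * (δ i c * δ r j)              ∎
        trQX : tr (Q ⊡ X) ≡ 1#
        trQX = begin
          sum (λ i → (Q ⊡ X) i i)          ≡⟨ sum-cong (λ i → QX i i) ⟩
          sum (λ i → u * (δ i c * X r i))  ≡⟨ sum-pick _ c (λ i i≢c → trans (cong (λ d → u * (d * X r i)) (δ-≢ i≢c)) (trans (cong (u *_) (zeroˡ _)) (zeroʳ u))) ⟩
          u * (δ c c * X r c)              ≡⟨ cong (λ d → u * (d * X r c)) (δ-refl c) ⟩
          u * (1# * X r c)                 ≡⟨ cong (u *_) (*-identityˡ _) ⟩
          u * X r c                        ≡⟨ trans (*-comm u _) xu≡1 ⟩
          1#                               ∎
        cover′ : ∀ i → i ∈ˡ rows ⊎ (∀ j → (X ⊟ X ⊡ Q ⊡ X) i j ≡ 0#)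
        cover′ i with cover i
        ... | inj₁ (there i∈) = inj₁ i∈
        ... | inj₁ (here refl) = inj₂ λ j → trans (cong (λ z → X r j + - z) (trans (XQX r j) (trans (sym (*-assoc _ _ _)) (trans (cong (_* X r j) xu≡1) (*-identityˡ _))))) (-‿inverseʳ _)
        ... | inj₂ z = inj₂ λ j → trans (cong₂ (λ a b → a + - b) (z j) (trans (XQX i j) (trans (cong (_* (u * X r j)) (z c)) (zeroˡ _)))) (-‿inverseʳ _)

    pivot-induction : ∀ X → P X
    pivot-induction X = go (allFin m) X (λ i → inj₁ (∈-allFin i))

  ⊟-zero : {A B : Mat m n} → B ≐ 0ᴹ → A ⊟ B ≐ A
  ⊟-zero {A = A} B≐0 = mk≐ λ i j → trans (cong (λ b → A i j + - b) (at B≐0 i j)) (trans (cong (A i j +_) -0#≈0#) (+-identityʳ _))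

  ⊟-self : {A B : Mat m n} → A ≐ B → A ⊟ B ≐ 0ᴹ
  ⊟-self {B = B} A≐B = mk≐ λ i j → trans (cong (_+ - B i j) (at A≐B i j)) (-‿inverseʳ _)

  ⊟⊞ : (A B : Mat m n) → A ⊟ B ⊞ B ≐ A
  ⊟⊞ A B = mk≐ λ i j → x-y+y (A i j) (B i j)

  ⊟≐0⇒≐ : {A B : Mat m n} → A ⊟ B ≐ 0ᴹ → A ≐ B
  ⊟≐0⇒≐ {A = A} {B} eq = mk≐ λ i j → trans (sym (x-y+y (A i j) (B i j))) (trans (cong (_+ B i j) (at eq i j)) (+-identityˡ _))

  -- Generalised inverses and traces of idempotents

  opaque
    -- Since `X₁` is both X(1 - QX) and (1 - XQ)X, a generalised inverse Y of `X₁` gives (1 - QX)Y(1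
    -- - XQ), for which X·X collapses to X₁YX₁ = X₁; adding Q restores the missing XQX.
    generalised-inverse : (X : Mat m n) → ∃ λ Y → X ⊡ Y ⊡ X ≐ X
    generalised-inverse = pivot-induction _
      (λ X X≐0 → 0ᴹ , ≐.trans (⊡-congˡ X≐0) (≐.trans (⊡-zeroʳ (X ⊡ 0ᴹ)) (≐.sym X≐0)))
      λ X Q QXQ _ (Y , eq) →
        let X₁ = X ⊟ X ⊡ Q ⊡ X
            L = λ Z → Z ⊟ Z ⊡ X ⊡ Q
            R = λ Z → Z ⊟ Q ⊡ X ⊡ Z in
        R (L Y) ⊞ Q , (beginᴹ
          X ⊡ (R (L Y) ⊞ Q) ⊡ X ≈⟨ ⊡-congʳ (⊡-distribˡ-⊞ X (R (L Y)) Q) ⟩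
          (X ⊡ R (L Y) ⊞ X ⊡ Q) ⊡ X ≈⟨ ⊡-distribʳ-⊞ (X ⊡ R (L Y)) (X ⊡ Q) X ⟩
          X ⊡ R (L Y) ⊡ X ⊞ X ⊡ Q ⊡ X ≈⟨ ⊞-cong (⊡-congʳ (beginᴹ
              X ⊡ R (L Y)                     ≈⟨ ⊡-distribˡ-⊟ X (L Y) (Q ⊡ X ⊡ L Y) ⟩
              X ⊡ L Y ⊟ X ⊡ (Q ⊡ X ⊡ L Y)     ≈⟨ ⊟-cong ≐.refl (≐.trans (⊡-congˡ (⊡-assoc Q X (L Y))) (≐.trans (≐.sym (⊡-assoc X Q (X ⊡ L Y))) (≐.sym (⊡-assoc (X ⊡ Q) X (L Y))))) ⟩
              X ⊡ L Y ⊟ X ⊡ Q ⊡ X ⊡ L Y       ≈⟨ ⊡-distribʳ-⊟ X (X ⊡ Q ⊡ X) (L Y) ⟨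
              X₁ ⊡ L Y                        ∎ᴹ)) ≐.refl ⟩
          X₁ ⊡ L Y ⊡ X ⊞ X ⊡ Q ⊡ X ≈⟨ ⊞-cong (⊡-assoc X₁ (L Y) X) ≐.refl ⟩
          X₁ ⊡ (L Y ⊡ X) ⊞ X ⊡ Q ⊡ X ≈⟨ ⊞-cong (⊡-congˡ (beginᴹ
              L Y ⊡ X                       ≈⟨ ⊡-distribʳ-⊟ Y (Y ⊡ X ⊡ Q) X ⟩
              Y ⊡ X ⊟ Y ⊡ X ⊡ Q ⊡ X         ≈⟨ ⊟-cong ≐.refl (≐.trans (⊡-congʳ (⊡-assoc Y X Q)) (⊡-assoc Y (X ⊡ Q) X)) ⟩
              Y ⊡ X ⊟ Y ⊡ (X ⊡ Q ⊡ X)       ≈⟨ ⊡-distribˡ-⊟ Y X (X ⊡ Q ⊡ X) ⟨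
              Y ⊡ X₁                        ∎ᴹ)) ≐.refl ⟩
          X₁ ⊡ (Y ⊡ X₁) ⊞ X ⊡ Q ⊡ X ≈⟨ ⊞-cong (≐.trans (≐.sym (⊡-assoc X₁ Y X₁)) eq) ≐.refl ⟩
          X₁ ⊞ X ⊡ Q ⊡ X ≈⟨ ⊟⊞ X (X ⊡ Q ⊡ X) ⟩
          X ∎ᴹ)

  opaque
    -- The trace counts pivots: E = PQP is an idempotent with PE = EP = E and trace tr(QP) = 1, so P
    -- - E is again idempotent with trace one less. No pivot at all means P = 0.
    idempotent-trace : (P : Mat n n) → P ⊡ P ≐ P → ∃ λ k → tr P ≡ fromℕ k × (k ≡ 0 → P ≐ 0ᴹ)
    idempotent-trace = pivot-induction _
      (λ P P≐0 _ → 0 , trans (tr-cong P≐0) (sum-zero λ _ → refl) , λ _ → P≐0)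
      step
      where
      step : ∀ (P Q : Mat n n) → Q ⊡ P ⊡ Q ≐ Q → tr (Q ⊡ P) ≡ 1# →
        (let P₁ = P ⊟ P ⊡ Q ⊡ P in P₁ ⊡ P₁ ≐ P₁ → ∃ λ k → tr P₁ ≡ fromℕ k × (k ≡ 0 → P₁ ≐ 0ᴹ)) →
        P ⊡ P ≐ P → ∃ λ k → tr P ≡ fromℕ k × (k ≡ 0 → P ≐ 0ᴹ)
      step {n} P Q QPQ trQP IH PP with IH P₁P₁
        where
        E : Mat n n
        E = P ⊡ Q ⊡ P
        EP : E ⊡ P ≐ E
        EP = ≐.trans (⊡-assoc (P ⊡ Q) P P) (⊡-congˡ PP)
        PE : P ⊡ E ≐ E
        PE = ≐.trans (≐.sym (⊡-assoc P (P ⊡ Q) P)) (⊡-congʳ (≐.trans (≐.sym (⊡-assoc P P Q)) (⊡-congʳ PP)))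
        EE : E ⊡ E ≐ E
        EE = beginᴹ
          P ⊡ Q ⊡ P ⊡ (P ⊡ Q ⊡ P) ≈⟨ ⊡-assoc (P ⊡ Q ⊡ P) (P ⊡ Q) P ⟨
          P ⊡ Q ⊡ P ⊡ (P ⊡ Q) ⊡ P ≈⟨ ⊡-congʳ (⊡-assoc (P ⊡ Q ⊡ P) P Q) ⟨
          E ⊡ P ⊡ Q ⊡ P           ≈⟨ ⊡-congʳ (⊡-congʳ EP) ⟩
          P ⊡ Q ⊡ P ⊡ Q ⊡ P       ≈⟨ ⊡-congʳ (≐.trans (⊡-congʳ (⊡-assoc P Q P)) (⊡-assoc P (Q ⊡ P) Q)) ⟩
          P ⊡ (Q ⊡ P ⊡ Q) ⊡ P     ≈⟨ ⊡-congʳ (⊡-congˡ QPQ) ⟩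
          P ⊡ Q ⊡ P               ∎ᴹ
        P₁P₁ : (P ⊟ E) ⊡ (P ⊟ E) ≐ P ⊟ E
        P₁P₁ = beginᴹ
          (P ⊟ E) ⊡ (P ⊟ E) ≈⟨ ⊡-distribʳ-⊟ P E (P ⊟ E) ⟩
          P ⊡ (P ⊟ E) ⊟ E ⊡ (P ⊟ E) ≈⟨ ⊟-cong (≐.trans (⊡-distribˡ-⊟ P P E) (⊟-cong PP PE)) (≐.trans (⊡-distribˡ-⊟ E P E) (⊟-self (≐.trans EP (≐.sym EE)))) ⟩
          P ⊟ E ⊟ 0ᴹ ≈⟨ ⊟-zero ≐.refl ⟩
          P ⊟ E ∎ᴹ
      ... | k , tr≡k , _ = suc k , trP , λ ()
        where
        trE : tr (P ⊡ Q ⊡ P) ≡ 1#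
        trE = begin
          tr (P ⊡ Q ⊡ P) ≡⟨ tr-cong (⊡-assoc P Q P) ⟩
          tr (P ⊡ (Q ⊡ P)) ≡⟨ tr-⊡-comm P (Q ⊡ P) ⟩
          tr (Q ⊡ P ⊡ P)   ≡⟨ tr-cong (≐.trans (⊡-assoc Q P P) (⊡-congˡ PP)) ⟩
          tr (Q ⊡ P)       ≡⟨ trQP ⟩
          1#               ∎
        trP : tr P ≡ 1# + fromℕ k
        trP = begin
          tr P                      ≡⟨ x-y+y (tr P) 1# ⟨
          tr P + - 1# + 1#          ≡⟨ cong (λ z → tr P + - z + 1#) trE ⟨
          tr P + - tr (P ⊡ Q ⊡ P) + 1# ≡⟨ cong (_+ 1#) (tr-⊟ P (P ⊡ Q ⊡ P)) ⟨
          tr (P ⊟ P ⊡ Q ⊡ P) + 1#   ≡⟨ cong (_+ 1#) tr≡k ⟩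
          fromℕ k + 1#              ≡⟨ +-comm _ _ ⟩
          1# + fromℕ k              ∎

-- Representations of finite groups

record FiniteGroup : Set where
  infixl 7 _∙_
  infix 8 _⁻
  field
    order : ℕ
    _∙_ : Fin order → Fin order → Fin order
    ε : Fin order
    _⁻ : Fin order → Fin order
    isGroup : IsGroup _≡_ _∙_ ε _⁻

  group : Group 0ℓ 0ℓ
  group = record { isGroup = isGroup }

  open Group group public using (assoc; identityˡ; identityʳ; inverseˡ; inverseʳ)
  open GroupProperties group public using (⁻¹-anti-homo-∙; ⁻¹-involutive; ε⁻¹≈ε; ∙-cancelˡ; ∙-cancelʳ)

  Elem : Set
  Elem = Fin order

  \\-cancel : ∀ x y → x ⁻ ∙ (x ∙ y) ≡ y
  \\-cancel x y = trans (sym (assoc _ _ _)) (trans (cong (_∙ y) (inverseˡ x)) (identityˡ y))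

  ∙-\\ : ∀ x y → x ∙ (x ⁻ ∙ y) ≡ y
  ∙-\\ x y = trans (sym (assoc _ _ _)) (trans (cong (_∙ y) (inverseʳ x)) (identityˡ y))

  ∙-// : ∀ x y → x ∙ y ∙ y ⁻ ≡ x
  ∙-// x y = trans (assoc _ _ _) (trans (cong (x ∙_) (inverseʳ y)) (identityʳ x))

  //-∙ : ∀ x y → x ∙ y ⁻ ∙ y ≡ x
  //-∙ x y = trans (assoc _ _ _) (trans (cong (x ∙_) (inverseˡ y)) (identityʳ x))

  conj-∙ : ∀ y x z → y ⁻ ∙ (x ∙ z) ∙ y ≡ (y ⁻ ∙ x ∙ y) ∙ (y ⁻ ∙ z ∙ y)
  conj-∙ y x z = sym (let open ≡-Reasoning in begin
    (y ⁻ ∙ x ∙ y) ∙ (y ⁻ ∙ z ∙ y)   ≡⟨ cong (y ⁻ ∙ x ∙ y ∙_) (assoc (y ⁻) z y) ⟩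
    (y ⁻ ∙ x ∙ y) ∙ (y ⁻ ∙ (z ∙ y)) ≡⟨ assoc (y ⁻ ∙ x) y _ ⟩
    y ⁻ ∙ x ∙ (y ∙ (y ⁻ ∙ (z ∙ y))) ≡⟨ cong (y ⁻ ∙ x ∙_) (∙-\\ y _) ⟩
    y ⁻ ∙ x ∙ (z ∙ y)               ≡⟨ assoc (y ⁻ ∙ x) z y ⟨
    y ⁻ ∙ x ∙ z ∙ y                 ≡⟨ cong (_∙ y) (assoc (y ⁻) x z) ⟩
    y ⁻ ∙ (x ∙ z) ∙ y               ∎)

  conj-ε : ∀ y → y ⁻ ∙ ε ∙ y ≡ ε
  conj-ε y = trans (cong (_∙ y) (identityʳ _)) (inverseˡ y)

  conj≡ε : ∀ {y x} → y ⁻ ∙ x ∙ y ≡ ε → x ≡ ε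
  conj≡ε {y} {x} eq = ∙-cancelˡ (y ⁻) x ε (∙-cancelʳ y _ _ (trans eq (sym (conj-ε y))))

  -- Subgroups are Boolean predicates on the ambient group, so that representations and class
  -- functions of all subgroups share one carrier and restriction changes no data.
  record Subgroup : Set where
    field
      mem : Elem → Bool
      ε∈ : mem ε ≡ true
      ∙∈ : ∀ {x y} → mem x ≡ true → mem y ≡ true → mem (x ∙ y) ≡ true
      ⁻∈ : ∀ {x} → mem x ≡ true → mem (x ⁻) ≡ true

  open Subgroup public

  infix 4 _∈_
  _∈_ : Elem → Subgroup → Set
  x ∈ S = mem S x ≡ true

  whole : Subgroup
  whole = record { mem = λ _ → true ; ε∈ = refl ; ∙∈ = λ _ _ → refl ; ⁻∈ = λ _ → refl }

  mem-translate : ∀ S {s} → s ∈ S → ∀ x → mem S (s ∙ x) ≡ mem S x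
  mem-translate S {s} s∈ x with mem S x in x?
  ... | true = ∙∈ S s∈ x?
  ... | false with mem S (s ∙ x) in sx?
  ...   | false = refl
  ...   | true = trans (sym (trans (cong (mem S) (sym (\\-cancel s x))) (∙∈ S (⁻∈ S s∈) sx?))) x?

  mem-⁻ : ∀ S x → mem S (x ⁻) ≡ mem S x
  mem-⁻ S x with mem S x in x?
  ... | true = ⁻∈ S x?
  ... | false with mem S (x ⁻) in x⁻?
  ...   | false = refl
  ...   | true = trans (sym (trans (cong (mem S) (sym (⁻¹-involutive x))) (⁻∈ S x⁻?))) x?

module Representations (𝔽 : CharZeroField) (G : FiniteGroup) where
  open LinearAlgebra 𝔽 public
  open FiniteGroup G public
  open ≡-Reasoning

  -- Sums over subgroups

  guard : Bool → F → F
  guard b x = if b then x else 0#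

  guard-+ : ∀ b x y → guard b (x + y) ≡ guard b x + guard b y
  guard-+ true x y = refl
  guard-+ false x y = sym (+-identityˡ 0#)

  guard-*ˡ : ∀ b c x → guard b (c * x) ≡ c * guard b x
  guard-*ˡ true c x = refl
  guard-*ˡ false c x = sym (zeroʳ c)

  guard-zero : ∀ b {x} → x ≡ 0# → guard b x ≡ 0#
  guard-zero true eq = eq
  guard-zero false _ = refl

  guard-sum : ∀ b {n} (f : Fin n → F) → guard b (sum f) ≡ sum (λ i → guard b (f i))
  guard-sum true f = refl
  guard-sum false f = sym (sum-zero λ _ → refl)

  sumG-translate : ∀ s (f : Elem → F) → sum f ≡ sum (λ x → f (s ∙ x))
  sumG-translate s f = sum-bijection f (s ∙_) (s ⁻ ∙_) (∙-\\ s) (\\-cancel s)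

  sumG-⁻ : ∀ (f : Elem → F) → sum f ≡ sum (λ x → f (x ⁻))
  sumG-⁻ f = sum-bijection f _⁻ _⁻ ⁻¹-involutive ⁻¹-involutive

  sumG-conj : ∀ y (f : Elem → F) → sum f ≡ sum (λ x → f (y ⁻ ∙ x ∙ y))
  sumG-conj y f = sum-bijection f (λ x → y ⁻ ∙ x ∙ y) (λ x → y ∙ x ∙ y ⁻)
    (λ x → trans (cong (_∙ y) (trans (cong (y ⁻ ∙_) (assoc y x (y ⁻))) (\\-cancel y _))) (//-∙ x y))
    (λ x → trans (cong (_∙ y ⁻) (trans (cong (y ∙_) (assoc (y ⁻) x y)) (∙-\\ y _))) (∙-// x y))

  opaque
    ΣS : Subgroup → (Elem → F) → F
    ΣS S f = sum λ x → guard (mem S x) (f x)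

  module _ (S : Subgroup) where
    ∣_∣ : F
    ∣_∣ = ΣS S λ _ → 1#

    ΣM : ∀ {m n} → (Elem → Mat m n) → Mat m n
    ΣM M i j = ΣS S λ x → M x i j

  module _ {S : Subgroup} where
    opaque
      unfolding ΣS

      ΣS-def : (f : Elem → F) → ΣS S f ≡ sum λ x → guard (mem S x) (f x)
      ΣS-def f = refl

      ΣS-cong : {f g : Elem → F} → (∀ x → x ∈ S → f x ≡ g x) → ΣS S f ≡ ΣS S g
      ΣS-cong {f} {g} eq = sum-cong pointwise
        where
        pointwise : ∀ x → guard (mem S x) (f x) ≡ guard (mem S x) (g x)
        pointwise x with mem S x in x∈
        ... | true = eq x x∈
        ... | false = refl

      ΣS-+ : (f g : Elem → F) → ΣS S (λ x → f x + g x) ≡ ΣS S f + ΣS S g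
      ΣS-+ f g = trans (sum-cong λ x → guard-+ (mem S x) (f x) (g x)) (sum-+ (λ x → guard (mem S x) (f x)) (λ x → guard (mem S x) (g x)))

      ΣS-*ˡ : ∀ c (f : Elem → F) → ΣS S (λ x → c * f x) ≡ c * ΣS S f
      ΣS-*ˡ c f = trans (sum-cong λ x → guard-*ˡ (mem S x) c (f x)) (sym (*-distribˡ-sum c (λ x → guard (mem S x) (f x))))

      ΣS-*ʳ : ∀ c (f : Elem → F) → ΣS S (λ x → f x * c) ≡ ΣS S f * c
      ΣS-*ʳ c f = trans (ΣS-cong λ x _ → *-comm (f x) c) (trans (ΣS-*ˡ c f) (*-comm c _))

      ΣS-sum : ∀ {n} (f : Elem → Fin n → F) → ΣS S (λ x → sum λ i → f x i) ≡ sum λ i → ΣS S λ x → f x i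
      ΣS-sum f = trans (sum-cong λ x → guard-sum (mem S x) (f x)) (sum-comm λ x i → guard (mem S x) (f x i))

      ΣS-const : ∀ c → ΣS S (λ _ → c) ≡ ∣ S ∣ * c
      ΣS-const c = trans (ΣS-cong λ _ _ → sym (*-identityˡ c)) (ΣS-*ʳ c (λ _ → 1#))

      ΣS-translate : ∀ {s} → s ∈ S → (f : Elem → F) → ΣS S f ≡ ΣS S λ x → f (s ∙ x)
      ΣS-translate {s} s∈ f = trans (sumG-translate s λ x → guard (mem S x) (f x))
        (sum-cong λ x → cong (λ b → guard b (f (s ∙ x))) (mem-translate S s∈ x))

      ΣS-⁻ : (f : Elem → F) → ΣS S f ≡ ΣS S λ x → f (x ⁻)
      ΣS-⁻ f = trans (sumG-⁻ λ x → guard (mem S x) (f x)) (sum-cong λ x → cong (λ b → guard b (f (x ⁻))) (mem-⁻ S x))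

      ∣S∣≢0 : ∣ S ∣ ≢ 0#
      ∣S∣≢0 eq with k , k≡ , k≢0 ← sum-indicator (mem S) = k≢0 ε (ε∈ S) (fromℕ-injective k 0 (trans (sym k≡) eq))

    ΣM-cong : ∀ {m n} {M N : Elem → Mat m n} → (∀ x → x ∈ S → M x ≐ N x) → ΣM S M ≐ ΣM S N
    ΣM-cong eq = mk≐ λ i j → ΣS-cong λ x x∈ → at (eq x x∈) i j

    ⊡-ΣM : ∀ {l m n} (A : Mat l m) (M : Elem → Mat m n) → A ⊡ ΣM S M ≐ ΣM S λ x → A ⊡ M x
    ⊡-ΣM A M = mk≐ λ i j → trans (trans (⊡-at A (ΣM S M) i j) (sum-cong λ k → sym (ΣS-*ˡ (A i k) λ x → M x k j))) (trans (sym (ΣS-sum λ x k → A i k * M x k j)) (ΣS-cong λ x _ → sym (⊡-at A (M x) i j)))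

    ΣM-⊡ : ∀ {l m n} (M : Elem → Mat l m) (A : Mat m n) → ΣM S M ⊡ A ≐ ΣM S λ x → M x ⊡ A
    ΣM-⊡ M A = mk≐ λ i j → trans (trans (⊡-at (ΣM S M) A i j) (sum-cong λ k → sym (ΣS-*ʳ (A k j) λ x → M x i k))) (trans (sym (ΣS-sum λ x k → M x i k * A k j)) (ΣS-cong λ x _ → sym (⊡-at (M x) A i j)))

    ΣM-translate : ∀ {m n s} → s ∈ S → (M : Elem → Mat m n) → ΣM S M ≐ ΣM S λ x → M (s ∙ x)
    ΣM-translate s∈ M = mk≐ λ i j → ΣS-translate s∈ λ x → M x i j

    tr-ΣM : ∀ {n} (M : Elem → Mat n n) → tr (ΣM S M) ≡ ΣS S λ x → tr (M x)
    tr-ΣM M = sym (ΣS-sum λ x i → M x i i)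

  opaque
    1/∣_∣ : Subgroup → F
    1/∣ S ∣ = proj₁ (recip ∣ S ∣ (∣S∣≢0 {S}))

    1/∣S∣-inverse : ∀ S → ∣ S ∣ * 1/∣ S ∣ ≡ 1#
    1/∣S∣-inverse S = proj₂ (recip ∣ S ∣ (∣S∣≢0 {S}))

  module _ {S : Subgroup} where
    1/∣S∣-* : ∀ x → 1/∣ S ∣ * (∣ S ∣ * x) ≡ x
    1/∣S∣-* x = trans (sym (*-assoc _ _ _)) (trans (cong (_* x) (trans (*-comm _ _) (1/∣S∣-inverse S))) (*-identityˡ x))

    mean-const : ∀ c → 1/∣ S ∣ * ΣS S (λ _ → c) ≡ c
    mean-const c = trans (cong (1/∣ S ∣ *_) (ΣS-const c)) (1/∣S∣-* c)

    meanᴹ-const : ∀ {m n} (A : Mat m n) → 1/∣ S ∣ • ΣM S (λ _ → A) ≐ A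
    meanᴹ-const A = mk≐ λ i j → mean-const (A i j)

  -- ρ ε is only required to be idempotent, so that the summand cut out by an
  -- equivariant idempotent P is again a representation of the same degree, x ↦ ρ x ⊡ P.
  record Rep (S : Subgroup) : Set where
    field
      {deg} : ℕ
      ρ : Elem → Mat deg deg
      hom : ∀ {x y} → x ∈ S → y ∈ S → ρ (x ∙ y) ≐ ρ x ⊡ ρ y

    ρ-εˡ : ∀ {x} → x ∈ S → ρ ε ⊡ ρ x ≐ ρ x
    ρ-εˡ {x} x∈ = ≐.trans (≐.sym (hom (ε∈ S) x∈)) (≐.reflexive (cong ρ (identityˡ x)))

    ρ-εʳ : ∀ {x} → x ∈ S → ρ x ⊡ ρ ε ≐ ρ x
    ρ-εʳ {x} x∈ = ≐.trans (≐.sym (hom x∈ (ε∈ S))) (≐.reflexive (cong ρ (identityʳ x)))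

    ρ-⁻ : ∀ {x} → x ∈ S → ρ x ⊡ ρ (x ⁻) ≐ ρ ε
    ρ-⁻ {x} x∈ = ≐.trans (≐.sym (hom x∈ (⁻∈ S x∈))) (≐.reflexive (cong ρ (inverseʳ x)))

    χ : Elem → F
    χ x = tr (ρ x)

  open Rep public using (deg; χ)

  record Character (S : Subgroup) (f : Elem → F) : Set where
    constructor _affords_
    field
      rep : Rep S
      χ≡ : ∀ {x} → x ∈ S → χ rep x ≡ f x

  open Character public

  -- Degrees, summands and intertwiners

  module _ {S : Subgroup} where

    character-cong : ∀ {f g} → (∀ {x} → x ∈ S → f x ≡ g x) → Character S f → Character S g
    character-cong f≡g (R affords eq) = R affords λ x∈ → trans (eq x∈) (f≡g x∈)

    opaque
      -- The degree of the character is the trace of the idempotent `ρ ε`, which may be smaller than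
      -- the matrix size `deg`. If it is zero then `ρ ε` is zero, and with it every ρ x = ρ x ρ ε.
      degree : ∀ {f} → Character S f → ∃ λ k → f ε ≡ fromℕ k × (k ≡ 0 → ∀ {x} → x ∈ S → f x ≡ 0#)
      degree {f} (R affords χ≡f) with k , tr≡k , vanish ← idempotent-trace (Rep.ρ R ε) (Rep.ρ-εˡ R (ε∈ S)) =
        k , trans (sym (χ≡f (ε∈ S))) tr≡k , λ k≡0 {x} x∈ → begin
          f x                         ≡⟨ χ≡f x∈ ⟨
          tr (ρ x)                    ≡⟨ tr-cong (Rep.ρ-εʳ R x∈) ⟨
          tr (ρ x ⊡ ρ ε)              ≡⟨ tr-cong (≐.trans (⊡-congˡ (vanish k≡0)) (⊡-zeroʳ (ρ x))) ⟩
          tr {deg R} 0ᴹ               ≡⟨ sum-zero (λ _ → refl) ⟩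
          0#                          ∎
        where open Rep R using (ρ)

    class-function : ∀ {f} → Character S f → ∀ {x y} → x ∈ S → y ∈ S → f (y ⁻ ∙ x ∙ y) ≡ f x
    class-function {f} (R affords χ≡f) {x} {y} x∈ y∈ = begin
      f (y ⁻ ∙ x ∙ y)              ≡⟨ χ≡f (∙∈ S (∙∈ S (⁻∈ S y∈) x∈) y∈) ⟨
      tr (ρ (y ⁻ ∙ x ∙ y))         ≡⟨ tr-cong (hom (∙∈ S (⁻∈ S y∈) x∈) y∈) ⟩
      tr (ρ (y ⁻ ∙ x) ⊡ ρ y)       ≡⟨ tr-⊡-comm (ρ (y ⁻ ∙ x)) (ρ y) ⟩
      tr (ρ y ⊡ ρ (y ⁻ ∙ x))       ≡⟨ tr-cong (hom y∈ (∙∈ S (⁻∈ S y∈) x∈)) ⟨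
      tr (ρ (y ∙ (y ⁻ ∙ x)))       ≡⟨ cong (tr ∘ ρ) (∙-\\ y x) ⟩
      tr (ρ x)                     ≡⟨ χ≡f x∈ ⟩
      f x                          ∎
      where open Rep R using (ρ; hom)

    module Summand (R : Rep S) (P : Mat (deg R) (deg R)) (PP : P ⊡ P ≐ P)
      (comm : ∀ {x} → x ∈ S → P ⊡ Rep.ρ R x ≐ Rep.ρ R x ⊡ P) where
      open Rep R using (ρ; hom)

      private
        ρ₁ : Elem → Mat (deg R) (deg R)
        ρ₁ x = ρ x ⊡ P

        ρρ₁ : ∀ {x y} → x ∈ S → y ∈ S → ρ x ⊡ ρ₁ y ≐ ρ₁ (x ∙ y)
        ρρ₁ {x} {y} x∈ y∈ = ≐.trans (≐.sym (⊡-assoc (ρ x) (ρ y) P)) (⊡-congʳ (≐.sym (hom x∈ y∈)))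

        ρ₁ρ : ∀ {x y} → x ∈ S → y ∈ S → ρ₁ x ⊡ ρ y ≐ ρ₁ (x ∙ y)
        ρ₁ρ {x} {y} x∈ y∈ = ≐.trans (⊡-assoc (ρ x) P (ρ y)) (≐.trans (⊡-congˡ (comm y∈)) (ρρ₁ x∈ y∈))

        ρ₁ρ₁ : ∀ {x y} → x ∈ S → y ∈ S → ρ₁ x ⊡ ρ₁ y ≐ ρ₁ (x ∙ y)
        ρ₁ρ₁ {x} {y} x∈ y∈ = beginᴹ
          ρ₁ x ⊡ (ρ y ⊡ P)   ≈⟨ ⊡-assoc (ρ₁ x) (ρ y) P ⟨
          ρ₁ x ⊡ ρ y ⊡ P     ≈⟨ ⊡-congʳ (ρ₁ρ x∈ y∈) ⟩
          ρ (x ∙ y) ⊡ P ⊡ P  ≈⟨ ⊡-assoc (ρ (x ∙ y)) P P ⟩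
          ρ (x ∙ y) ⊡ (P ⊡ P) ≈⟨ ⊡-congˡ PP ⟩
          ρ (x ∙ y) ⊡ P      ∎ᴹ

      image complement : Rep S
      image = record { ρ = ρ₁ ; hom = λ x∈ y∈ → ≐.sym (ρ₁ρ₁ x∈ y∈) }
      complement = record
        { ρ = λ x → ρ x ⊟ ρ₁ x
        ; hom = λ {x} {y} x∈ y∈ → ≐.sym (beginᴹ
            (ρ x ⊟ ρ₁ x) ⊡ (ρ y ⊟ ρ₁ y)
              ≈⟨ ⊡-distribʳ-⊟ (ρ x) (ρ₁ x) (ρ y ⊟ ρ₁ y) ⟩
            ρ x ⊡ (ρ y ⊟ ρ₁ y) ⊟ ρ₁ x ⊡ (ρ y ⊟ ρ₁ y)
              ≈⟨ ⊟-cong (≐.trans (⊡-distribˡ-⊟ (ρ x) (ρ y) (ρ₁ y)) (⊟-cong (≐.sym (hom x∈ y∈)) (ρρ₁ x∈ y∈)))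
                        (≐.trans (⊡-distribˡ-⊟ (ρ₁ x) (ρ y) (ρ₁ y)) (⊟-self (≐.trans (ρ₁ρ x∈ y∈) (≐.sym (ρ₁ρ₁ x∈ y∈))))) ⟩
            ρ (x ∙ y) ⊟ ρ₁ (x ∙ y) ⊟ 0ᴹ
              ≈⟨ ⊟-zero ≐.refl ⟩
            ρ (x ∙ y) ⊟ ρ₁ (x ∙ y) ∎ᴹ) }

      χ-decomposition : ∀ x → χ R x ≡ χ image x + χ complement x
      χ-decomposition x = sym (trans (cong (tr (ρ₁ x) +_) (tr-⊟ (ρ x) (ρ₁ x))) (trans (+-comm _ _) (x-y+y (tr (ρ x)) (tr (ρ₁ x)))))

    module Averaging (R R′ : Rep S) where
      open Rep R using (ρ; hom; ρ-εʳ)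
      open Rep R′ using () renaming (ρ to ρ′; hom to hom′)

      average : Mat (deg R′) (deg R) → Mat (deg R′) (deg R)
      average E = ΣM S λ g → ρ′ g ⊡ E ⊡ ρ (g ⁻)

      average-equivariant : ∀ E {s} → s ∈ S → ρ′ s ⊡ average E ≐ average E ⊡ ρ s
      average-equivariant E {s} s∈ = beginᴹ
        ρ′ s ⊡ average E                      ≈⟨ ⊡-ΣM (ρ′ s) (λ g → ρ′ g ⊡ E ⊡ ρ (g ⁻)) ⟩
        ΣM S (λ g → ρ′ s ⊡ (ρ′ g ⊡ E ⊡ ρ (g ⁻)))  ≈⟨ ΣM-cong move ⟩
        ΣM S (λ g → T (s ∙ g))                  ≈⟨ ΣM-translate s∈ T ⟨
        ΣM S T                                  ≈⟨ ΣM-⊡ (λ g → ρ′ g ⊡ E ⊡ ρ (g ⁻)) (ρ s) ⟨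
        average E ⊡ ρ s                       ∎ᴹ
        where
        T : Elem → Mat (deg R′) (deg R)
        T g = ρ′ g ⊡ E ⊡ ρ (g ⁻) ⊡ ρ s
        cancel : ∀ g → (s ∙ g) ⁻ ∙ s ≡ g ⁻
        cancel g = trans (cong (_∙ s) (⁻¹-anti-homo-∙ s g)) (//-∙ (g ⁻) s)
        move : ∀ g → g ∈ S → ρ′ s ⊡ (ρ′ g ⊡ E ⊡ ρ (g ⁻)) ≐ T (s ∙ g)
        move g g∈ = beginᴹ
          ρ′ s ⊡ (ρ′ g ⊡ E ⊡ ρ (g ⁻))    ≈⟨ ⊡-assoc (ρ′ s) (ρ′ g ⊡ E) (ρ (g ⁻)) ⟨
          ρ′ s ⊡ (ρ′ g ⊡ E) ⊡ ρ (g ⁻)    ≈⟨ ⊡-cong (≐.trans (≐.sym (⊡-assoc (ρ′ s) (ρ′ g) E)) (⊡-congʳ (≐.sym (hom′ s∈ g∈)))) (≐.trans (≐.reflexive (cong ρ (sym (cancel g)))) (hom (⁻∈ S (∙∈ S s∈ g∈)) s∈)) ⟩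
          ρ′ (s ∙ g) ⊡ E ⊡ (ρ ((s ∙ g) ⁻) ⊡ ρ s) ≈⟨ ⊡-assoc (ρ′ (s ∙ g) ⊡ E) (ρ ((s ∙ g) ⁻)) (ρ s) ⟨
          T (s ∙ g)                      ∎ᴹ

      -- As `ρ ε` need not be the identity matrix, an intertwiner must be known to live on the image
      -- of `ρ ε`; averages do.
      average-unitʳ : ∀ E → average E ⊡ ρ ε ≐ average E
      average-unitʳ E = ≐.trans (ΣM-⊡ (λ g → ρ′ g ⊡ E ⊡ ρ (g ⁻)) (ρ ε))
        (ΣM-cong λ g g∈ → ≐.trans (⊡-assoc (ρ′ g ⊡ E) (ρ (g ⁻)) (ρ ε)) (⊡-congˡ (ρ-εʳ (⁻∈ S g∈))))

    -- A generalised inverse Y of an intertwiner X becomes an intertwiner by averaging,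
    -- and then YX and XY cut out isomorphic summands.
    module CommonSummand (R R′ : Rep S) (X : Mat (deg R′) (deg R))
      (X-comm : ∀ {s} → s ∈ S → Rep.ρ R′ s ⊡ X ≐ X ⊡ Rep.ρ R s) (X-unit : X ⊡ Rep.ρ R ε ≐ X) where
      open Rep R using (ρ; ρ-⁻)
      open Rep R′ using () renaming (ρ to ρ′)
      open Averaging R′ R

      private
        Y₀ : Mat (deg R) (deg R′)
        Y₀ = proj₁ (generalised-inverse X)

        Y : Mat (deg R) (deg R′)
        Y = 1/∣ S ∣ • average Y₀

        Y-comm : ∀ {s} → s ∈ S → ρ s ⊡ Y ≐ Y ⊡ ρ′ s
        Y-comm {s} s∈ = ≐.trans (⊡-•ʳ (1/∣ S ∣) (ρ s) (average Y₀)) (≐.trans (•-cong _ (average-equivariant Y₀ s∈)) (≐.sym (⊡-•ˡ _ (average Y₀) (ρ′ s))))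

        -- Every term of the average is already a generalised inverse of X: equivariance moves the
        -- group elements outside, where X Y₀ X = X applies, and then they cancel.
        XYX : X ⊡ Y ⊡ X ≐ X
        XYX = beginᴹ
          X ⊡ (1/∣ S ∣ • average Y₀) ⊡ X     ≈⟨ ⊡-congʳ (⊡-•ʳ (1/∣ S ∣) X (average Y₀)) ⟩
          (1/∣ S ∣ • (X ⊡ average Y₀)) ⊡ X   ≈⟨ ⊡-•ˡ (1/∣ S ∣) (X ⊡ average Y₀) X ⟩
          1/∣ S ∣ • (X ⊡ average Y₀ ⊡ X)     ≈⟨ •-cong _ (≐.trans (⊡-congʳ (⊡-ΣM X λ g → ρ g ⊡ Y₀ ⊡ ρ′ (g ⁻))) (ΣM-⊡ (λ g → X ⊡ (ρ g ⊡ Y₀ ⊡ ρ′ (g ⁻))) X)) ⟩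
          1/∣ S ∣ • ΣM S (λ g → X ⊡ (ρ g ⊡ Y₀ ⊡ ρ′ (g ⁻)) ⊡ X) ≈⟨ •-cong _ (ΣM-cong collapse) ⟩
          1/∣ S ∣ • ΣM S (λ _ → X)          ≈⟨ meanᴹ-const X ⟩
          X                                    ∎ᴹ
          where
          collapse : ∀ g → g ∈ S → X ⊡ (ρ g ⊡ Y₀ ⊡ ρ′ (g ⁻)) ⊡ X ≐ X
          collapse g g∈ = beginᴹ
            X ⊡ (ρ g ⊡ Y₀ ⊡ ρ′ (g ⁻)) ⊡ X    ≈⟨ ⊡-congʳ (≐.trans (≐.sym (⊡-assoc X (ρ g ⊡ Y₀) (ρ′ (g ⁻)))) (⊡-congʳ (≐.sym (⊡-assoc X (ρ g) Y₀)))) ⟩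
            X ⊡ ρ g ⊡ Y₀ ⊡ ρ′ (g ⁻) ⊡ X      ≈⟨ ⊡-assoc (X ⊡ ρ g ⊡ Y₀) (ρ′ (g ⁻)) X ⟩
            X ⊡ ρ g ⊡ Y₀ ⊡ (ρ′ (g ⁻) ⊡ X)    ≈⟨ ⊡-cong (⊡-congʳ (≐.sym (X-comm g∈))) (X-comm (⁻∈ S g∈)) ⟩
            ρ′ g ⊡ X ⊡ Y₀ ⊡ (X ⊡ ρ (g ⁻))    ≈⟨ ⊡-assoc (ρ′ g ⊡ X ⊡ Y₀) X (ρ (g ⁻)) ⟨
            ρ′ g ⊡ X ⊡ Y₀ ⊡ X ⊡ ρ (g ⁻)      ≈⟨ ⊡-congʳ (≐.trans (⊡-congʳ (⊡-assoc (ρ′ g) X Y₀)) (⊡-assoc (ρ′ g) (X ⊡ Y₀) X)) ⟩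
            ρ′ g ⊡ (X ⊡ Y₀ ⊡ X) ⊡ ρ (g ⁻)    ≈⟨ ⊡-congʳ (≐.trans (⊡-congˡ (proj₂ (generalised-inverse X))) (X-comm g∈)) ⟩
            X ⊡ ρ g ⊡ ρ (g ⁻)                ≈⟨ ⊡-assoc X (ρ g) (ρ (g ⁻)) ⟩
            X ⊡ (ρ g ⊡ ρ (g ⁻))              ≈⟨ ⊡-congˡ (ρ-⁻ g∈) ⟩
            X ⊡ ρ ε                          ≈⟨ X-unit ⟩
            X                                ∎ᴹ

        YX-idem : Y ⊡ X ⊡ (Y ⊡ X) ≐ Y ⊡ X
        YX-idem = ≐.trans (⊡-assoc Y X (Y ⊡ X)) (⊡-congˡ (≐.trans (≐.sym (⊡-assoc X Y X)) XYX))

        XY-idem : X ⊡ Y ⊡ (X ⊡ Y) ≐ X ⊡ Y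
        XY-idem = ≐.trans (≐.sym (⊡-assoc (X ⊡ Y) X Y)) (⊡-congʳ XYX)

        YX-comm : ∀ {s} → s ∈ S → Y ⊡ X ⊡ ρ s ≐ ρ s ⊡ (Y ⊡ X)
        YX-comm {s} s∈ = beginᴹ
          Y ⊡ X ⊡ ρ s    ≈⟨ ⊡-assoc Y X (ρ s) ⟩
          Y ⊡ (X ⊡ ρ s)  ≈⟨ ⊡-congˡ (X-comm s∈) ⟨
          Y ⊡ (ρ′ s ⊡ X) ≈⟨ ⊡-assoc Y (ρ′ s) X ⟨
          Y ⊡ ρ′ s ⊡ X   ≈⟨ ⊡-congʳ (Y-comm s∈) ⟨
          ρ s ⊡ Y ⊡ X    ≈⟨ ⊡-assoc (ρ s) Y X ⟩
          ρ s ⊡ (Y ⊡ X)  ∎ᴹ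

        XY-comm : ∀ {s} → s ∈ S → X ⊡ Y ⊡ ρ′ s ≐ ρ′ s ⊡ (X ⊡ Y)
        XY-comm {s} s∈ = beginᴹ
          X ⊡ Y ⊡ ρ′ s   ≈⟨ ⊡-assoc X Y (ρ′ s) ⟩
          X ⊡ (Y ⊡ ρ′ s) ≈⟨ ⊡-congˡ (Y-comm s∈) ⟨
          X ⊡ (ρ s ⊡ Y)  ≈⟨ ⊡-assoc X (ρ s) Y ⟨
          X ⊡ ρ s ⊡ Y    ≈⟨ ⊡-congʳ (X-comm s∈) ⟨
          ρ′ s ⊡ X ⊡ Y   ≈⟨ ⊡-assoc (ρ′ s) X Y ⟩
          ρ′ s ⊡ (X ⊡ Y) ∎ᴹ

      module Source = Summand R (Y ⊡ X) YX-idem YX-comm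
      module Target = Summand R′ (X ⊡ Y) XY-idem XY-comm

      images-agree : ∀ {s} → s ∈ S → χ Source.image s ≡ χ Target.image s
      images-agree {s} s∈ = begin
        tr (ρ s ⊡ (Y ⊡ X))  ≡⟨ tr-cong (YX-comm s∈) ⟨
        tr (Y ⊡ X ⊡ ρ s)    ≡⟨ tr-cong (≐.trans (⊡-assoc Y X (ρ s)) (⊡-congˡ (≐.sym (X-comm s∈)))) ⟩
        tr (Y ⊡ (ρ′ s ⊡ X)) ≡⟨ tr-⊡-comm Y (ρ′ s ⊡ X) ⟩
        tr (ρ′ s ⊡ X ⊡ Y)   ≡⟨ tr-cong (⊡-assoc (ρ′ s) X Y) ⟩
        tr (ρ′ s ⊡ (X ⊡ Y)) ∎

      image≢0 : ¬ (X ≐ 0ᴹ) → χ Source.image ε ≢ 0#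
      image≢0 X≢0 tr≡0 with k , tr≡k , vanish ← idempotent-trace (ρ ε ⊡ (Y ⊡ X)) (≐.trans (≐.sym (Rep.hom Source.image (ε∈ S) (ε∈ S))) (≐.reflexive (cong (Rep.ρ Source.image) (identityˡ ε)))) =
        X≢0 (beginᴹ
          X                       ≈⟨ XYX ⟨
          X ⊡ Y ⊡ X               ≈⟨ ⊡-congʳ (⊡-congʳ X-unit) ⟨
          X ⊡ ρ ε ⊡ Y ⊡ X         ≈⟨ ⊡-assoc (X ⊡ ρ ε) Y X ⟩
          X ⊡ ρ ε ⊡ (Y ⊡ X)       ≈⟨ ⊡-assoc X (ρ ε) (Y ⊡ X) ⟩
          X ⊡ (ρ ε ⊡ (Y ⊡ X))     ≈⟨ ⊡-congˡ (vanish (fromℕ-injective k 0 (trans (sym tr≡k) tr≡0))) ⟩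
          X ⊡ 0ᴹ                  ≈⟨ ⊡-zeroʳ X ⟩
          0ᴹ                      ∎ᴹ)

-- Characters

module CharacterTheory (𝔽 : CharZeroField) (G : FiniteGroup) where
  open Representations 𝔽 G public
  open ≡-Reasoning

  -- Inner products of characters

  infix 5 ⟨_∣_⟩_
  opaque
    -- The inverse replaces complex conjugation, which makes the form bilinear and, by the
    -- substitution of x⁻¹ for x, symmetric.
    ⟨_∣_⟩_ : (Elem → F) → (Elem → F) → Subgroup → F
    ⟨ f ∣ g ⟩ S = 1/∣ S ∣ * ΣS S λ x → f (x ⁻) * g x

  sum*sum : ∀ {m n} (f : Fin m → F) (g : Fin n → F) → sum f * sum g ≡ sum λ i → sum λ j → f i * g j
  sum*sum f g = trans (*-distribʳ-sum (sum g) f) (sum-cong λ i → *-distribˡ-sum (f i) g)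

  module _ {S : Subgroup} where

    opaque
      unfolding ⟨_∣_⟩_

      ip-cong : ∀ {f f′ g g′} → (∀ {x} → x ∈ S → f x ≡ f′ x) → (∀ {x} → x ∈ S → g x ≡ g′ x) → ⟨ f ∣ g ⟩ S ≡ ⟨ f′ ∣ g′ ⟩ S
      ip-cong f≡ g≡ = cong (1/∣ S ∣ *_) (ΣS-cong λ x x∈ → cong₂ _*_ (f≡ (⁻∈ S x∈)) (g≡ x∈))

      ip-comm : ∀ f g → ⟨ f ∣ g ⟩ S ≡ ⟨ g ∣ f ⟩ S
      ip-comm f g = cong (1/∣ S ∣ *_) (trans (ΣS-⁻ λ x → f (x ⁻) * g x) (ΣS-cong λ x _ → trans (cong (λ y → f y * g (x ⁻)) (⁻¹-involutive x)) (*-comm _ _)))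

      ip-+ʳ : ∀ f g h → ⟨ f ∣ (λ x → g x + h x) ⟩ S ≡ (⟨ f ∣ g ⟩ S) + (⟨ f ∣ h ⟩ S)
      ip-+ʳ f g h = begin
        1/∣ S ∣ * ΣS S (λ x → f (x ⁻) * (g x + h x))                ≡⟨ cong (1/∣ S ∣ *_) (trans (ΣS-cong λ x _ → distribˡ (f (x ⁻)) (g x) (h x)) (ΣS-+ (λ x → f (x ⁻) * g x) (λ x → f (x ⁻) * h x))) ⟩
        1/∣ S ∣ * (ΣS S (λ x → f (x ⁻) * g x) + ΣS S (λ x → f (x ⁻) * h x)) ≡⟨ distribˡ _ _ _ ⟩
        (⟨ f ∣ g ⟩ S) + (⟨ f ∣ h ⟩ S)                                ∎

      ip-*ʳ : ∀ c f g → ⟨ f ∣ (λ x → c * g x) ⟩ S ≡ c * (⟨ f ∣ g ⟩ S)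
      ip-*ʳ c f g = begin
        1/∣ S ∣ * ΣS S (λ x → f (x ⁻) * (c * g x))  ≡⟨ cong (1/∣ S ∣ *_) (trans (ΣS-cong λ x _ → x*yz≡y*xz (f (x ⁻)) c (g x)) (ΣS-*ˡ c λ x → f (x ⁻) * g x)) ⟩
        1/∣ S ∣ * (c * ΣS S (λ x → f (x ⁻) * g x))  ≡⟨ x*yz≡y*xz _ _ _ ⟩
        c * (⟨ f ∣ g ⟩ S)                           ∎

    -- `α≢0` ensures that cancelling α lowers the degree of both functions, on which the inductions
    -- that cancel common parts run.
    record CommonPart (f g : Elem → F) : Set where
      field
        {α β γ} : Elem → F
        α-character : Character S α
        β-character : Character S β
        γ-character : Character S γ
        α≢0 : α ε ≢ 0#
        f≡α+β : ∀ {x} → x ∈ S → f x ≡ α x + β x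
        g≡α+γ : ∀ {x} → x ∈ S → g x ≡ α x + γ x

    private
      ip-entries : ∀ {f g} (c : Character S f) (c′ : Character S g) → ΣS S (λ x → f (x ⁻) * g x) ≡ sum λ k → sum λ l → ΣS S λ x → Rep.ρ (rep c′) x k k * Rep.ρ (rep c) (x ⁻) l l
      ip-entries {f} {g} (R affords χ≡f) (R′ affords χ′≡g) = begin
        ΣS S (λ x → f (x ⁻) * g x)
          ≡⟨ ΣS-cong (λ x x∈ → trans (*-comm _ _) (cong₂ _*_ (sym (χ′≡g x∈)) (sym (χ≡f (⁻∈ S x∈))))) ⟩
        ΣS S (λ x → tr (ρ′ x) * tr (ρ (x ⁻)))
          ≡⟨ ΣS-cong (λ x x∈ → sum*sum (λ k → ρ′ x k k) (λ l → ρ (x ⁻) l l)) ⟩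
        ΣS S (λ x → sum λ k → sum λ l → ρ′ x k k * ρ (x ⁻) l l)
          ≡⟨ ΣS-sum (λ x k → sum λ l → ρ′ x k k * ρ (x ⁻) l l) ⟩
        sum (λ k → ΣS S λ x → sum λ l → ρ′ x k k * ρ (x ⁻) l l)
          ≡⟨ sum-cong (λ k → ΣS-sum (λ x l → ρ′ x k k * ρ (x ⁻) l l)) ⟩
        sum (λ k → sum λ l → ΣS S λ x → ρ′ x k k * ρ (x ⁻) l l) ∎
        where
        open Rep R using (ρ)
        open Rep R′ using () renaming (ρ to ρ′)

    opaque
      unfolding ⟨_∣_⟩_

      -- Orthogonality of characters read backwards: a non-zero inner product has a non-zero
      -- contribution from some pair of diagonal entries k, l. That contribution is the (k, l) entry
      -- of the averaged matrix unit, which is therefore a non-zero intertwiner.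
      common-part : ∀ {f g} → Character S f → Character S g → ⟨ f ∣ g ⟩ S ≢ 0# → CommonPart f g
      common-part {f} {g} c@(R affords χ≡f) c′@(R′ affords χ′≡g) fg≢0
        with k , k≢0 ← sum-≢0 (λ k → sum λ l → ΣS S λ x → Rep.ρ R′ x k k * Rep.ρ R (x ⁻) l l) (λ eq → fg≢0 (trans (cong (1/∣ S ∣ *_) (trans (ip-entries c c′) eq)) (zeroʳ _)))
        with l , l≢0 ← sum-≢0 (λ l → ΣS S λ x → Rep.ρ R′ x k k * Rep.ρ R (x ⁻) l l) k≢0 = record
        { α-character = Source.image affords λ _ → refl
        ; β-character = Source.complement affords λ _ → refl
        ; γ-character = Target.complement affords λ _ → refl
        ; α≢0 = image≢0 X≢0
        ; f≡α+β = λ {x} x∈ → trans (sym (χ≡f x∈)) (Source.χ-decomposition x)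
        ; g≡α+γ = λ {x} x∈ → trans (sym (χ′≡g x∈)) (trans (Target.χ-decomposition x) (cong (_+ χ Target.complement x) (sym (images-agree x∈))))
        }
        where
        open Averaging R R′
        X : Mat (deg R′) (deg R)
        X = average (unit k l)
        open CommonSummand R R′ X (average-equivariant (unit k l)) (average-unitʳ (unit k l))
        X≢0 : ¬ (X ≐ 0ᴹ)
        X≢0 X≐0 = l≢0 (trans (ΣS-cong λ x _ → sym (⊡-unit-⊡ (Rep.ρ R′ x) k l (Rep.ρ R (x ⁻)) k l)) (at X≐0 k l))

    -- Averaging projections and norms

    module _ (R : Rep S) where
      open Rep R using (ρ; hom)

      -- The projection onto the vectors fixed by S.
      mean : Mat (deg R) (deg R)
      mean = 1/∣ S ∣ • ΣM S ρ

      mean-absorbs : ∀ {s} → s ∈ S → ρ s ⊡ mean ≐ mean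
      mean-absorbs {s} s∈ = beginᴹ
        ρ s ⊡ (1/∣ S ∣ • ΣM S ρ)          ≈⟨ ⊡-•ʳ (1/∣ S ∣) (ρ s) (ΣM S ρ) ⟩
        1/∣ S ∣ • (ρ s ⊡ ΣM S ρ)          ≈⟨ •-cong _ (≐.trans (⊡-ΣM (ρ s) ρ) (ΣM-cong λ x x∈ → ≐.sym (hom s∈ x∈))) ⟩
        1/∣ S ∣ • ΣM S (λ x → ρ (s ∙ x))  ≈⟨ •-cong _ (ΣM-translate s∈ ρ) ⟨
        mean                              ∎ᴹ

      mean-idempotent : mean ⊡ mean ≐ mean
      mean-idempotent = beginᴹ
        (1/∣ S ∣ • ΣM S ρ) ⊡ mean         ≈⟨ ⊡-•ˡ (1/∣ S ∣) (ΣM S ρ) mean ⟩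
        1/∣ S ∣ • (ΣM S ρ ⊡ mean)         ≈⟨ •-cong _ (≐.trans (ΣM-⊡ ρ mean) (ΣM-cong λ x x∈ → mean-absorbs x∈)) ⟩
        1/∣ S ∣ • ΣM S (λ _ → mean)       ≈⟨ meanᴹ-const mean ⟩
        mean                              ∎ᴹ

      tr-mean : tr mean ≡ 1/∣ S ∣ * ΣS S (χ R)
      tr-mean = trans (tr-• (1/∣ S ∣) (ΣM S ρ)) (cong (1/∣ S ∣ *_) (tr-ΣM ρ))

    module _ (R : Rep S) where
      open Rep R using (ρ; hom)

      private
        d = deg R

        -- The matrix of M ↦ ρ(x) M ρ(x⁻¹) on the space of d × d matrices, in the basis of matrix
        -- units.
        T : Elem → (Fin d × Fin d) → (Fin d × Fin d) → F
        T x (i , j) (k , l) = ρ x i k * ρ (x ⁻) l j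

        T-hom : ∀ {x y} → x ∈ S → y ∈ S → ∀ p q → T (x ∙ y) p q ≡ sum λ a → sum λ b → T x p (a , b) * T y (a , b) q
        T-hom {x} {y} x∈ y∈ (i , j) (k , l) = begin
          ρ (x ∙ y) i k * ρ ((x ∙ y) ⁻) l j
            ≡⟨ cong₂ _*_ (trans (at (hom x∈ y∈) i k) (⊡-at (ρ x) (ρ y) i k)) (trans (cong (λ z → ρ z l j) (⁻¹-anti-homo-∙ x y)) (trans (at (hom (⁻∈ S y∈) (⁻∈ S x∈)) l j) (⊡-at (ρ (y ⁻)) (ρ (x ⁻)) l j))) ⟩
          sum (λ a → ρ x i a * ρ y a k) * sum (λ b → ρ (y ⁻) l b * ρ (x ⁻) b j)
            ≡⟨ sum*sum (λ a → ρ x i a * ρ y a k) (λ b → ρ (y ⁻) l b * ρ (x ⁻) b j) ⟩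
          sum (λ a → sum λ b → ρ x i a * ρ y a k * (ρ (y ⁻) l b * ρ (x ⁻) b j))
            ≡⟨ sum-cong (λ a → sum-cong λ b → trans (cong (ρ x i a * ρ y a k *_) (*-comm _ _)) (*-interchange (ρ x i a) (ρ y a k) (ρ (x ⁻) b j) (ρ (y ⁻) l b))) ⟩
          sum (λ a → sum λ b → ρ x i a * ρ (x ⁻) b j * (ρ y a k * ρ (y ⁻) l b)) ∎

      conjugation : Rep S
      conjugation = record
        { ρ = λ x p q → T x (remQuot d p) (remQuot d q)
        ; hom = λ {x} {y} x∈ y∈ → mk≐ λ p q → trans (T-hom x∈ y∈ (remQuot d p) (remQuot d q))
            (trans (sym (sum-remQuot d d λ r → T x (remQuot d p) r * T y r (remQuot d q)))
              (sym (⊡-at (λ p q → T x (remQuot d p) (remQuot d q)) (λ p q → T y (remQuot d p) (remQuot d q)) p q))) }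

      conjugation-χ : ∀ x → χ conjugation x ≡ χ R (x ⁻) * χ R x
      conjugation-χ x = trans (sum-remQuot d d λ r → T x r r) (trans (sym (sum*sum (λ a → ρ x a a) (λ b → ρ (x ⁻) b b))) (*-comm _ _))

      -- Applying the mean to the identity matrix, which is the sum over the index pairs (k, k),
      -- gives the average of ρ(x)ρ(x⁻¹), that is `ρ ε`.
      mean-conjugation≐0 : mean conjugation ≐ 0ᴹ → ρ ε ≐ 0ᴹ
      mean-conjugation≐0 m≐0 = mk≐ λ i j → begin
        ρ ε i j
          ≡⟨ mean-const (ρ ε i j) ⟨
        1/∣ S ∣ * ΣS S (λ _ → ρ ε i j)
          ≡⟨ cong (1/∣ S ∣ *_) (ΣS-cong λ x x∈ → trans (sym (at (Rep.ρ-⁻ R x∈) i j)) (⊡-at (ρ x) (ρ (x ⁻)) i j)) ⟩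
        1/∣ S ∣ * ΣS S (λ x → sum λ k → ρ x i k * ρ (x ⁻) k j)
          ≡⟨ cong (1/∣ S ∣ *_) (ΣS-sum λ x k → ρ x i k * ρ (x ⁻) k j) ⟩
        1/∣ S ∣ * sum (λ k → ΣS S λ x → ρ x i k * ρ (x ⁻) k j)
          ≡⟨ *-distribˡ-sum (1/∣ S ∣) (λ k → ΣS S λ x → ρ x i k * ρ (x ⁻) k j) ⟩
        sum (λ k → 1/∣ S ∣ * ΣS S λ x → ρ x i k * ρ (x ⁻) k j)
          ≡⟨ sum-zero (λ k → trans (cong (1/∣ S ∣ *_) (ΣS-cong λ x _ → sym (cong₂ (T x) (Finₚ.remQuot-combine i j) (Finₚ.remQuot-combine k k)))) (at m≐0 (Fin.combine i j) (Fin.combine k k))) ⟩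
        0# ∎

    opaque
      unfolding ⟨_∣_⟩_

      -- The norm is the dimension of the space of matrices invariant under `conjugation`: it is the
      -- trace of the idempotent projecting onto that space. This gives definiteness without an
      -- order on the field.
      norm : ∀ {f} → Character S f → ∃ λ k → ⟨ f ∣ f ⟩ S ≡ fromℕ k × (k ≡ 0 → f ε ≡ 0#)
      norm {f} (R affords χ≡f) with k , tr≡k , vanish ← idempotent-trace (mean (conjugation R)) (mean-idempotent (conjugation R)) =
        k
        , trans (cong (1/∣ S ∣ *_) (ΣS-cong λ x x∈ → trans (sym (cong₂ _*_ (χ≡f (⁻∈ S x∈)) (χ≡f x∈))) (sym (conjugation-χ R x))))
            (trans (sym (tr-mean (conjugation R))) tr≡k)
        , λ k≡0 → trans (sym (χ≡f (ε∈ S))) (trans (tr-cong (mean-conjugation≐0 R (vanish k≡0))) (sum-zero λ _ → refl))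

    -- Constructions of characters

    restrict : ∀ {f} → Character whole f → Character S f
    restrict (R affords χ≡f) = record { ρ = Rep.ρ R ; hom = λ _ _ → Rep.hom R refl refl } affords λ _ → χ≡f refl

    zero-character : Character S (λ _ → 0#)
    zero-character = record { deg = 0 ; ρ = λ _ → 0ᴹ ; hom = λ _ _ → mk≐ λ () } affords λ _ → sum-zero λ ()

    trivial-character : Character S (λ _ → 1#)
    trivial-character = record { deg = 1 ; ρ = λ _ _ _ → 1# ; hom = λ _ _ → mk≐ λ i j → sym (trans (⊡-at {n = 1} (λ _ _ → 1#) (λ _ _ → 1#) i j) (trans (sum₁ _) (*-identityˡ 1#))) } affords λ _ → sum₁ _
      where
      sum₁ : (f : Fin 1 → F) → sum f ≡ f zero
      sum₁ f = sum-pick f zero λ where zero 0≢0 → contradiction refl 0≢0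

    +-character : ∀ {f g} → Character S f → Character S g → Character S (λ x → f x + g x)
    +-character (R affords χ≡f) (R′ affords χ′≡g) =
      record
        { ρ = λ x p q → block x (splitAt m p) (splitAt m q)
        ; hom = λ {x} {y} x∈ y∈ → mk≐ λ p q → trans (block-hom x∈ y∈ (splitAt m p) (splitAt m q))
            (trans (sym (sum-splitAt m λ r → block x (splitAt m p) r * block y r (splitAt m q)))
              (sym (⊡-at (λ p q → block x (splitAt m p) (splitAt m q)) (λ p q → block y (splitAt m p) (splitAt m q)) p q))) }
      affords λ {x} x∈ → trans (sum-splitAt m λ r → block x r r) (cong₂ _+_ (χ≡f x∈) (χ′≡g x∈))
      where
      m = deg R
      open Rep R using (ρ; hom)
      open Rep R′ using () renaming (ρ to ρ′; hom to hom′)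
      Index : Set
      Index = Fin m ⊎ Fin (deg R′)
      block : Elem → Index → Index → F
      block x (inj₁ i) (inj₁ j) = ρ x i j
      block x (inj₂ i) (inj₂ j) = ρ′ x i j
      block x _ _ = 0#
      block-hom : ∀ {x y} → x ∈ S → y ∈ S → ∀ p q → block (x ∙ y) p q ≡ sum (λ i → block x p (inj₁ i) * block y (inj₁ i) q) + sum (λ j → block x p (inj₂ j) * block y (inj₂ j) q)
      block-hom {x} {y} x∈ y∈ (inj₁ i) (inj₁ j) = sym (trans (cong₂ _+_ (sym (trans (at (hom x∈ y∈) i j) (⊡-at (ρ x) (ρ y) i j))) (sum-zero λ k → zeroˡ _)) (+-identityʳ _))
      block-hom {x} {y} x∈ y∈ (inj₂ i) (inj₂ j) = sym (trans (cong₂ _+_ (sum-zero λ k → zeroˡ _) (sym (trans (at (hom′ x∈ y∈) i j) (⊡-at (ρ′ x) (ρ′ y) i j)))) (+-identityˡ _))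
      block-hom {x} {y} x∈ y∈ (inj₁ i) (inj₂ j) = sym (trans (cong₂ _+_ (sum-zero λ k → zeroʳ _) (sum-zero λ k → zeroˡ _)) (+-identityˡ _))
      block-hom {x} {y} x∈ y∈ (inj₂ i) (inj₁ j) = sym (trans (cong₂ _+_ (sum-zero λ k → zeroˡ _) (sum-zero λ k → zeroʳ _)) (+-identityˡ _))

    ×-character : ∀ k {f} → Character S f → Character S (λ x → fromℕ k * f x)
    ×-character zero c = character-cong (λ _ → sym (zeroˡ _)) zero-character
    ×-character (suc k) {f} c = character-cong (λ {x} _ → sym (trans (distribʳ (f x) 1# (fromℕ k)) (cong (_+ fromℕ k * f x) (*-identityˡ (f x))))) (+-character c (×-character k c))

  module _ (S : Subgroup) where

    -- Left translation on the basis indexed by the whole ambient group, with the rows outside S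
    -- erased. The identity then acts as the projection onto the part indexed by S.
    regular-character : Character S (λ x → δ x ε * ∣ S ∣)
    regular-character = record { ρ = λ h x y → guard (mem S x) (δ x (h ∙ y)) ; hom = reg-hom } affords λ {h} _ → reg-χ h
      where
      reg : Elem → Mat order order
      reg h x y = guard (mem S x) (δ x (h ∙ y))
      reg-hom : ∀ {g h} → g ∈ S → h ∈ S → reg (g ∙ h) ≐ reg g ⊡ reg h
      reg-hom {g} {h} g∈ h∈ = mk≐ λ x z → sym (begin
        (reg g ⊡ reg h) x z ≡⟨ ⊡-at (reg g) (reg h) x z ⟩
        sum (λ y → reg g x y * reg h y z) ≡⟨ sum-pick (λ y → reg g x y * reg h y z) (h ∙ z) (λ y y≢ → trans (cong (reg g x y *_) (guard-zero (mem S y) (δ-≢ y≢))) (zeroʳ _)) ⟩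
        reg g x (h ∙ z) * reg h (h ∙ z) z ≡⟨ cong (λ d → reg g x (h ∙ z) * guard (mem S (h ∙ z)) d) (δ-refl (h ∙ z)) ⟩
        guard (mem S x) (δ x (g ∙ (h ∙ z))) * guard (mem S (h ∙ z)) 1# ≡⟨ diag x z ⟩
        guard (mem S x) (δ x (g ∙ h ∙ z)) ∎)
        where
        diag : ∀ x z → guard (mem S x) (δ x (g ∙ (h ∙ z))) * guard (mem S (h ∙ z)) 1# ≡ guard (mem S x) (δ x (g ∙ h ∙ z))
        diag x z with x Fin.≟ g ∙ h ∙ z
        ... | no x≢ = trans (cong (_* guard (mem S (h ∙ z)) 1#) (guard-zero (mem S x) (δ-≢ (x≢ ∘ λ eq → trans eq (sym (assoc g h z)))))) (trans (zeroˡ _) (sym (guard-zero (mem S x) (δ-≢ x≢))))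
        ... | yes refl rewrite assoc g h z | δ-refl (g ∙ (h ∙ z)) | mem-translate S g∈ (h ∙ z) with mem S (h ∙ z)
        ...   | true = *-identityˡ 1#
        ...   | false = zeroˡ _
      reg-χ : ∀ h → tr (reg h) ≡ δ h ε * ∣ S ∣
      reg-χ h with h Fin.≟ ε
      ... | yes refl = trans (sum-cong λ x → cong (guard (mem S x)) (trans (cong (δ x) (identityˡ x)) (δ-refl x))) (trans (sym (ΣS-def λ _ → 1#)) (sym (trans (cong (_* ∣ S ∣) (δ-refl ε)) (*-identityˡ _))))
      ... | no h≢ε = trans (sum-zero λ x → guard-zero (mem S x) (δ-≢ λ eq → h≢ε (∙-cancelʳ x h ε (trans (sym eq) (sym (identityˡ x)))))) (sym (trans (cong (_* ∣ S ∣) (δ-≢ h≢ε)) (zeroˡ _)))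

    opaque
      unfolding ⟨_∣_⟩_

      ip-regular : ∀ f → ⟨ f ∣ (λ x → δ x ε * ∣ S ∣) ⟩ S ≡ f ε
      ip-regular f = begin
        1/∣ S ∣ * ΣS S (λ x → f (x ⁻) * (δ x ε * ∣ S ∣))   ≡⟨ cong (1/∣ S ∣ *_) (trans (ΣS-def _) (sum-pick _ ε λ x x≢ε → guard-zero (mem S x) (trans (cong (λ d → f (x ⁻) * (d * ∣ S ∣)) (δ-≢ x≢ε)) (trans (cong (f (x ⁻) *_) (zeroˡ _)) (zeroʳ _))))) ⟩
        1/∣ S ∣ * guard (mem S ε) (f (ε ⁻) * (δ ε ε * ∣ S ∣)) ≡⟨ cong (λ b → 1/∣ S ∣ * guard b (f (ε ⁻) * (δ ε ε * ∣ S ∣))) (ε∈ S) ⟩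
        1/∣ S ∣ * (f (ε ⁻) * (δ ε ε * ∣ S ∣))              ≡⟨ cong (1/∣ S ∣ *_) (cong₂ _*_ (cong f ε⁻¹≈ε) (trans (cong (_* ∣ S ∣) (δ-refl ε)) (*-identityˡ _))) ⟩
        1/∣ S ∣ * (f ε * ∣ S ∣)                            ≡⟨ trans (cong (1/∣ S ∣ *_) (*-comm _ _)) (1/∣S∣-* {S} (f ε)) ⟩
        f ε                                                ∎

    induced : (Elem → F) → Elem → F
    induced f x = 1/∣ S ∣ * sum λ y → guard (mem S (y ⁻ ∙ x ∙ y)) (f (y ⁻ ∙ x ∙ y))

    -- No coset representatives are chosen: blocks are indexed by all group elements, and the factor
    -- 1/|S| compensates for the repetition. The identity again acts only as an idempotent.
    induced-character : ∀ {f} → Character S f → Character whole (induced f)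
    induced-character {f} (R affords χ≡f) =
      record
        { ρ = λ g p q → ind g (remQuot {order} d p) (remQuot d q)
        ; hom = λ {g} {h} _ _ → mk≐ λ p q → trans (ind-hom g h (remQuot d p) (remQuot d q))
            (trans (sym (sum-remQuot order d λ r → ind g (remQuot d p) r * ind h r (remQuot d q)))
              (sym (⊡-at (λ p q → ind g (remQuot {order} d p) (remQuot d q)) (λ p q → ind h (remQuot {order} d p) (remQuot d q)) p q))) }
      affords λ {g} _ → begin
        sum (λ p → ind g (remQuot {order} d p) (remQuot d p))  ≡⟨ sum-remQuot order d (λ r → ind g r r) ⟩
        sum (λ x → sum λ a → c * ρ° (x ⁻ ∙ g ∙ x) a a)         ≡⟨ sum-cong (λ x → *-distribˡ-sum c (λ a → ρ° (x ⁻ ∙ g ∙ x) a a)) ⟨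
        sum (λ x → c * sum λ a → ρ° (x ⁻ ∙ g ∙ x) a a)         ≡⟨ *-distribˡ-sum c (λ x → sum λ a → ρ° (x ⁻ ∙ g ∙ x) a a) ⟨
        c * sum (λ x → sum λ a → ρ° (x ⁻ ∙ g ∙ x) a a)         ≡⟨ cong (c *_) (sum-cong λ x → χ° (x ⁻ ∙ g ∙ x)) ⟩
        induced f g                                            ∎
      where
      open Rep R using (ρ; hom)
      d = deg R
      c = 1/∣ S ∣
      ρ° : Elem → Mat d d
      ρ° x a b = guard (mem S x) (ρ x a b)
      χ° : ∀ x → sum (λ a → ρ° x a a) ≡ guard (mem S x) (f x)
      χ° x with mem S x in x∈
      ... | true = χ≡f x∈
      ... | false = sum-zero λ _ → refl
      ind : Elem → (Elem × Fin d) → (Elem × Fin d) → F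
      ind g (x , a) (y , b) = c * ρ° (x ⁻ ∙ g ∙ y) a b
      convolve : ∀ w a b u → sum (λ k → ρ° u a k * ρ° (u ⁻ ∙ w) k b) ≡ guard (mem S u) (ρ° w a b)
      convolve w a b u with mem S u in u∈
      ... | false = sum-zero λ k → zeroˡ _
      ... | true with mem S w in w∈
      ...   | false = sum-zero λ k → trans (cong (λ m → ρ u a k * guard m (ρ (u ⁻ ∙ w) k b)) (trans (mem-translate S (⁻∈ S u∈) w) w∈)) (zeroʳ _)
      ...   | true = begin
        sum (λ k → ρ u a k * guard (mem S (u ⁻ ∙ w)) (ρ (u ⁻ ∙ w) k b)) ≡⟨ sum-cong (λ k → cong (λ m → ρ u a k * guard m (ρ (u ⁻ ∙ w) k b)) u⁻w∈) ⟩
        sum (λ k → ρ u a k * ρ (u ⁻ ∙ w) k b) ≡⟨ ⊡-at (ρ u) (ρ (u ⁻ ∙ w)) a b ⟨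
        (ρ u ⊡ ρ (u ⁻ ∙ w)) a b               ≡⟨ at (hom u∈ u⁻w∈) a b ⟨
        ρ (u ∙ (u ⁻ ∙ w)) a b                 ≡⟨ cong (λ z → ρ z a b) (∙-\\ u w) ⟩
        ρ w a b                               ∎
        where
        u⁻w∈ : mem S (u ⁻ ∙ w) ≡ true
        u⁻w∈ = ∙∈ S (⁻∈ S u∈) w∈
      ind-hom : ∀ g h p q → ind (g ∙ h) p q ≡ sum λ y → sum λ k → ind g p (y , k) * ind h (y , k) q
      ind-hom g h (x , a) (z , b) = sym (begin
        sum (λ y → sum λ k → c * ρ° (x ⁻ ∙ g ∙ y) a k * (c * ρ° (y ⁻ ∙ h ∙ z) k b))
          ≡⟨ sum-cong (λ y → sum-cong λ k → *-interchange c (ρ° (x ⁻ ∙ g ∙ y) a k) c (ρ° (y ⁻ ∙ h ∙ z) k b)) ⟩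
        sum (λ y → sum λ k → c * c * (ρ° (x ⁻ ∙ g ∙ y) a k * ρ° (y ⁻ ∙ h ∙ z) k b))
          ≡⟨ sum-cong (λ y → *-distribˡ-sum (c * c) λ k → ρ° (x ⁻ ∙ g ∙ y) a k * ρ° (y ⁻ ∙ h ∙ z) k b) ⟨
        sum (λ y → c * c * sum λ k → ρ° (x ⁻ ∙ g ∙ y) a k * ρ° (y ⁻ ∙ h ∙ z) k b)
          ≡⟨ *-distribˡ-sum (c * c) (λ y → sum λ k → ρ° (x ⁻ ∙ g ∙ y) a k * ρ° (y ⁻ ∙ h ∙ z) k b) ⟨
        c * c * sum (λ y → sum λ k → ρ° (x ⁻ ∙ g ∙ y) a k * ρ° (y ⁻ ∙ h ∙ z) k b)
          -- The substitution y = g⁻¹xu turns the first factor into `ρ° u`. The sum over u then has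
          -- |S| equal terms, and |S| cancels one of the two factors c.
          ≡⟨ cong (c * c *_) (sumG-translate (g ⁻ ∙ x) λ y → sum λ k → ρ° (x ⁻ ∙ g ∙ y) a k * ρ° (y ⁻ ∙ h ∙ z) k b) ⟩
        c * c * sum (λ u → sum λ k → ρ° (x ⁻ ∙ g ∙ (g ⁻ ∙ x ∙ u)) a k * ρ° ((g ⁻ ∙ x ∙ u) ⁻ ∙ h ∙ z) k b)
          ≡⟨ cong (c * c *_) (sum-cong λ u → sum-cong λ k → cong₂ (λ v w → ρ° v a k * ρ° w k b) (left u) (right u)) ⟩
        c * c * sum (λ u → sum λ k → ρ° u a k * ρ° (u ⁻ ∙ w) k b)
          ≡⟨ cong (c * c *_) (sum-cong (convolve w a b)) ⟩
        c * c * sum (λ u → guard (mem S u) (ρ° w a b))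
          ≡⟨ cong (c * c *_) (trans (sym (ΣS-def λ _ → ρ° w a b)) (ΣS-const {S} (ρ° w a b))) ⟩
        c * c * (∣ S ∣ * ρ° w a b)
          ≡⟨ trans (*-assoc c c _) (cong (c *_) (1/∣S∣-* {S} _)) ⟩
        c * ρ° w a b ∎)
        where
        w = x ⁻ ∙ (g ∙ h) ∙ z
        left : ∀ u → x ⁻ ∙ g ∙ (g ⁻ ∙ x ∙ u) ≡ u
        left u = trans (assoc _ _ _) (trans (cong (x ⁻ ∙_) (trans (cong (g ∙_) (assoc _ _ _)) (∙-\\ g _))) (\\-cancel x u))
        right : ∀ u → (g ⁻ ∙ x ∙ u) ⁻ ∙ h ∙ z ≡ u ⁻ ∙ w
        right u = begin
          (g ⁻ ∙ x ∙ u) ⁻ ∙ h ∙ z          ≡⟨ cong (λ v → v ∙ h ∙ z) (trans (⁻¹-anti-homo-∙ (g ⁻ ∙ x) u) (cong (u ⁻ ∙_) (trans (⁻¹-anti-homo-∙ (g ⁻) x) (cong (x ⁻ ∙_) (⁻¹-involutive g))))) ⟩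
          u ⁻ ∙ (x ⁻ ∙ g) ∙ h ∙ z          ≡⟨ cong (_∙ z) (assoc _ _ _) ⟩
          u ⁻ ∙ (x ⁻ ∙ g ∙ h) ∙ z          ≡⟨ assoc _ _ _ ⟩
          u ⁻ ∙ (x ⁻ ∙ g ∙ h ∙ z)          ≡⟨ cong (λ v → u ⁻ ∙ (v ∙ z)) (assoc _ _ _) ⟩
          u ⁻ ∙ w                          ∎

-- Frobenius' theorem

module FrobeniusTheorem (𝔽 : CharZeroField) (G : FiniteGroup) where
  open CharacterTheory 𝔽 G
  open ≡-Reasoning

  -- Irreducible characters

  module _ {S : Subgroup} where

    degrees : ∀ n {f α β : Elem → F} → Character S α → Character S β → (∀ {x} → x ∈ S → f x ≡ α x + β x) → f ε ≡ fromℕ n → α ε ≢ 0# → ∃ λ m → β ε ≡ fromℕ m × m < n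
    degrees n cα cβ f≡ fε≡n α≢0 with a , α≡a , _ ← degree cα | m , β≡m , _ ← degree cβ =
      m , β≡m , subst (m <_) (sym n≡a+m) (a+m>m a≢0)
      where
      n≡a+m : n ≡ a ℕ.+ m
      n≡a+m = fromℕ-injective n (a ℕ.+ m) (trans (sym fε≡n) (trans (f≡ (ε∈ S)) (trans (cong₂ _+_ α≡a β≡m) (sym (fromℕ-+ a m)))))
      a≢0 : a ≢ 0
      a≢0 refl = α≢0 α≡a
      a+m>m : ∀ {a} → a ≢ 0 → m < a ℕ.+ m
      a+m>m {zero} a≢0 = contradiction refl a≢0
      a+m>m {suc a} _ = s≤s (ℕₚ.m≤n+m m a)

    vanishes : ∀ {f} → Character S f → f ε ≡ 0# → ∀ {x} → x ∈ S → f x ≡ 0#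
    vanishes c fε≡0 with k , f≡k , vanish ← degree c = vanish (fromℕ-injective k 0 (trans (sym f≡k) fε≡0))

    -- Irreducibility over the base field, expressed through characters rather than submodules;
    -- ⟨θ,θ⟩ is then the dimension of an endomorphism algebra and may exceed 1.
    record Irreducible (θ : Elem → F) : Set where
      field
        character : Character S θ
        nonzero : θ ε ≢ 0#
        indecomposable : ∀ {α β} → Character S α → Character S β → (∀ {x} → x ∈ S → θ x ≡ α x + β x) → α ε ≢ 0# → β ε ≡ 0#

    opaque
      -- If ⟨θ,f⟩ is non-zero, the common part of θ and f is all of θ by irreducibility; cancelling
      -- it from f lowers the inner product by exactly ⟨θ,θ⟩ and also lowers the degree.
      multiplicity : ∀ {θ f} → Irreducible θ → Character S f → ∃ λ k → ⟨ θ ∣ f ⟩ S ≡ fromℕ k * (⟨ θ ∣ θ ⟩ S)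
      multiplicity {θ} {f} irr cf = go (proj₁ (degree cf)) (proj₁ (degree cf)) ℕₚ.≤-refl cf (proj₁ (proj₂ (degree cf)))
        where
        open Irreducible irr
        -- `b` bounds the degree `n` and drops in each recursive call, which makes the induction on
        -- the degree structural.
        go : ∀ b n {f} → n ≤ b → Character S f → f ε ≡ fromℕ n → ∃ λ k → ⟨ θ ∣ f ⟩ S ≡ fromℕ k * (⟨ θ ∣ θ ⟩ S)
        go b n {f} n≤b cf fε≡n with ⟨ θ ∣ f ⟩ S ≟ 0#
        ... | yes θf≡0 = 0 , trans θf≡0 (sym (zeroˡ _))
        ... | no θf≢0 with common-part character cf θf≢0
        ...   | cp with degrees n (CommonPart.α-character cp) (CommonPart.γ-character cp) (CommonPart.g≡α+γ cp) fε≡n (CommonPart.α≢0 cp)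
        go zero n n≤0 _ _ | no _ | cp | m , _ , m<n = contradiction (ℕₚ.<-≤-trans m<n n≤0) λ ()
        go (suc b) n n≤b _ _ | no _ | cp | m , γ≡m , m<n
          with k , eq ← go b m (ℕₚ.≤-pred (ℕₚ.<-≤-trans m<n n≤b)) (CommonPart.γ-character cp) γ≡m = suc k , (begin
            ⟨ θ ∣ _ ⟩ S                                    ≡⟨ ip-cong (λ _ → refl) (λ x∈ → trans (g≡α+γ x∈) (cong (_+ _) (sym (θ≡α x∈)))) ⟩
            ⟨ θ ∣ (λ x → θ x + γ x) ⟩ S                    ≡⟨ ip-+ʳ θ θ γ ⟩
            (⟨ θ ∣ θ ⟩ S) + (⟨ θ ∣ γ ⟩ S)                  ≡⟨ cong₂ _+_ (sym (*-identityˡ _)) eq ⟩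
            1# * (⟨ θ ∣ θ ⟩ S) + fromℕ k * (⟨ θ ∣ θ ⟩ S)   ≡⟨ distribʳ _ _ _ ⟨
            fromℕ (suc k) * (⟨ θ ∣ θ ⟩ S)                  ∎)
          where
          open CommonPart cp
          θ≡α : ∀ {x} → x ∈ S → θ x ≡ α x
          θ≡α x∈ = trans (f≡α+β x∈) (trans (cong (_ +_) (vanishes β-character (indecomposable α-character β-character f≡α+β α≢0) x∈)) (+-identityʳ _))

    opaque
      unfolding ⟨_∣_⟩_

      ip-11 : ⟨ (λ _ → 1#) ∣ (λ _ → 1#) ⟩ S ≡ 1#
      ip-11 = trans (mean-const {S} (1# * 1#)) (*-identityˡ 1#)

    trivial-irreducible : Irreducible λ _ → 1#
    trivial-irreducible = record
      { character = trivial-character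
      ; nonzero = 1≢0
      ; indecomposable = λ cα cβ eq α≢0 → case-degree (degrees 1 cα cβ eq (sym (+-identityʳ 1#)) α≢0)
      }
      where
      case-degree : ∀ {y} → (∃ λ m → y ≡ fromℕ m × m < 1) → y ≡ 0#
      case-degree (zero , eq , _) = eq
      case-degree (suc m , _ , s≤s ())

    trivial-multiplicity : ∀ {f} → Character S f → ∃ λ k → ⟨ f ∣ (λ _ → 1#) ⟩ S ≡ fromℕ k
    trivial-multiplicity {f} cf with k , eq ← multiplicity trivial-irreducible cf =
      k , trans (ip-comm f (λ _ → 1#)) (trans eq (trans (cong (fromℕ k *_) ip-11) (*-identityʳ _)))

    -- In place of a decomposition into irreducibles: a character with f(h) ≠ f(1) is itself
    -- irreducible, because both parts of a proper splitting have smaller degree, take equal values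
    -- at h and 1 by induction, and so force f to do the same.
    irreducibles-separate : ∀ {h} → h ∈ S → (∀ {θ} → Irreducible θ → θ h ≡ θ ε) → ∀ {f} → Character S f → f h ≡ f ε
    irreducibles-separate {h} h∈ all-trivial cf = go (proj₁ (degree cf)) (proj₁ (degree cf)) ℕₚ.≤-refl cf (proj₁ (proj₂ (degree cf)))
      where
      go : ∀ b n {f} → n ≤ b → Character S f → f ε ≡ fromℕ n → f h ≡ f ε
      go zero zero n≤b cf fε≡n = trans (vanishes cf fε≡n h∈) (sym fε≡n)
      go (suc b) n {f} n≤b cf fε≡n with f h ≟ f ε
      ... | yes eq = eq
      ... | no f≢ = all-trivial record
        { character = cf
        ; nonzero = λ fε≡0 → f≢ (trans (vanishes cf fε≡0 h∈) (sym fε≡0))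
        ; indecomposable = λ {α} {β} cα cβ eq α≢0 → split cα cβ eq α≢0 (β ε ≟ 0#)
        }
        where
        split : ∀ {α β} → Character S α → Character S β → (∀ {x} → x ∈ S → f x ≡ α x + β x) → α ε ≢ 0# → Dec (β ε ≡ 0#) → β ε ≡ 0#
        split _ _ _ _ (yes β≡0) = β≡0
        split {α} {β} cα cβ eq α≢0 (no β≢0)
          with m , β≡m , m<n ← degrees n cα cβ eq fε≡n α≢0
          with l , α≡l , l<n ← degrees n cβ cα (λ x∈ → trans (eq x∈) (+-comm _ _)) fε≡n β≢0 =
          contradiction (trans (eq h∈) (trans (cong₂ _+_ (go b l (ℕₚ.≤-pred (ℕₚ.<-≤-trans l<n n≤b)) cα α≡l) (go b m (ℕₚ.≤-pred (ℕₚ.<-≤-trans m<n n≤b)) cβ β≡m)) (sym (eq (ε∈ S))))) f≢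

  -- Frobenius reciprocity

  opaque
    unfolding ⟨_∣_⟩_

    -- After exchanging the sums, conjugation by y as a change of variable makes the inner sum
    -- independent of y, because g is a class function; averaging over y then changes nothing.
    reciprocity : ∀ S {g} → (∀ x y → g (y ⁻ ∙ x ∙ y) ≡ g x) → ∀ f → ⟨ g ∣ induced S f ⟩ whole ≡ ⟨ g ∣ f ⟩ S
    reciprocity S {g} class f = begin
      n⁻¹ * ΣS whole (λ x → g (x ⁻) * (c * sum λ y → f° (y ⁻ ∙ x ∙ y)))
        ≡⟨ cong (n⁻¹ *_) (ΣS-def _) ⟩
      n⁻¹ * sum (λ x → g (x ⁻) * (c * sum λ y → f° (y ⁻ ∙ x ∙ y)))
        ≡⟨ cong (n⁻¹ *_) (sum-cong λ x → trans (x*yz≡y*xz (g (x ⁻)) c _) (cong (c *_) (*-distribˡ-sum (g (x ⁻)) λ y → f° (y ⁻ ∙ x ∙ y)))) ⟩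
      n⁻¹ * sum (λ x → c * sum λ y → g (x ⁻) * f° (y ⁻ ∙ x ∙ y))
        ≡⟨ cong (n⁻¹ *_) (sym (*-distribˡ-sum c λ x → sum λ y → g (x ⁻) * f° (y ⁻ ∙ x ∙ y))) ⟩
      n⁻¹ * (c * sum λ x → sum λ y → g (x ⁻) * f° (y ⁻ ∙ x ∙ y))
        ≡⟨ cong (λ z → n⁻¹ * (c * z)) (sum-comm λ x y → g (x ⁻) * f° (y ⁻ ∙ x ∙ y)) ⟩
      n⁻¹ * (c * sum λ y → sum λ x → g (x ⁻) * f° (y ⁻ ∙ x ∙ y))
        ≡⟨ cong (λ z → n⁻¹ * (c * z)) (sum-cong λ y → trans (sum-cong λ x → cong (_* f° (y ⁻ ∙ x ∙ y)) (conj-⁻ x y)) (sym (sumG-conj y λ z → g (z ⁻) * f° z))) ⟩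
      n⁻¹ * (c * sum λ y → sum λ z → g (z ⁻) * f° z)
        ≡⟨ x*yz≡y*xz _ _ _ ⟩
      c * (n⁻¹ * sum λ y → sum λ z → g (z ⁻) * f° z)
        ≡⟨ cong (λ z → c * (n⁻¹ * z)) (ΣS-def _) ⟨
      c * (n⁻¹ * ΣS whole λ _ → sum λ z → g (z ⁻) * f° z)
        ≡⟨ cong (c *_) (mean-const {whole} _) ⟩
      c * sum (λ z → g (z ⁻) * f° z)
        ≡⟨ cong (c *_) (trans (sum-cong λ z → sym (guard-*ˡ (mem S z) (g (z ⁻)) (f z))) (sym (ΣS-def _))) ⟩
      ⟨ g ∣ f ⟩ S ∎
      where
      n⁻¹ c : F
      n⁻¹ = 1/∣ whole ∣
      c = 1/∣ S ∣
      f° : Elem → F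
      f° z = guard (mem S z) (f z)
      conj-⁻ : ∀ x y → g (x ⁻) ≡ g ((y ⁻ ∙ x ∙ y) ⁻)
      conj-⁻ x y = sym (trans (cong g (begin
        (y ⁻ ∙ x ∙ y) ⁻         ≡⟨ ⁻¹-anti-homo-∙ (y ⁻ ∙ x) y ⟩
        y ⁻ ∙ (y ⁻ ∙ x) ⁻       ≡⟨ cong (y ⁻ ∙_) (⁻¹-anti-homo-∙ (y ⁻) x) ⟩
        y ⁻ ∙ (x ⁻ ∙ y ⁻ ⁻)     ≡⟨ cong (λ z → y ⁻ ∙ (x ⁻ ∙ z)) (⁻¹-involutive y) ⟩
        y ⁻ ∙ (x ⁻ ∙ y)         ≡⟨ assoc _ _ _ ⟨
        y ⁻ ∙ x ⁻ ∙ y           ∎)) (class (x ⁻) y))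

  -- Centralisers and the kernel of a malnormal subgroup

  centraliser : Elem → Subgroup
  centraliser x = record
    { mem = λ z → does (z ∙ x Fin.≟ x ∙ z)
    ; ε∈ = commutes→mem (trans (identityˡ x) (sym (identityʳ x)))
    ; ∙∈ = λ {y} {z} y∈ z∈ → commutes→mem (begin
        y ∙ z ∙ x     ≡⟨ assoc y z x ⟩
        y ∙ (z ∙ x)   ≡⟨ cong (y ∙_) (mem→commutes z∈) ⟩
        y ∙ (x ∙ z)   ≡⟨ assoc y x z ⟨
        y ∙ x ∙ z     ≡⟨ cong (_∙ z) (mem→commutes y∈) ⟩
        x ∙ y ∙ z     ≡⟨ assoc x y z ⟩
        x ∙ (y ∙ z)   ∎)
    ; ⁻∈ = λ {y} y∈ → commutes→mem (∙-cancelˡ y _ _ (begin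
        y ∙ (y ⁻ ∙ x) ≡⟨ ∙-\\ y x ⟩
        x             ≡⟨ ∙-// x y ⟨
        x ∙ y ∙ y ⁻   ≡⟨ cong (_∙ y ⁻) (mem→commutes y∈) ⟨
        y ∙ x ∙ y ⁻   ≡⟨ assoc y x (y ⁻) ⟩
        y ∙ (x ∙ y ⁻) ∎))
    }
    where
    commutes→mem : ∀ {z} → z ∙ x ≡ x ∙ z → does (z ∙ x Fin.≟ x ∙ z) ≡ true
    commutes→mem {z} = dec-true (z ∙ x Fin.≟ x ∙ z)
    mem→commutes : ∀ {z} → does (z ∙ x Fin.≟ x ∙ z) ≡ true → z ∙ x ≡ x ∙ z
    mem→commutes {z} = does⁻ (z ∙ x Fin.≟ x ∙ z)

  centraliser-commutes : ∀ {x z} → z ∈ centraliser x → z ∙ x ≡ x ∙ z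
  centraliser-commutes {x} {z} = does⁻ (z ∙ x Fin.≟ x ∙ z)

  self∈centraliser : ∀ x → x ∈ centraliser x
  self∈centraliser x = dec-true (x ∙ x Fin.≟ x ∙ x) refl

  module Malnormal (H : Subgroup) (malnormal : ∀ {h y} → h ∈ H → h ≢ ε → y ⁻ ∙ h ∙ y ∈ H → y ∈ H) where

    -- Membership in the Frobenius kernel as a set: the identity and the elements without a
    -- conjugate in H.
    InKernel : Elem → Set
    InKernel x = ∀ y → y ⁻ ∙ x ∙ y ∈ H → x ≡ ε

    -- Suppose z ≠ 1 commutes with x and has a conjugate z′ in H. The same conjugate x′ of x fixes
    -- z′ under conjugation, so malnormality puts x′ into H, contradicting that x ≠ 1 is in the
    -- kernel.
    centraliser-inKernel : ∀ {x z} → InKernel x → x ≢ ε → z ∈ centraliser x → InKernel z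
    centraliser-inKernel {x} {z} x∈K x≢ε z∈ y y⁻zy∈H with z Fin.≟ ε
    ... | yes z≡ε = z≡ε
    ... | no z≢ε = contradiction (x∈K y (malnormal y⁻zy∈H (z≢ε ∘ conj≡ε) (subst (_∈ H) (sym fixed) y⁻zy∈H))) x≢ε
      where
      x′ = y ⁻ ∙ x ∙ y
      z′ = y ⁻ ∙ z ∙ y
      fixed : x′ ⁻ ∙ z′ ∙ x′ ≡ z′
      fixed = begin
        x′ ⁻ ∙ z′ ∙ x′             ≡⟨ assoc _ _ _ ⟩
        x′ ⁻ ∙ (z′ ∙ x′)           ≡⟨ cong (x′ ⁻ ∙_) (conj-∙ y z x) ⟨
        x′ ⁻ ∙ (y ⁻ ∙ (z ∙ x) ∙ y) ≡⟨ cong (λ w → x′ ⁻ ∙ (y ⁻ ∙ w ∙ y)) (centraliser-commutes z∈) ⟩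
        x′ ⁻ ∙ (y ⁻ ∙ (x ∙ z) ∙ y) ≡⟨ cong (x′ ⁻ ∙_) (conj-∙ y x z) ⟩
        x′ ⁻ ∙ (x′ ∙ z′)           ≡⟨ \\-cancel x′ z′ ⟩
        z′                         ∎

    -- φ = A₀ − B₀ is Ind (θ − θ(1)) + θ(1).
    module Extension {θ : Elem → F} (irr : Irreducible {H} θ) where
      open Irreducible irr

      private
        𝟏 : Elem → F
        𝟏 _ = 1#

        t : ℕ
        t = proj₁ (degree character)

        θε≡t : θ ε ≡ fromℕ t
        θε≡t = proj₁ (proj₂ (degree character))

        A₀ B₀ : Elem → F
        A₀ x = induced H θ x + fromℕ t * 1#
        B₀ x = fromℕ t * induced H 𝟏 x

        A₀-character : Character whole A₀
        A₀-character = +-character (induced-character H character) (×-character t trivial-character)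

        B₀-character : Character whole B₀
        B₀-character = ×-character t (induced-character H trivial-character)

      φ : Elem → F
      φ x = A₀ x + - B₀ x

      private
        A₀≡B₀+φ : ∀ x → A₀ x ≡ B₀ x + φ x
        A₀≡B₀+φ x = sym (trans (+-comm _ _) (x-y+y (A₀ x) (B₀ x)))

        φ-class : ∀ x y → φ (y ⁻ ∙ x ∙ y) ≡ φ x
        φ-class x y = cong₂ (λ a b → a + - b) (class-function A₀-character {x} {y} refl refl) (class-function B₀-character {x} {y} refl refl)

        φ-unique : ∀ {x z} → A₀ x ≡ z + B₀ x → φ x ≡ z
        φ-unique {x} {z} eq = trans (cong (_+ - B₀ x) eq) (x+y-y z (B₀ x))

        ext : (Elem → F) → Elem → F
        ext f z = guard (mem H z) (f z)

      -- A conjugate of x lies in H only if x = 1, where θ and the constant θ(1) agree. So the two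
      -- induced terms cancel and θ(1) remains.
      φ-kernel : ∀ {x} → InKernel x → φ x ≡ θ ε
      φ-kernel {x} x∈K = φ-unique (begin
        induced H θ x + fromℕ t * 1#              ≡⟨ +-comm _ _ ⟩
        fromℕ t * 1# + induced H θ x              ≡⟨ cong₂ _+_ (trans (*-identityʳ _) (sym θε≡t)) (begin
            c * sum (λ y → ext θ (y ⁻ ∙ x ∙ y))             ≡⟨ cong (c *_) (sum-cong term) ⟩
            c * sum (λ y → fromℕ t * ext 𝟏 (y ⁻ ∙ x ∙ y))   ≡⟨ cong (c *_) (*-distribˡ-sum (fromℕ t) λ y → ext 𝟏 (y ⁻ ∙ x ∙ y)) ⟨
            c * (fromℕ t * sum (λ y → ext 𝟏 (y ⁻ ∙ x ∙ y))) ≡⟨ x*yz≡y*xz _ _ _ ⟩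
            fromℕ t * induced H 𝟏 x                         ∎) ⟩
        θ ε + B₀ x                                ∎)
        where
        c = 1/∣ H ∣
        term : ∀ y → ext θ (y ⁻ ∙ x ∙ y) ≡ fromℕ t * ext 𝟏 (y ⁻ ∙ x ∙ y)
        term y with mem H (y ⁻ ∙ x ∙ y) in m
        ... | false = sym (zeroʳ _)
        ... | true = trans (cong θ (trans (cong (λ z → y ⁻ ∙ z ∙ y) (x∈K y m)) (conj-ε y))) (trans θε≡t (sym (*-identityʳ _)))

      -- Conjugating by y ∈ H contributes θ(h) - θ(1) each time. By malnormality y ∉ H contributes
      -- only for h = 1, where θ and the constant θ(1) agree. The subtracted terms are moved to the
      -- other side throughout.
      φ-H : ∀ {h} → h ∈ H → φ h ≡ θ h
      φ-H {h} h∈ = φ-unique (begin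
        c * sum (λ y → ext θ (y ⁻ ∙ h ∙ y)) + fromℕ t * 1#
          ≡⟨ cong (c * sum (λ y → ext θ (y ⁻ ∙ h ∙ y)) +_) (trans (*-identityʳ _) (mean-guard (fromℕ t))) ⟩
        c * sum (λ y → ext θ (y ⁻ ∙ h ∙ y)) + c * sum (λ y → guard (mem H y) (fromℕ t))
          ≡⟨ collect (λ y → ext θ (y ⁻ ∙ h ∙ y)) (λ y → guard (mem H y) (fromℕ t)) ⟩
        c * sum (λ y → ext θ (y ⁻ ∙ h ∙ y) + guard (mem H y) (fromℕ t))
          ≡⟨ cong (c *_) (sum-cong term) ⟩
        c * sum (λ y → guard (mem H y) (θ h) + fromℕ t * ext 𝟏 (y ⁻ ∙ h ∙ y))
          ≡⟨ collect (λ y → guard (mem H y) (θ h)) (λ y → fromℕ t * ext 𝟏 (y ⁻ ∙ h ∙ y)) ⟨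
        c * sum (λ y → guard (mem H y) (θ h)) + c * sum (λ y → fromℕ t * ext 𝟏 (y ⁻ ∙ h ∙ y))
          ≡⟨ cong₂ _+_ (sym (mean-guard (θ h))) (trans (cong (c *_) (sym (*-distribˡ-sum (fromℕ t) λ y → ext 𝟏 (y ⁻ ∙ h ∙ y)))) (x*yz≡y*xz _ _ _)) ⟩
        θ h + B₀ h ∎)
        where
        c = 1/∣ H ∣
        mean-guard : ∀ z → z ≡ c * sum (λ y → guard (mem H y) z)
        mean-guard z = trans (sym (mean-const {H} z)) (cong (c *_) (ΣS-def _))
        collect : ∀ (f g : Elem → F) → c * sum f + c * sum g ≡ c * sum (λ y → f y + g y)
        collect f g = trans (sym (distribˡ c (sum f) (sum g))) (cong (c *_) (sym (sum-+ f g)))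
        outside : ∀ y → mem H y ≡ false → ext θ (y ⁻ ∙ h ∙ y) ≡ fromℕ t * ext 𝟏 (y ⁻ ∙ h ∙ y)
        outside y y∉ with mem H (y ⁻ ∙ h ∙ y) in m
        ... | false = sym (zeroʳ _)
        ... | true with h Fin.≟ ε
        ...   | yes refl = trans (cong θ (conj-ε y)) (trans θε≡t (sym (*-identityʳ _)))
        ...   | no h≢ε = contradiction (trans (sym y∉) (malnormal h∈ h≢ε m)) λ ()
        term : ∀ y → ext θ (y ⁻ ∙ h ∙ y) + guard (mem H y) (fromℕ t) ≡ guard (mem H y) (θ h) + fromℕ t * ext 𝟏 (y ⁻ ∙ h ∙ y)
        term y with mem H y in y∈
        ... | false = trans (+-comm _ _) (cong (0# +_) (outside y y∈))
        ... | true rewrite ∙∈ H (∙∈ H (⁻∈ H y∈) h∈) y∈ = cong₂ _+_ (class-function character h∈ y∈) (sym (*-identityʳ _))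

      private
        -- That is, ⟨g,φ⟩ over G is ⟨g,θ⟩ - t⟨g,1⟩ over H plus t⟨g,1⟩ over G. Written without
        -- subtraction, it becomes an equation between natural numbers when g is the character A
        -- below.
        φ-reciprocity : ∀ {g} → (∀ x y → g (y ⁻ ∙ x ∙ y) ≡ g x) →
          (⟨ g ∣ φ ⟩ whole) + fromℕ t * (⟨ g ∣ 𝟏 ⟩ H) ≡ (⟨ g ∣ θ ⟩ H) + fromℕ t * (⟨ g ∣ 𝟏 ⟩ whole)
        φ-reciprocity {g} class = begin
          (⟨ g ∣ φ ⟩ whole) + fromℕ t * (⟨ g ∣ 𝟏 ⟩ H)
            ≡⟨ +-comm _ _ ⟩
          fromℕ t * (⟨ g ∣ 𝟏 ⟩ H) + (⟨ g ∣ φ ⟩ whole)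
            ≡⟨ cong (_+ (⟨ g ∣ φ ⟩ whole)) (trans (cong (fromℕ t *_) (sym (reciprocity H class 𝟏))) (sym (ip-*ʳ (fromℕ t) g (induced H 𝟏)))) ⟩
          (⟨ g ∣ B₀ ⟩ whole) + (⟨ g ∣ φ ⟩ whole)
            ≡⟨ ip-+ʳ g B₀ φ ⟨
          ⟨ g ∣ (λ x → B₀ x + φ x) ⟩ whole
            ≡⟨ ip-cong {whole} (λ _ → refl) (λ {x} _ → A₀≡B₀+φ x) ⟨
          ⟨ g ∣ A₀ ⟩ whole
            ≡⟨ ip-+ʳ g (induced H θ) (λ _ → fromℕ t * 1#) ⟩
          (⟨ g ∣ induced H θ ⟩ whole) + (⟨ g ∣ (λ _ → fromℕ t * 1#) ⟩ whole)
            ≡⟨ cong₂ _+_ (reciprocity H class θ) (ip-*ʳ (fromℕ t) g 𝟏) ⟩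
          (⟨ g ∣ θ ⟩ H) + fromℕ t * (⟨ g ∣ 𝟏 ⟩ whole) ∎

        ip-φ1 : ⟨ 𝟏 ∣ φ ⟩ whole ≡ ⟨ 𝟏 ∣ θ ⟩ H
        ip-φ1 = +-cancelʳ _ _ _ (trans (cong (λ z → (⟨ 𝟏 ∣ φ ⟩ whole) + fromℕ t * z) (trans (ip-11 {whole}) (sym (ip-11 {H})))) (φ-reciprocity {𝟏} λ _ _ → refl))

        -- Taking g = φ in the reciprocity, the two t-terms cancel: φ restricts to θ, and its inner
        -- product with 1 is the same over G as over H.
        ip-φφ : ⟨ φ ∣ φ ⟩ whole ≡ ⟨ θ ∣ θ ⟩ H
        ip-φφ = +-cancelʳ (fromℕ t * (⟨ φ ∣ 𝟏 ⟩ whole)) _ _ (begin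
          (⟨ φ ∣ φ ⟩ whole) + fromℕ t * (⟨ φ ∣ 𝟏 ⟩ whole)
            ≡⟨ cong (λ z → (⟨ φ ∣ φ ⟩ whole) + fromℕ t * z) (trans (ip-comm φ 𝟏) (trans ip-φ1 (trans (ip-comm 𝟏 θ) (sym (ip-cong φ-H λ _ → refl))))) ⟩
          (⟨ φ ∣ φ ⟩ whole) + fromℕ t * (⟨ φ ∣ 𝟏 ⟩ H)
            ≡⟨ φ-reciprocity φ-class ⟩
          (⟨ φ ∣ θ ⟩ H) + fromℕ t * (⟨ φ ∣ 𝟏 ⟩ whole)
            ≡⟨ cong (_+ fromℕ t * (⟨ φ ∣ 𝟏 ⟩ whole)) (ip-cong φ-H λ _ → refl) ⟩
          (⟨ θ ∣ θ ⟩ H) + fromℕ t * (⟨ φ ∣ 𝟏 ⟩ whole) ∎)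

        s : ℕ
        s = proj₁ (norm character)

        θθ≡s : ⟨ θ ∣ θ ⟩ H ≡ fromℕ s
        θθ≡s = proj₁ (proj₂ (norm character))

        s∣multiplicity : ∀ {f} → Character H f → ∃ λ k → ⟨ f ∣ θ ⟩ H ≡ fromℕ k × s ∣ k
        s∣multiplicity {f} cf with k , eq ← multiplicity irr cf =
          k ℕ.* s , trans (ip-comm f θ) (trans eq (trans (cong (fromℕ k *_) θθ≡s) (sym (fromℕ-* k s)))) , n∣m*n k

        -- The inner product of θ with the regular character of H is θ(1), so the degree is itself
        -- one of the multiples of s.
        s∣t : s ∣ t
        s∣t with k , eq , s∣k ← s∣multiplicity (regular-character H) =
          subst (s ∣_) (fromℕ-injective k t (trans (sym eq) (trans (ip-comm _ θ) (trans (ip-regular H θ) θε≡t)))) s∣k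

        module Orthogonal {A B : Elem → F} (cA : Character whole A) (cB : Character whole B)
          (A≡B+φ : ∀ x → A x ≡ B x + φ x) (AB≡0 : ⟨ A ∣ B ⟩ whole ≡ 0#) where

          a b : ℕ
          a = proj₁ (norm cA)
          b = proj₁ (norm cB)

          AA≡Aφ : ⟨ A ∣ A ⟩ whole ≡ ⟨ A ∣ φ ⟩ whole
          AA≡Aφ = begin
            ⟨ A ∣ A ⟩ whole                          ≡⟨ ip-cong {whole} (λ _ → refl) (λ {x} _ → A≡B+φ x) ⟩
            ⟨ A ∣ (λ x → B x + φ x) ⟩ whole          ≡⟨ ip-+ʳ A B φ ⟩
            (⟨ A ∣ B ⟩ whole) + (⟨ A ∣ φ ⟩ whole)    ≡⟨ cong (_+ (⟨ A ∣ φ ⟩ whole)) AB≡0 ⟩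
            0# + (⟨ A ∣ φ ⟩ whole)                   ≡⟨ +-identityˡ _ ⟩
            ⟨ A ∣ φ ⟩ whole                          ∎

          BB+Bφ≡0 : (⟨ B ∣ B ⟩ whole) + (⟨ B ∣ φ ⟩ whole) ≡ 0#
          BB+Bφ≡0 = begin
            (⟨ B ∣ B ⟩ whole) + (⟨ B ∣ φ ⟩ whole)    ≡⟨ ip-+ʳ B B φ ⟨
            ⟨ B ∣ (λ x → B x + φ x) ⟩ whole          ≡⟨ ip-cong {whole} (λ _ → refl) (λ {x} _ → A≡B+φ x) ⟨
            ⟨ B ∣ A ⟩ whole                          ≡⟨ ip-comm B A ⟩
            ⟨ A ∣ B ⟩ whole                          ≡⟨ AB≡0 ⟩
            0#                                       ∎

          a+b≡s : a ℕ.+ b ≡ s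
          a+b≡s = fromℕ-injective (a ℕ.+ b) s (begin
            fromℕ (a ℕ.+ b)                          ≡⟨ fromℕ-+ a b ⟩
            fromℕ a + fromℕ b                        ≡⟨ cong₂ _+_ (proj₁ (proj₂ (norm cA))) (proj₁ (proj₂ (norm cB))) ⟨
            (⟨ A ∣ A ⟩ whole) + (⟨ B ∣ B ⟩ whole)    ≡⟨ cong (_+ (⟨ B ∣ B ⟩ whole)) (trans AA≡Aφ (trans (ip-comm A φ) (trans (ip-cong {whole} (λ _ → refl) (λ {x} _ → A≡B+φ x)) (ip-+ʳ φ B φ)))) ⟩
            (⟨ φ ∣ B ⟩ whole) + (⟨ φ ∣ φ ⟩ whole) + (⟨ B ∣ B ⟩ whole) ≡⟨ trans (+-comm _ _) (sym (+-assoc _ _ _)) ⟩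
            (⟨ B ∣ B ⟩ whole) + (⟨ φ ∣ B ⟩ whole) + (⟨ φ ∣ φ ⟩ whole) ≡⟨ cong (_+ (⟨ φ ∣ φ ⟩ whole)) (trans (cong ((⟨ B ∣ B ⟩ whole) +_) (ip-comm φ B)) BB+Bφ≡0) ⟩
            0# + (⟨ φ ∣ φ ⟩ whole)                   ≡⟨ +-identityˡ _ ⟩
            ⟨ φ ∣ φ ⟩ whole                          ≡⟨ trans ip-φφ θθ≡s ⟩
            fromℕ s                                  ∎)

          -- Reciprocity with g = A reads a + t k₂ = k₁ + t k₃; here s divides k₁, an inner product
          -- with θ, and divides t.
          s∣a : s ∣ a
          s∣a with k₁ , eq₁ , s∣k₁ ← s∣multiplicity (restrict cA)
                 | k₂ , eq₂ ← trivial-multiplicity {H} (restrict cA)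
                 | k₃ , eq₃ ← trivial-multiplicity cA =
            ∣m+n∣m⇒∣n (subst (s ∣_) (sym nat) (∣m∣n⇒∣m+n s∣k₁ (∣m⇒∣m*n k₃ s∣t))) (∣m⇒∣m*n k₂ s∣t)
            where
            nat : t ℕ.* k₂ ℕ.+ a ≡ k₁ ℕ.+ t ℕ.* k₃
            nat = fromℕ-injective _ _ (begin
              fromℕ (t ℕ.* k₂ ℕ.+ a)               ≡⟨ trans (fromℕ-+ (t ℕ.* k₂) a) (cong (_+ fromℕ a) (fromℕ-* t k₂)) ⟩
              fromℕ t * fromℕ k₂ + fromℕ a         ≡⟨ trans (+-comm _ _) (cong₂ _+_ (sym (trans (sym AA≡Aφ) (proj₁ (proj₂ (norm cA))))) (cong (fromℕ t *_) (sym eq₂))) ⟩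
              (⟨ A ∣ φ ⟩ whole) + fromℕ t * (⟨ A ∣ 𝟏 ⟩ H) ≡⟨ φ-reciprocity (λ x y → class-function cA {x} {y} refl refl) ⟩
              (⟨ A ∣ θ ⟩ H) + fromℕ t * (⟨ A ∣ 𝟏 ⟩ whole) ≡⟨ cong₂ _+_ eq₁ (cong (fromℕ t *_) eq₃) ⟩
              fromℕ k₁ + fromℕ t * fromℕ k₃        ≡⟨ trans (fromℕ-+ k₁ (t ℕ.* k₃)) (cong (fromℕ k₁ +_) (fromℕ-* t k₃)) ⟨
              fromℕ (k₁ ℕ.+ t ℕ.* k₃)              ∎)

          s∣b : s ∣ b
          s∣b = ∣m+n∣m⇒∣n (subst (s ∣_) (sym a+b≡s) (∣-refl)) s∣a

          -- Since s divides b and a + b = s, a non-zero b forces a = 0 and hence A(1) = 0. But A(1)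
          -- = B(1) + θ(1), a sum of natural numbers with θ(1) ≠ 0.
          B-vanishes : ∀ x → B x ≡ 0#
          B-vanishes x with b ℕ.≟ 0
          ... | yes b≡0 = vanishes {whole} cB (proj₂ (proj₂ (norm cB)) b≡0) refl
          ... | no b≢0 = contradiction θε≡0 nonzero
            where
            a≡0 : a ≡ 0
            a≡0 = ℕₚ.n≤0⇒n≡0 (ℕₚ.+-cancelʳ-≤ b a 0 (ℕₚ.≤-trans (ℕₚ.≤-reflexive a+b≡s) (∣⇒≤ {{ℕ.≢-nonZero b≢0}} s∣b)))
            n : ℕ
            n = proj₁ (degree cB)
            n+t≡0 : n ℕ.+ t ≡ 0
            n+t≡0 = fromℕ-injective (n ℕ.+ t) 0 (begin
              fromℕ (n ℕ.+ t)    ≡⟨ fromℕ-+ n t ⟩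
              fromℕ n + fromℕ t  ≡⟨ cong₂ _+_ (sym (proj₁ (proj₂ (degree cB)))) (trans (sym θε≡t) (sym (φ-H (ε∈ H)))) ⟩
              B ε + φ ε          ≡⟨ A≡B+φ ε ⟨
              A ε                ≡⟨ proj₂ (proj₂ (norm cA)) a≡0 ⟩
              0#                 ∎)
            θε≡0 : θ ε ≡ 0#
            θε≡0 = trans θε≡t (cong fromℕ (ℕₚ.m+n≡0⇒n≡0 n n+t≡0))

      opaque
        φ-character : Character whole φ
        φ-character = go (proj₁ (degree A₀-character)) (proj₁ (degree A₀-character)) ℕₚ.≤-refl A₀-character B₀-character A₀≡B₀+φ (proj₁ (proj₂ (degree A₀-character)))
          where
          go : ∀ d n {A B} → n ≤ d → Character whole A → Character whole B → (∀ x → A x ≡ B x + φ x) → A ε ≡ fromℕ n → Character whole φ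
          go d n {A} {B} n≤d cA cB A≡B+φ Aε≡n with ⟨ A ∣ B ⟩ whole ≟ 0#
          ... | yes AB≡0 = character-cong (λ {x} _ → trans (A≡B+φ x) (trans (cong (_+ φ x) (Orthogonal.B-vanishes cA cB A≡B+φ AB≡0 x)) (+-identityˡ _))) cA
          ... | no AB≢0 with common-part cA cB AB≢0
          ...   | cp with degrees n (CommonPart.α-character cp) (CommonPart.β-character cp) (CommonPart.f≡α+β cp) Aε≡n (CommonPart.α≢0 cp)
          go zero n n≤0 _ _ _ _ | no _ | cp | m , _ , m<n = contradiction (ℕₚ.<-≤-trans m<n n≤0) λ ()
          go (suc d) n n≤d _ _ A≡B+φ _ | no _ | cp | m , β≡m , m<n =
            go d m (ℕₚ.≤-pred (ℕₚ.<-≤-trans m<n n≤d)) β-character γ-character β≡γ+φ β≡m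
            where
            open CommonPart cp
            β≡γ+φ : ∀ x → β x ≡ γ x + φ x
            β≡γ+φ x = +-cancelˡ (α x) _ _ (trans (sym (f≡α+β {x} refl)) (trans (A≡B+φ x) (trans (cong (_+ φ x) (g≡α+γ {x} refl)) (+-assoc _ _ _))))

      -- For x ≠ 1, φ is constant on the centraliser C, so the mean Π over C has the trace of `ρ ε`.
      -- Then ρ ε - Π is an idempotent of trace zero, so ρ ε = Π, which absorbs ρ x. The centraliser
      -- is a subgroup inside K containing x that is available before K itself is known to be
      -- closed.
      kernel-acts-trivially : ∀ {x} → InKernel x → Rep.ρ (rep φ-character) x ≐ Rep.ρ (rep φ-character) ε
      kernel-acts-trivially {x} x∈K with x Fin.≟ ε
      ... | yes refl = ≐.refl
      ... | no x≢ε = beginᴹ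
        ρ x          ≈⟨ Rep.ρ-εʳ R {x} refl ⟨
        ρ x ⊡ ρ ε    ≈⟨ ⊡-congˡ ρε≐Π ⟩
        ρ x ⊡ Π      ≈⟨ mean-absorbs R′ (self∈centraliser x) ⟩
        Π            ≈⟨ ρε≐Π ⟨
        ρ ε          ∎ᴹ
        where
        R = rep φ-character
        open Rep R using (ρ)
        C : Subgroup
        C = centraliser x
        R′ : Rep C
        R′ = rep (restrict φ-character)
        Π : Mat (deg R) (deg R)
        Π = mean R′
        D : Mat (deg R) (deg R)
        D = ρ ε ⊟ Π
        εΠ : ρ ε ⊡ Π ≐ Π
        εΠ = mean-absorbs R′ (ε∈ C)
        Πε : Π ⊡ ρ ε ≐ Π
        Πε = ≐.trans (⊡-•ˡ (1/∣ C ∣) (ΣM C ρ) (ρ ε)) (•-cong _ (≐.trans (ΣM-⊡ ρ (ρ ε)) (ΣM-cong λ z _ → Rep.ρ-εʳ R {z} refl)))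
        DD : D ⊡ D ≐ D
        DD = beginᴹ
          (ρ ε ⊟ Π) ⊡ D      ≈⟨ ⊡-distribʳ-⊟ (ρ ε) Π D ⟩
          ρ ε ⊡ D ⊟ Π ⊡ D    ≈⟨ ⊟-cong (≐.trans (⊡-distribˡ-⊟ (ρ ε) (ρ ε) Π) (⊟-cong (Rep.ρ-εʳ R {ε} refl) εΠ)) (≐.trans (⊡-distribˡ-⊟ Π (ρ ε) Π) (⊟-self (≐.trans Πε (≐.sym (mean-idempotent R′))))) ⟩
          D ⊟ 0ᴹ             ≈⟨ ⊟-zero ≐.refl ⟩
          D                  ∎ᴹ
        trΠ : tr Π ≡ tr (ρ ε)
        trΠ = begin
          tr Π                            ≡⟨ tr-mean R′ ⟩
          1/∣ C ∣ * ΣS C (χ R)            ≡⟨ cong (1/∣ C ∣ *_) (ΣS-cong λ z z∈ → trans (χ≡ φ-character refl) (φ-kernel (centraliser-inKernel x∈K x≢ε z∈))) ⟩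
          1/∣ C ∣ * ΣS C (λ _ → θ ε)      ≡⟨ mean-const {C} (θ ε) ⟩
          θ ε                             ≡⟨ φ-H (ε∈ H) ⟨
          φ ε                             ≡⟨ χ≡ φ-character refl ⟨
          tr (ρ ε)                        ∎
        ρε≐Π : ρ ε ≐ Π
        ρε≐Π with k , tr≡k , vanish ← idempotent-trace D DD =
          ⊟≐0⇒≐ (vanish (fromℕ-injective k 0 (trans (sym tr≡k) (trans (tr-⊟ (ρ ε) Π) (trans (cong (λ z → tr (ρ ε) + - z) trΠ) (-‿inverseʳ _))))))

    kernel-⁻ : ∀ {x} → InKernel x → InKernel (x ⁻)
    kernel-⁻ {x} x∈K y x⁻∈ = trans (cong _⁻ (x∈K y (subst (_∈ H) conj-⁻⁻ (⁻∈ H x⁻∈)))) ε⁻¹≈ε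
      where
      conj-⁻⁻ : (y ⁻ ∙ x ⁻ ∙ y) ⁻ ≡ y ⁻ ∙ x ∙ y
      conj-⁻⁻ = begin
        (y ⁻ ∙ x ⁻ ∙ y) ⁻       ≡⟨ ⁻¹-anti-homo-∙ (y ⁻ ∙ x ⁻) y ⟩
        y ⁻ ∙ (y ⁻ ∙ x ⁻) ⁻     ≡⟨ cong (y ⁻ ∙_) (⁻¹-anti-homo-∙ (y ⁻) (x ⁻)) ⟩
        y ⁻ ∙ (x ⁻ ⁻ ∙ y ⁻ ⁻)   ≡⟨ cong₂ (λ u v → y ⁻ ∙ (u ∙ v)) (⁻¹-involutive x) (⁻¹-involutive y) ⟩
        y ⁻ ∙ (x ∙ y)           ≡⟨ assoc _ _ _ ⟨
        y ⁻ ∙ x ∙ y             ∎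

    -- Let h ∈ H be conjugate to xy. Every irreducible θ of H extends to a character of G whose
    -- representation is trivial at x and y, so θ(h) = θ(1); the regular character of H then forces
    -- h = 1.
    kernel-∙ : ∀ {x y} → InKernel x → InKernel y → InKernel (x ∙ y)
    kernel-∙ {x} {y} x∈K y∈K z h∈ with x ∙ y Fin.≟ ε
    ... | yes xy≡ε = xy≡ε
    ... | no xy≢ε = contradiction ∣H∣≡0 (∣S∣≢0 {H})
      where
      h = z ⁻ ∙ (x ∙ y) ∙ z
      all-trivial : ∀ {θ} → Irreducible {H} θ → θ h ≡ θ ε
      all-trivial {θ} irr = begin
        θ h               ≡⟨ φ-H h∈ ⟨
        φ h               ≡⟨ class-function φ-character {x ∙ y} {z} refl refl ⟩
        φ (x ∙ y)         ≡⟨ χ≡ φ-character refl ⟨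
        tr (ρ (x ∙ y))    ≡⟨ tr-cong (≐.trans (hom {x} {y} refl refl) (≐.trans (⊡-cong (kernel-acts-trivially x∈K) (kernel-acts-trivially y∈K)) (Rep.ρ-εʳ (rep φ-character) {ε} refl))) ⟩
        tr (ρ ε)          ≡⟨ χ≡ φ-character refl ⟩
        φ ε               ≡⟨ φ-H (ε∈ H) ⟩
        θ ε               ∎
        where
        open Extension irr
        open Rep (rep φ-character) using (ρ; hom)
      ∣H∣≡0 : ∣ H ∣ ≡ 0#
      ∣H∣≡0 = begin
        ∣ H ∣             ≡⟨ trans (cong (_* ∣ H ∣) (δ-refl ε)) (*-identityˡ _) ⟨
        δ ε ε * ∣ H ∣     ≡⟨ irreducibles-separate h∈ all-trivial (regular-character H) ⟨
        δ h ε * ∣ H ∣     ≡⟨ cong (_* ∣ H ∣) (δ-≢ (xy≢ε ∘ conj≡ε)) ⟩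
        0# * ∣ H ∣        ≡⟨ zeroˡ _ ⟩
        0#                ∎

-- Malnormal subgroups of order two

module MalnormalPair (𝔽 : CharZeroField) (G : FiniteGroup) where
  open FiniteGroup G
  open FrobeniusTheorem 𝔽 G using (module Malnormal)
  open ≡-Reasoning

  record IsMalnormal (H : Subgroup) : Set where
    field
      malnormal : ∀ {h y} → h ∈ H → h ≢ ε → y ⁻ ∙ h ∙ y ∈ H → y ∈ H
      proper : ∃ λ g → ¬ (g ∈ H)

  open IsMalnormal

  HasOrderTwo : Subgroup → Set
  HasOrderTwo H = ∃ λ t → t ∈ H × t ≢ ε × (∀ {x} → x ∈ H → x ≡ ε ⊎ x ≡ t)

  -- If A = {ε, t} is malnormal, then its kernel K is abelian, inverted by t and of index 2.
  module _ {A B : Subgroup} (A-malnormal : IsMalnormal A) (B-malnormal : IsMalnormal B) (A-two : HasOrderTwo A) where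
    open Malnormal A (malnormal A-malnormal)

    private
      t : Elem
      t = proj₁ A-two

      t∈A : t ∈ A
      t∈A = proj₁ (proj₂ A-two)

      t≢ε : t ≢ ε
      t≢ε = proj₁ (proj₂ (proj₂ A-two))

      A-elements : ∀ {x} → x ∈ A → x ≡ ε ⊎ x ≡ t
      A-elements = proj₂ (proj₂ (proj₂ A-two))

      tt : t ∙ t ≡ ε
      tt with A-elements (∙∈ A t∈A t∈A)
      ... | inj₁ eq = eq
      ... | inj₂ eq = contradiction (∙-cancelˡ t t ε (trans eq (sym (identityʳ t)))) t≢ε

      -- An element outside the kernel is conjugate to t and therefore an involution; only this
      -- consequence is recorded.
      kernel? : ∀ g → InKernel g ⊎ (g ≢ ε × g ∙ g ≡ ε)
      kernel? g with g Fin.≟ ε | Finₚ.any? (λ y → mem A (y ⁻ ∙ g ∙ y) Boolₚ.≟ true)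
      ... | yes g≡ε | _ = inj₁ λ _ _ → g≡ε
      ... | no g≢ε | no none = inj₁ λ y y∈ → contradiction (y , y∈) none
      ... | no g≢ε | yes (y , y∈) with A-elements y∈
      ...   | inj₁ eq = contradiction (conj≡ε eq) g≢ε
      ...   | inj₂ eq = inj₂ (g≢ε , conj≡ε (trans (conj-∙ y g g) (trans (cong₂ _∙_ eq eq) tt)))

      -- Otherwise gt is an involution as well, so g commutes with t and lies in A by malnormality.
      -- Then g = t and gt = 1, which is excluded.
      g-times-t : ∀ {g} → g ≢ ε → g ∙ g ≡ ε → InKernel (g ∙ t)
      g-times-t {g} g≢ε gg with kernel? (g ∙ t)
      ... | inj₁ gt∈K = gt∈K
      ... | inj₂ (gt≢ε , gtgt) with A-elements (malnormal A-malnormal {t} {g} t∈A t≢ε (subst (_∈ A) (sym fixed) t∈A))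
        where
        gt≡tg : t ∙ g ≡ g ∙ t
        gt≡tg = begin
          t ∙ g                     ≡⟨ \\-cancel (g ∙ t) (t ∙ g) ⟨
          (g ∙ t) ⁻ ∙ (g ∙ t ∙ (t ∙ g)) ≡⟨ cong ((g ∙ t) ⁻ ∙_) (trans (assoc g t _) (trans (cong (g ∙_) (trans (sym (assoc t t g)) (trans (cong (_∙ g) tt) (identityˡ g)))) gg)) ⟩
          (g ∙ t) ⁻ ∙ ε             ≡⟨ cong ((g ∙ t) ⁻ ∙_) gtgt ⟨
          (g ∙ t) ⁻ ∙ (g ∙ t ∙ (g ∙ t)) ≡⟨ \\-cancel (g ∙ t) (g ∙ t) ⟩
          g ∙ t                     ∎
        fixed : g ⁻ ∙ t ∙ g ≡ t
        fixed = trans (assoc _ _ _) (trans (cong (g ⁻ ∙_) gt≡tg) (\\-cancel g t))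
      ...   | inj₁ g≡ε = contradiction g≡ε g≢ε
      ...   | inj₂ refl = contradiction tt gt≢ε

      -- The product tk is outside the kernel, since otherwise t would lie in it; hence tk is an
      -- involution.
      inverted : ∀ {k} → InKernel k → k ∙ t ∙ k ≡ t
      inverted {k} k∈K with kernel? (t ∙ k)
      ... | inj₁ tk∈K = contradiction (subst InKernel (∙-// t k) (kernel-∙ tk∈K (kernel-⁻ k∈K)) ε (subst (_∈ A) (sym (trans (cong (λ z → z ∙ t ∙ ε) ε⁻¹≈ε) (trans (identityʳ _) (identityˡ t)))) t∈A)) t≢ε
      ... | inj₂ (_ , tktk) = ∙-cancelˡ t _ _ (begin
        t ∙ (k ∙ t ∙ k)   ≡⟨ cong (t ∙_) (assoc k t k) ⟩
        t ∙ (k ∙ (t ∙ k)) ≡⟨ assoc t k (t ∙ k) ⟨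
        t ∙ k ∙ (t ∙ k)   ≡⟨ tktk ⟩
        ε                 ≡⟨ tt ⟨
        t ∙ t             ∎)

      kt : ∀ {k} → InKernel k → k ∙ t ≡ t ∙ k ⁻
      kt {k} k∈K = trans (sym (∙-// (k ∙ t) k)) (cong (_∙ k ⁻) (inverted k∈K))

      -- On the kernel inversion is conjugation by t, hence multiplicative, and a group with
      -- multiplicative inversion is abelian.
      commute : ∀ {k l} → InKernel k → InKernel l → k ⁻ ∙ l ∙ k ≡ l
      commute {k} {l} k∈K l∈K = trans (assoc _ _ _) (trans (cong (k ⁻ ∙_) (sym kl≡lk)) (\\-cancel k l))
        where
        inverses-commute : ∀ {k l} → InKernel k → InKernel l → l ⁻ ∙ k ⁻ ≡ k ⁻ ∙ l ⁻
        inverses-commute {k} {l} k∈K l∈K = ∙-cancelˡ t _ _ (begin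
          t ∙ (l ⁻ ∙ k ⁻)   ≡⟨ cong (t ∙_) (⁻¹-anti-homo-∙ k l) ⟨
          t ∙ (k ∙ l) ⁻     ≡⟨ kt (kernel-∙ k∈K l∈K) ⟨
          k ∙ l ∙ t         ≡⟨ assoc k l t ⟩
          k ∙ (l ∙ t)       ≡⟨ cong (k ∙_) (kt l∈K) ⟩
          k ∙ (t ∙ l ⁻)     ≡⟨ assoc k t (l ⁻) ⟨
          k ∙ t ∙ l ⁻       ≡⟨ cong (_∙ l ⁻) (kt k∈K) ⟩
          t ∙ k ⁻ ∙ l ⁻     ≡⟨ assoc t (k ⁻) (l ⁻) ⟩
          t ∙ (k ⁻ ∙ l ⁻)   ∎)
        kl≡lk : k ∙ l ≡ l ∙ k
        kl≡lk = begin
          k ∙ l             ≡⟨ cong₂ _∙_ (⁻¹-involutive k) (⁻¹-involutive l) ⟨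
          k ⁻ ⁻ ∙ l ⁻ ⁻     ≡⟨ inverses-commute (kernel-⁻ l∈K) (kernel-⁻ k∈K) ⟩
          l ⁻ ⁻ ∙ k ⁻ ⁻     ≡⟨ cong₂ _∙_ (⁻¹-involutive l) (⁻¹-involutive k) ⟩
          l ∙ k             ∎

      -- A non-trivial b in the intersection is centralised by K and inverted by t, so malnormality
      -- of B puts both K and t into B. As K has index two, B would be the whole group.
      B∩K : ∀ {b} → b ∈ B → InKernel b → b ≡ ε
      B∩K {b} b∈B b∈K with b Fin.≟ ε
      ... | yes b≡ε = b≡ε
      ... | no b≢ε = contradiction (B-everything (proj₁ (proper B-malnormal))) (proj₂ (proper B-malnormal))
        where
        K⊆B : ∀ {k} → InKernel k → k ∈ B
        K⊆B k∈K = malnormal B-malnormal b∈B b≢ε (subst (_∈ B) (sym (commute k∈K b∈K)) b∈B)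
        t∈B : t ∈ B
        t∈B = malnormal B-malnormal b∈B b≢ε (subst (_∈ B) (sym (begin
          t ⁻ ∙ b ∙ t     ≡⟨ assoc _ _ _ ⟩
          t ⁻ ∙ (b ∙ t)   ≡⟨ cong (t ⁻ ∙_) (kt b∈K) ⟩
          t ⁻ ∙ (t ∙ b ⁻) ≡⟨ \\-cancel t (b ⁻) ⟩
          b ⁻             ∎)) (⁻∈ B b∈B))
        B-everything : ∀ g → g ∈ B
        B-everything g with kernel? g
        ... | inj₁ g∈K = K⊆B g∈K
        ... | inj₂ (g≢ε , gg) = subst (_∈ B) (∙-// g t) (∙∈ B (K⊆B (g-times-t g≢ε gg)) (⁻∈ B t∈B))

      shift : ∀ {b} → b ∈ B → b ≢ ε → InKernel (b ∙ t)
      shift {b} b∈B b≢ε with kernel? b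
      ... | inj₁ b∈K = contradiction (B∩K b∈B b∈K) b≢ε
      ... | inj₂ (_ , bb) = g-times-t b≢ε bb

    -- By `shift` all non-trivial elements of B lie in the single coset Kt, so the quotient of two
    -- of them lies in B ∩ K and is trivial.
    order-two-transfer : (∃ λ b → b ∈ B × b ≢ ε) → HasOrderTwo B
    order-two-transfer (b , b∈B , b≢ε) = b , b∈B , b≢ε , elements
      where
      elements : ∀ {x} → x ∈ B → x ≡ ε ⊎ x ≡ b
      elements {x} x∈B with x Fin.≟ ε
      ... | yes x≡ε = inj₁ x≡ε
      ... | no x≢ε = inj₂ (∙-cancelʳ (b ⁻) x b (trans (B∩K (∙∈ B x∈B (⁻∈ B b∈B)) (subst InKernel quotient (kernel-∙ (shift x∈B x≢ε) (kernel-⁻ (shift b∈B b≢ε))))) (sym (inverseʳ b))))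
        where
        quotient : x ∙ t ∙ (b ∙ t) ⁻ ≡ x ∙ b ⁻
        quotient = begin
          x ∙ t ∙ (b ∙ t) ⁻      ≡⟨ cong (x ∙ t ∙_) (⁻¹-anti-homo-∙ b t) ⟩
          x ∙ t ∙ (t ⁻ ∙ b ⁻)    ≡⟨ assoc x t _ ⟩
          x ∙ (t ∙ (t ⁻ ∙ b ⁻))  ≡⟨ cong (x ∙_) (∙-\\ t (b ⁻)) ⟩
          x ∙ b ⁻                ∎

-- Frobenius groups of permutations

record FrobeniusAction (G : FiniteGroup) (n : ℕ) : Set where
  open FiniteGroup G
  field
    act : Elem → Fin n → Fin n
    act-∙ : ∀ x y i → act (x ∙ y) i ≡ act x (act y i)
    act-ε : ∀ i → act ε i ≡ i
    transitive : ∀ i j → ∃ λ x → act x i ≡ j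
    fixed-unique : ∀ {x} → x ≢ ε → ∀ i j → act x i ≡ i → act x j ≡ j → i ≡ j

  act-⁻ˡ : ∀ x i → act (x ⁻) (act x i) ≡ i
  act-⁻ˡ x i = trans (sym (act-∙ (x ⁻) x i)) (trans (cong (λ z → act z i) (inverseˡ x)) (act-ε i))

  act-⁻ʳ : ∀ x i → act x (act (x ⁻) i) ≡ i
  act-⁻ʳ x i = trans (sym (act-∙ x (x ⁻) i)) (trans (cong (λ z → act z i) (inverseʳ x)) (act-ε i))

module FrobeniusActionTheory (𝔽 : CharZeroField) {G : FiniteGroup} {n : ℕ} (action : FrobeniusAction G n) (o : Fin n) where
  open CharacterTheory 𝔽 G
  open FrobeniusAction action
  open ≡-Reasoning

  stabiliser : Subgroup
  stabiliser = record
    { mem = λ x → does (act x o Fin.≟ o)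
    ; ε∈ = dec-true (act ε o Fin.≟ o) (act-ε o)
    ; ∙∈ = λ {x} {y} x∈ y∈ → dec-true (act (x ∙ y) o Fin.≟ o) (trans (act-∙ x y o) (trans (cong (act x) (fixes y y∈)) (fixes x x∈)))
    ; ⁻∈ = λ {x} x∈ → dec-true (act (x ⁻) o Fin.≟ o) (trans (cong (act (x ⁻)) (sym (fixes x x∈))) (act-⁻ˡ x o))
    }
    where
    fixes : ∀ x → does (act x o Fin.≟ o) ≡ true → act x o ≡ o
    fixes x = does⁻ (act x o Fin.≟ o)

  stabiliser⁺ : ∀ {x} → act x o ≡ o → x ∈ stabiliser
  stabiliser⁺ {x} = dec-true (act x o Fin.≟ o)

  stabiliser⁻ : ∀ {x} → x ∈ stabiliser → act x o ≡ o
  stabiliser⁻ {x} = does⁻ (act x o Fin.≟ o)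

  conj-fixes⁻ : ∀ y x → act (y ⁻ ∙ x ∙ y) o ≡ o → act x (act y o) ≡ act y o
  conj-fixes⁻ y x eq = begin
    act x (act y o)                     ≡⟨ act-⁻ʳ y _ ⟨
    act y (act (y ⁻) (act x (act y o))) ≡⟨ cong (act y) (trans (cong (act (y ⁻)) (sym (act-∙ x y o))) (sym (act-∙ (y ⁻) (x ∙ y) o))) ⟩
    act y (act (y ⁻ ∙ (x ∙ y)) o)       ≡⟨ cong (λ z → act y (act z o)) (assoc (y ⁻) x y) ⟨
    act y (act (y ⁻ ∙ x ∙ y) o)         ≡⟨ cong (act y) eq ⟩
    act y o                             ∎

  conj-fixes⁺ : ∀ y x → act x (act y o) ≡ act y o → act (y ⁻ ∙ x ∙ y) o ≡ o
  conj-fixes⁺ y x eq = begin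
    act (y ⁻ ∙ x ∙ y) o            ≡⟨ trans (act-∙ (y ⁻ ∙ x) y o) (act-∙ (y ⁻) x (act y o)) ⟩
    act (y ⁻) (act x (act y o))    ≡⟨ cong (act (y ⁻)) eq ⟩
    act (y ⁻) (act y o)            ≡⟨ act-⁻ˡ y o ⟩
    o                              ∎

  -- Such an h fixes both the base point and its image under y, so these two points coincide.
  stabiliser-malnormal : ∀ {h y} → h ∈ stabiliser → h ≢ ε → y ⁻ ∙ h ∙ y ∈ stabiliser → y ∈ stabiliser
  stabiliser-malnormal {h} {y} h∈ h≢ε yhy∈ = stabiliser⁺ (fixed-unique h≢ε (act y o) o (conj-fixes⁻ y h (stabiliser⁻ yhy∈)) (stabiliser⁻ h∈))

  open FrobeniusTheorem.Malnormal 𝔽 G stabiliser stabiliser-malnormal using (InKernel; kernel-∙; kernel-⁻)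

  InK : Elem → Set
  InK x = ∀ i → act x i ≡ i → x ≡ ε

  private
    toK : ∀ {x} → InKernel x → InK x
    toK {x} x∈ i fix with y , refl ← transitive o i = x∈ y (stabiliser⁺ (conj-fixes⁺ y x fix))

    fromK : ∀ {x} → InK x → InKernel x
    fromK {x} x∈ y yxy∈ = x∈ (act y o) (conj-fixes⁻ y x (stabiliser⁻ yxy∈))

  K-ε : InK ε
  K-ε _ _ = refl

  K-∙ : ∀ {x y} → InK x → InK y → InK (x ∙ y)
  K-∙ x∈ y∈ = toK (kernel-∙ (fromK x∈) (fromK y∈))

  K-⁻ : ∀ {x} → InK x → InK (x ⁻)
  K-⁻ x∈ = toK (kernel-⁻ (fromK x∈))

  K-conj : ∀ {z} x → InK z → InK (x ∙ z ∙ x ⁻)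
  K-conj {z} x z∈ i fix = begin
    x ∙ z ∙ x ⁻ ≡⟨ cong (λ w → x ∙ w ∙ x ⁻) (z∈ (act (x ⁻) i) fix′) ⟩
    x ∙ ε ∙ x ⁻ ≡⟨ cong (_∙ x ⁻) (identityʳ x) ⟩
    x ∙ x ⁻     ≡⟨ inverseʳ x ⟩
    ε           ∎
    where
    fix′ : act z (act (x ⁻) i) ≡ act (x ⁻) i
    fix′ = begin
      act z (act (x ⁻) i)                     ≡⟨ act-⁻ˡ x _ ⟨
      act (x ⁻) (act x (act z (act (x ⁻) i))) ≡⟨ cong (act (x ⁻)) (trans (cong (act x) (sym (act-∙ z (x ⁻) i))) (sym (act-∙ x (z ∙ x ⁻) i))) ⟩
      act (x ⁻) (act (x ∙ (z ∙ x ⁻)) i)       ≡⟨ cong (λ w → act (x ⁻) (act w i)) (assoc x z (x ⁻)) ⟨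
      act (x ⁻) (act (x ∙ z ∙ x ⁻) i)         ≡⟨ cong (act (x ⁻)) fix ⟩
      act (x ⁻) i                             ∎

  data KernelView (x : Elem) : Bool → Set where
    identity : x ≡ ε → KernelView x true
    deranged : x ≢ ε → (∀ i → act x i ≢ i) → KernelView x true
    fixing   : x ≢ ε → ∀ i → act x i ≡ i → KernelView x false

  kernelView : ∀ x → ∃ (KernelView x)
  kernelView x with x Fin.≟ ε | Finₚ.any? (λ i → act x i Fin.≟ i)
  ... | yes x≡ε | _ = true , identity x≡ε
  ... | no x≢ε | yes (i , fix) = false , fixing x≢ε i fix
  ... | no x≢ε | no none = true , deranged x≢ε λ i fix → none (i , fix)

  -- Regularity of the kernel, by counting

  private
    inK? : Elem → Bool
    inK? x = proj₁ (kernelView x)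

    inK?-sound : ∀ x → inK? x ≡ true → InK x
    inK?-sound x eq with kernelView x
    ... | true , identity refl = K-ε
    ... | true , deranged _ none = λ i fix → contradiction fix (none i)

    K-injective : ∀ {x y} → InK x → InK y → act x o ≡ act y o → x ≡ y
    K-injective {x} {y} x∈ y∈ eq = ∙-cancelˡ (y ⁻) x y (trans (K-∙ (K-⁻ y∈) x∈ o (trans (act-∙ (y ⁻) x o) (trans (cong (act (y ⁻)) eq) (act-⁻ˡ y o)))) (sym (inverseˡ y)))

    #points #G #K : F
    #points = sum {n} λ _ → 1#
    #G = sum {order} λ _ → 1#
    #K = sum λ x → guard (inK? x) 1#

    δ-sum : ∀ {m} (k : Fin m) → sum (δ k) ≡ 1#
    δ-sum k = trans (sum-pick (δ k) k λ i i≢k → δ-≢ (i≢k ∘ sym)) (δ-refl k)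

    fix : Elem → F
    fix x = sum λ i → δ (act x i) i

    -- Burnside's count, by moving i to o with a right translation.
    sum-fix : sum fix ≡ #G
    sum-fix = begin
      sum (λ x → sum λ i → δ (act x i) i)    ≡⟨ sum-comm (λ x i → δ (act x i) i) ⟩
      sum (λ i → sum λ x → δ (act x i) i)    ≡⟨ sum-cong translate ⟩
      sum (λ i → sum λ x → δ (act x o) i)    ≡⟨ sum-comm (λ i x → δ (act x o) i) ⟩
      sum (λ x → sum λ i → δ (act x o) i)    ≡⟨ sum-cong (λ x → δ-sum (act x o)) ⟩
      #G                                     ∎
      where
      translate : ∀ i → sum (λ x → δ (act x i) i) ≡ sum λ x → δ (act x o) i
      translate i with y , yo≡i ← transitive o i = trans
        (sum-cong λ x → cong (λ j → δ j i) (trans (cong (act x) (sym yo≡i)) (sym (act-∙ x y o))))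
        (sym (sum-bijection (λ x → δ (act x o) i) (_∙ y) (_∙ y ⁻) (λ x → //-∙ x y) (λ x → ∙-// x y)))

    -- A non-identity element is either in K without fixed points or outside K with exactly one,
    -- while the identity is in K and fixes all n points. Summed over G and compared with Burnside's
    -- count, this yields |K| = n.
    inK-plus-fix : ∀ x → guard (inK? x) 1# + fix x ≡ 1# + δ x ε * #points
    inK-plus-fix x with kernelView x
    ... | true , identity refl = cong (1# +_) (trans (sum-cong λ i → trans (cong (λ j → δ j i) (act-ε i)) (δ-refl i)) (sym (trans (cong (_* #points) (δ-refl ε)) (*-identityˡ _))))
    ... | true , deranged x≢ε none = cong (1# +_) (trans (sum-zero λ i → δ-≢ (none i)) (sym (trans (cong (_* #points) (δ-≢ x≢ε)) (zeroˡ _))))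
    ... | false , fixing x≢ε i fixi = begin
      0# + fix x              ≡⟨ +-identityˡ _ ⟩
      fix x                   ≡⟨ sum-pick (λ j → δ (act x j) j) i (λ j j≢i → δ-≢ λ fixj → j≢i (fixed-unique x≢ε j i fixj fixi)) ⟩
      δ (act x i) i           ≡⟨ trans (cong (λ j → δ j i) fixi) (δ-refl i) ⟩
      1#                      ≡⟨ +-identityʳ 1# ⟨
      1# + 0#                 ≡⟨ cong (1# +_) (trans (cong (_* #points) (δ-≢ x≢ε)) (zeroˡ _)) ⟨
      1# + δ x ε * #points    ∎

    #K≡#points : #K ≡ #points
    #K≡#points = +-cancelʳ #G #K #points (begin
      #K + #G                                 ≡⟨ cong (#K +_) sum-fix ⟨
      #K + sum fix                            ≡⟨ sum-+ (λ x → guard (inK? x) 1#) fix ⟨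
      sum (λ x → guard (inK? x) 1# + fix x)   ≡⟨ sum-cong inK-plus-fix ⟩
      sum (λ x → 1# + δ x ε * #points)        ≡⟨ sum-+ (λ _ → 1#) (λ x → δ x ε * #points) ⟩
      #G + sum (λ x → δ x ε * #points)        ≡⟨ cong (#G +_) (trans (sum-pick (λ x → δ x ε * #points) ε λ x x≢ε → trans (cong (_* #points) (δ-≢ x≢ε)) (zeroˡ _)) (trans (cong (_* #points) (δ-refl ε)) (*-identityˡ _))) ⟩
      #G + #points                            ≡⟨ +-comm _ _ ⟩
      #points + #G                            ∎)

    hit? : ∀ i → Dec (∃ λ k → inK? k ≡ true × act k o ≡ i)
    hit? i = Finₚ.any? λ k → (inK? k Boolₚ.≟ true) ×-dec (act k o Fin.≟ i)

    missing : Fin n → Bool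
    missing i = not (does (hit? i))

    hits : Fin n → F
    hits i = sum λ x → guard (inK? x) (δ (act x o) i)

    missing-plus-hits : ∀ i → (if missing i then 1# else 0#) + hits i ≡ 1#
    missing-plus-hits i with hit? i
    ... | no none = trans (cong (1# +_) (sum-zero zero-term)) (+-identityʳ 1#)
      where
      zero-term : ∀ x → guard (inK? x) (δ (act x o) i) ≡ 0#
      zero-term x with inK? x in x∈
      ... | false = refl
      ... | true = δ-≢ λ eq → none (x , x∈ , eq)
    ... | yes (k , k∈ , refl) = trans (+-identityˡ _) (trans (sum-pick (λ x → guard (inK? x) (δ (act x o) (act k o))) k zero-term) (trans (cong (λ b → guard b (δ (act k o) (act k o))) k∈) (δ-refl _)))
      where
      zero-term : ∀ x → x ≢ k → guard (inK? x) (δ (act x o) (act k o)) ≡ 0#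
      zero-term x x≢k with inK? x in x∈
      ... | false = refl
      ... | true = δ-≢ λ eq → x≢k (K-injective (inK?-sound x x∈) (inK?-sound k k∈) eq)

    sum-hits : sum hits ≡ #points
    sum-hits = begin
      sum (λ i → sum λ x → guard (inK? x) (δ (act x o) i)) ≡⟨ sum-comm (λ i x → guard (inK? x) (δ (act x o) i)) ⟩
      sum (λ x → sum λ i → guard (inK? x) (δ (act x o) i)) ≡⟨ sum-cong (λ x → trans (sym (guard-sum (inK? x) (δ (act x o)))) (cong (guard (inK? x)) (δ-sum (act x o)))) ⟩
      #K                                                   ≡⟨ #K≡#points ⟩
      #points                                              ∎

  opaque
    -- Pigeonhole in the field: distinct elements of K move the base point to distinct places, so
    -- the n elements of K hit n points and the count of missed points is zero.
    K-transitive : ∀ i → ∃ λ k → InK k × act k o ≡ i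
    K-transitive i with hit? i in eq
    ... | yes (k , k∈ , ko≡i) = k , inK?-sound k k∈ , ko≡i
    ... | no _ with m , m≡ , m≢0 ← sum-indicator missing = contradiction (fromℕ-injective m 0 (trans (sym m≡) none-missing)) (m≢0 i (cong (not ∘ does) eq))
      where
      none-missing : sum (λ i → if missing i then 1# else 0#) ≡ 0#
      none-missing = +-cancelʳ #points _ _ (begin
        sum (λ i → if missing i then 1# else 0#) + #points   ≡⟨ cong (sum (λ i → if missing i then 1# else 0#) +_) sum-hits ⟨
        sum (λ i → if missing i then 1# else 0#) + sum hits  ≡⟨ sum-+ (λ i → if missing i then 1# else 0#) hits ⟨
        sum (λ i → (if missing i then 1# else 0#) + hits i)  ≡⟨ sum-cong missing-plus-hits ⟩
        #points                                              ≡⟨ +-identityˡ _ ⟨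
        0# + #points                                         ∎)

  -- The factorisation G = KH

  -- The factor in K is the kernel element that moves the base point to the same place as x; what
  -- remains is in the stabiliser.
  kernelPart complementPart : Elem → Elem
  kernelPart x = proj₁ (K-transitive (act x o))
  complementPart x = kernelPart x ⁻ ∙ x

  complementPart-fixes : ∀ x → act (complementPart x) o ≡ o
  complementPart-fixes x = trans (act-∙ (kernelPart x ⁻) x o) (trans (cong (act (kernelPart x ⁻)) (sym (proj₂ (proj₂ (K-transitive (act x o)))))) (act-⁻ˡ (kernelPart x) o))

  complementPart≡⇒K : ∀ x y → complementPart x ≡ complementPart y → InK (x ∙ y ⁻)
  complementPart≡⇒K x y eq = subst InK (sym (begin
    x ∙ y ⁻               ≡⟨ cong₂ (λ u v → u ∙ v ⁻) (∙-\\ k x) (∙-\\ l y) ⟨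
    k ∙ (k ⁻ ∙ x) ∙ (l ∙ (l ⁻ ∙ y)) ⁻ ≡⟨ cong (λ w → k ∙ w ∙ (l ∙ (l ⁻ ∙ y)) ⁻) eq ⟩
    k ∙ h ∙ (l ∙ h) ⁻     ≡⟨ cong (k ∙ h ∙_) (⁻¹-anti-homo-∙ l h) ⟩
    k ∙ h ∙ (h ⁻ ∙ l ⁻)   ≡⟨ assoc k h _ ⟩
    k ∙ (h ∙ (h ⁻ ∙ l ⁻)) ≡⟨ cong (k ∙_) (∙-\\ h _) ⟩
    k ∙ l ⁻               ∎)) (K-∙ (proj₁ (proj₂ (K-transitive (act x o)))) (K-⁻ (proj₁ (proj₂ (K-transitive (act y o))))))
    where
    k = kernelPart x
    l = kernelPart y
    h = complementPart y

  -- Right factors from K do not change the coset: as K is closed under conjugation, the hypothesis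
  -- reduces to xy⁻¹ ∈ K, and xy⁻¹ also fixes the base point.
  K-transversal : ∀ {x y k l} → act x o ≡ o → act y o ≡ o → InK k → InK l → InK (x ∙ k ∙ (y ∙ l) ⁻) → x ≡ y
  K-transversal {x} {y} {k} {l} xo yo k∈ l∈ q∈ = ∙-cancelʳ (y ⁻) x y (trans (xy⁻∈ o (trans (act-∙ x (y ⁻) o) (trans (cong (act x) (trans (cong (act (y ⁻)) (sym yo)) (act-⁻ˡ y o))) xo))) (sym (inverseʳ y)))
    where
    c = x ∙ (k ∙ l ⁻) ∙ x ⁻
    xy⁻∈ : InK (x ∙ y ⁻)
    xy⁻∈ = subst InK (∙-cancelˡ c _ _ (begin
      c ∙ (c ⁻ ∙ (x ∙ k ∙ (y ∙ l) ⁻))   ≡⟨ ∙-\\ c _ ⟩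
      x ∙ k ∙ (y ∙ l) ⁻                 ≡⟨ cong (x ∙ k ∙_) (⁻¹-anti-homo-∙ y l) ⟩
      x ∙ k ∙ (l ⁻ ∙ y ⁻)               ≡⟨ assoc _ _ _ ⟨
      x ∙ k ∙ l ⁻ ∙ y ⁻                 ≡⟨ cong (_∙ y ⁻) (assoc x k (l ⁻)) ⟩
      x ∙ (k ∙ l ⁻) ∙ y ⁻               ≡⟨ cong (_∙ y ⁻) (//-∙ (x ∙ (k ∙ l ⁻)) x) ⟨
      c ∙ x ∙ y ⁻                       ≡⟨ assoc c x (y ⁻) ⟩
      c ∙ (x ∙ y ⁻)                     ∎)) (K-∙ (K-⁻ (K-conj x (K-∙ k∈ (K-⁻ l∈)))) q∈)

-- The rational numbers

opaque
  rationals : CharZeroField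
  rationals = record
    { F = ℚ.ℚ ; _+_ = ℚ._+_ ; _*_ = ℚ._*_ ; -_ = ℚ.-_ ; 0# = ℚ.0ℚ ; 1# = ℚ.1ℚ
    ; isCommutativeRing = ℚₚ.+-*-isCommutativeRing
    ; _≟_ = ℚ._≟_
    ; recip = λ x x≢0 → (ℚ.1/ x) {{ℚ.≢-nonZero x≢0}} , ℚₚ.*-inverseʳ x {{ℚ.≢-nonZero x≢0}}
    ; fromℕ-suc≢0 = λ n eq → ℚₚ.<⇒≢ (ℚₚ.+-mono-<-≤ {ℚ.0ℚ} {ℚ.1ℚ} 0<1 (nonneg n)) (sym eq)
    }
    where
    0<1 : ℚ.0ℚ ℚ.< ℚ.1ℚ
    0<1 = ℚₚ.positive⁻¹ ℚ.1ℚ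
    nonneg : ∀ n → ℚ.0ℚ ℚ.≤ fold ℚ.0ℚ (ℚ.1ℚ ℚ.+_) n
    nonneg zero = ℚₚ.≤-refl
    nonneg (suc n) = ℚₚ.+-mono-≤ {ℚ.0ℚ} {ℚ.1ℚ} (ℚₚ.<⇒≤ 0<1) (nonneg n)

-- Lists of permutations up to pointwise equality

infix 4 _≈?_
_≈?_ : ∀ {n} (π σ : Perm n) → Dec (π ≈ σ)
π ≈? σ = Finₚ.all? λ i → (π ⟨$⟩ʳ i) Fin.≟ (σ ⟨$⟩ʳ i)

_∈≈?_ : ∀ {n} (π : Perm n) L → Dec (π ∈≈ L)
π ∈≈? L = Any.any? (π ≈?_) L

∈⇒∈≈ : ∀ {n} {π : Perm n} {L} → π ∈ˡ L → π ∈≈ L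
∈⇒∈≈ = Any.map λ { refl _ → refl }

∈≈-resp : ∀ {n} (π σ : Perm n) {L} → π ≈ σ → π ∈≈ L → σ ∈≈ L
∈≈-resp π σ π≈σ = Any.map λ π≈τ i → trans (sym (π≈σ i)) (π≈τ i)

lookup-≈-injective : ∀ {n} {L : List (Perm n)} → Distinct L → ∀ i j → lookup L i ≈ lookup L j → i ≡ j
lookup-≈-injective {L = _ ∷ _} _ zero zero _ = refl
lookup-≈-injective {L = _ ∷ _} (x∉ ∷ _) zero (suc j) eq = contradiction eq (All.lookup x∉ (∈-lookup j))
lookup-≈-injective {L = _ ∷ _} (x∉ ∷ _) (suc i) zero eq = contradiction (λ k → sym (eq k)) (All.lookup x∉ (∈-lookup i))
lookup-≈-injective {L = _ ∷ _} (_ ∷ distinct) (suc i) (suc j) eq = cong suc (lookup-≈-injective distinct i j eq)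

length≡2 : ∀ {n} {L : List (Perm n)} (π σ : Perm n) → Distinct L → π ∈≈ L → σ ∈≈ L → ¬ (π ≈ σ) → (∀ τ → τ ∈≈ L → τ ≈ π ⊎ τ ≈ σ) → length L ≡ 2
length≡2 {L = a ∷ []} _ _ _ (here π≈a) (here σ≈a) π≉σ _ = contradiction (λ i → trans (π≈a i) (sym (σ≈a i))) π≉σ
length≡2 {L = a ∷ b ∷ []} _ _ _ _ _ _ _ = refl
length≡2 {L = a ∷ b ∷ c ∷ L} _ _ ((a≉b ∷ a≉c ∷ _) ∷ (b≉c ∷ _) ∷ _) _ _ _ cover
  with cover a (here λ _ → refl) | cover b (there (here λ _ → refl)) | cover c (there (there (here λ _ → refl)))
... | inj₁ a≈ | inj₁ b≈ | _ = contradiction (λ i → trans (a≈ i) (sym (b≈ i))) a≉b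
... | inj₂ a≈ | inj₂ b≈ | _ = contradiction (λ i → trans (a≈ i) (sym (b≈ i))) a≉b
... | inj₁ a≈ | inj₂ b≈ | inj₁ c≈ = contradiction (λ i → trans (a≈ i) (sym (c≈ i))) a≉c
... | inj₁ a≈ | inj₂ b≈ | inj₂ c≈ = contradiction (λ i → trans (b≈ i) (sym (c≈ i))) b≉c
... | inj₂ a≈ | inj₁ b≈ | inj₁ c≈ = contradiction (λ i → trans (b≈ i) (sym (c≈ i))) b≉c
... | inj₂ a≈ | inj₁ b≈ | inj₂ c≈ = contradiction (λ i → trans (a≈ i) (sym (c≈ i))) a≉c

≤-foldr-⊔ : ∀ {A : Set} (f : A → ℕ) {x xs} → x ∈ˡ xs → f x ≤ foldr _⊔_ 0 (map f xs)
≤-foldr-⊔ f (here refl) = ℕₚ.m≤m⊔n _ _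
≤-foldr-⊔ f (there x∈) = ℕₚ.≤-trans (≤-foldr-⊔ f x∈) (ℕₚ.m≤n⊔m _ _)

-- The abstract group of a list of permutations

module PermGroup {n : ℕ} {G : List (Perm n)} (isPermGroup : IsPermGroup G) where
  open IsPermGroup isPermGroup

  el : Fin (length G) → Perm n
  el = lookup G

  el∈ : ∀ x → el x ∈≈ G
  el∈ x = ∈⇒∈≈ (∈-lookup x)

  find : ∀ π → π ∈≈ G → Fin (length G)
  find π = Any.index

  find-≈ : ∀ π (π∈ : π ∈≈ G) → π ≈ el (find π π∈)
  find-≈ π = Anyₚ.lookup-index

  act : Fin (length G) → Fin n → Fin n
  act x i = el x ⟨$⟩ʳ i

  -- Group elements are positions in the list, and its distinctness turns pointwise equality into
  -- equality of positions. All group laws are checked pointwise through this.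
  act-faithful : ∀ {x y} → (∀ i → act x i ≡ act y i) → x ≡ y
  act-faithful {x} {y} = lookup-≈-injective distinct x y

  private
    infixl 7 _⊗_
    opaque
      _⊗_ : Fin (length G) → Fin (length G) → Fin (length G)
      x ⊗ y = find (el x · el y) (closed· (el x) (el y) (el∈ x) (el∈ y))

      1ᴳ : Fin (length G)
      1ᴳ = find idP hasId

      inv : Fin (length G) → Fin (length G)
      inv x = find (el x Defs.⁻¹) (closed⁻¹ (el x) (el∈ x))

      act-⊗ : ∀ x y i → act (x ⊗ y) i ≡ act x (act y i)
      act-⊗ x y i = sym (find-≈ (el x · el y) (closed· (el x) (el y) (el∈ x) (el∈ y)) i)

      act-1 : ∀ i → act 1ᴳ i ≡ i
      act-1 i = sym (find-≈ idP hasId i)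

      act-inv : ∀ x i → act (inv x) i ≡ el x ⟨$⟩ˡ i
      act-inv x i = sym (find-≈ (el x Defs.⁻¹) (closed⁻¹ (el x) (el∈ x)) i)

  permGroup : FiniteGroup
  permGroup = record
    { order = length G ; _∙_ = _⊗_ ; ε = 1ᴳ ; _⁻ = inv
    ; isGroup = record
      { isMonoid = record
        { isSemigroup = record
          { isMagma = record { isEquivalence = isEquivalence ; ∙-cong = cong₂ _⊗_ }
          ; assoc = λ x y z → act-faithful λ i → trans (act-⊗ (x ⊗ y) z i) (trans (act-⊗ x y (act z i)) (trans (cong (act x) (sym (act-⊗ y z i))) (sym (act-⊗ x (y ⊗ z) i)))) }
        ; identity = (λ x → act-faithful λ i → trans (act-⊗ 1ᴳ x i) (act-1 (act x i)))
                   , (λ x → act-faithful λ i → trans (act-⊗ x 1ᴳ i) (cong (act x) (act-1 i))) }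
      ; inverse = (λ x → act-faithful λ i → trans (act-⊗ (inv x) x i) (trans (act-inv x (act x i)) (trans (Perm.inverseˡ (el x)) (sym (act-1 i)))))
                , (λ x → act-faithful λ i → trans (act-⊗ x (inv x) i) (trans (cong (act x) (act-inv x i)) (trans (Perm.inverseʳ (el x)) (sym (act-1 i)))))
      ; ⁻¹-cong = cong inv } }

  open FiniteGroup permGroup

  act-∙ : ∀ x y i → act (x ∙ y) i ≡ act x (act y i)
  act-∙ = act-⊗

  act-ε : ∀ i → act ε i ≡ i
  act-ε = act-1

  act-⁻ : ∀ x i → act (x ⁻) i ≡ el x ⟨$⟩ˡ i
  act-⁻ = act-inv

  ≢ε⇒≉ : ∀ {x} → x ≢ ε → ¬ (el x ≈ idP)
  ≢ε⇒≉ x≢ε x≈ = x≢ε (act-faithful λ i → trans (x≈ i) (sym (act-ε i)))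

  intersect⇒fixed : ∀ x y → Intersect (el x) (el y) → ∃ λ i → act (x ∙ y ⁻) i ≡ i
  intersect⇒fixed x y (i , fix) = i , trans (act-∙ x (y ⁻) i) (trans (cong (act x) (act-⁻ y i)) fix)

  fixed⇒intersect : ∀ x y → (∃ λ i → act (x ∙ y ⁻) i ≡ i) → Intersect (el x) (el y)
  fixed⇒intersect x y (i , fix) = i , trans (sym (cong (act x) (act-⁻ y i))) (trans (sym (act-∙ x (y ⁻) i)) fix)

agree⇒intersect : ∀ {n} (π σ : Perm n) i → π ⟨$⟩ʳ i ≡ σ ⟨$⟩ʳ i → Intersect π σ
agree⇒intersect π σ i eq = (σ ⟨$⟩ʳ i) , trans (cong (π ⟨$⟩ʳ_) (Perm.inverseˡ σ)) eq

-- Intersecting families in a Frobenius group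

module FrobeniusPermGroup {n : ℕ} {G : List (Perm n)} (isFrobenius : IsFrobenius G) where
  open IsFrobenius isFrobenius renaming (group to isPermGroup; transitive to transitive≈)
  open PermGroup isPermGroup
  open FiniteGroup permGroup
  open MalnormalPair rationals permGroup

  action : FrobeniusAction permGroup n
  action = record
    { act = act ; act-∙ = act-∙ ; act-ε = act-ε
    ; transitive = λ i j → let π , π∈ , πi≡j = transitive≈ i j in find π π∈ , trans (sym (find-≈ π π∈ i)) πi≡j
    ; fixed-unique = λ {x} x≢ε i j → atMostOneFixed (el x) (el∈ x) (≢ε⇒≉ x≢ε) i j
    }

  o : Fin n
  o = proj₁ (proj₂ (proj₂ (proj₂ someFixer)))

  open FrobeniusActionTheory rationals action o

  private
    t : Elem
    t = find (proj₁ someFixer) (proj₁ (proj₂ someFixer))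

    t-≈ : proj₁ someFixer ≈ el t
    t-≈ = find-≈ (proj₁ someFixer) (proj₁ (proj₂ someFixer))

    t-fixes : act t o ≡ o
    t-fixes = trans (sym (t-≈ o)) (proj₂ (proj₂ (proj₂ (proj₂ someFixer))))

    t≢ε : t ≢ ε
    t≢ε t≡ε = proj₁ (proj₂ (proj₂ someFixer)) λ i → trans (t-≈ i) (trans (cong (λ x → act x i) t≡ε) (act-ε i))

    moved : ∃ λ j → act t j ≢ j
    moved = Finₚ.¬∀⟶∃¬ n (λ j → act t j ≡ j) (λ j → act t j Fin.≟ j) λ all-fixed → t≢ε (act-faithful λ i → trans (all-fixed i) (sym (act-ε i)))

    -- A second point. The kernel element taking `o` to it witnesses that the stabiliser is proper,
    -- and is the twist used to leave the cosets.
    p : Fin n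
    p = proj₁ moved

    p≢o : p ≢ o
    p≢o p≡o = proj₂ moved (trans (cong (act t) p≡o) (trans t-fixes (sym p≡o)))

  stabiliser-nontrivial : ∃ λ x → x ∈ stabiliser × x ≢ ε
  stabiliser-nontrivial = t , stabiliser⁺ t-fixes , t≢ε

  stabiliser-isMalnormal : IsMalnormal stabiliser
  stabiliser-isMalnormal = record
    { malnormal = stabiliser-malnormal
    ; proper = let k , _ , ko≡p = K-transitive p in k , λ k∈ → p≢o (trans (sym ko≡p) (stabiliser⁻ k∈)) }

  stab⁺ : ∀ {x} → act x o ≡ o → el x ∈ˡ stab G o
  stab⁺ {x} fix = ∈-filter⁺ (λ π → (π ⟨$⟩ʳ o) Fin.≟ o) {xs = G} (∈-lookup x) fix

  stab⁻ : ∀ {π} → π ∈ˡ stab G o → ∃ λ x → π ≡ el x × act x o ≡ o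
  stab⁻ π∈ with π∈G , fix ← ∈-filter⁻ (λ π → (π ⟨$⟩ʳ o) Fin.≟ o) {xs = G} π∈ =
    Any.index π∈G , Anyₚ.lookup-index π∈G , trans (cong (_⟨$⟩ʳ o) (sym (Anyₚ.lookup-index π∈G))) fix

  stab-distinct : Distinct (stab G o)
  stab-distinct = AllPairsₚ.filter⁺ (λ π → (π ⟨$⟩ʳ o) Fin.≟ o) (IsPermGroup.distinct isPermGroup)

  intersecting-bound : ∀ S → IsIntersecting G S → length S ≤ length (stab G o)
  intersecting-bound S (distinct , S⊆G , intersecting) = Finₚ.injective⇒≤ {f = f} f-injective
    where
    elem : Fin (length S) → Elem
    elem a = find (lookup S a) (S⊆G (lookup S a) (∈-lookup a))
    elem-≈ : ∀ a → lookup S a ≈ el (elem a)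
    elem-≈ a = find-≈ (lookup S a) (S⊆G (lookup S a) (∈-lookup a))
    part∈ : ∀ a → el (complementPart (elem a)) ∈ˡ stab G o
    part∈ a = stab⁺ (complementPart-fixes (elem a))
    f : Fin (length S) → Fin (length (stab G o))
    f a = Any.index (part∈ a)
    f-injective : ∀ {a b} → f a ≡ f b → a ≡ b
    f-injective {a} {b} eq = lookup-≈-injective distinct a b λ i → trans (elem-≈ a i) (trans (cong (λ z → act z i) x≡y) (sym (elem-≈ b i)))
      where
      x = elem a
      y = elem b
      parts≡ : complementPart x ≡ complementPart y
      parts≡ = act-faithful λ i → cong (_⟨$⟩ʳ i) (trans (Anyₚ.lookup-index (part∈ a)) (trans (cong (lookup (stab G o)) eq) (sym (Anyₚ.lookup-index (part∈ b)))))
      -- Equal complement parts put xy⁻¹ into K, and the fixed point supplied by the intersecting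
      -- hypothesis makes it trivial.
      meet : ∃ λ i → act (x ∙ y ⁻) i ≡ i
      meet with j , fix ← intersecting _ _ (∈-lookup a) (∈-lookup b) = intersect⇒fixed x y (agree⇒intersect (el x) (el y) j′ (trans (sym (elem-≈ a j′)) (trans fix (trans (sym (Perm.inverseʳ (lookup S b))) (elem-≈ b j′)))))
        where
        j′ = lookup S b ⟨$⟩ˡ j
      x≡y : x ≡ y
      x≡y = ∙-cancelʳ (y ⁻) x y (trans (complementPart≡⇒K x y parts≡ (proj₁ meet) (proj₂ meet)) (sym (inverseʳ y)))

  ekr : EKR G
  ekr S intersecting = ℕₚ.≤-trans (intersecting-bound S intersecting) (≤-foldr-⊔ (λ i → length (stab G i)) (∈-allFin o))

  stab-intersecting : IsIntersecting G (stab G o)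
  stab-intersecting = stab-distinct , (λ π π∈ → ∈⇒∈≈ (proj₁ (∈-filter⁻ (λ π → (π ⟨$⟩ʳ o) Fin.≟ o) {xs = G} π∈))) , λ π σ π∈ σ∈ →
    agree⇒intersect π σ o (trans (fixes π∈) (sym (fixes σ∈)))
    where
    fixes : ∀ {π} → π ∈ˡ stab G o → π ⟨$⟩ʳ o ≡ o
    fixes π∈ = proj₂ (∈-filter⁻ (λ π → (π ⟨$⟩ʳ o) Fin.≟ o) {xs = G} π∈)

  stab-length : HasOrderTwo stabiliser → length (stab G o) ≡ 2
  stab-length (s , s∈ , s≢ε , elements) = length≡2 (el ε) (el s) stab-distinct (∈⇒∈≈ (stab⁺ (act-ε o))) (∈⇒∈≈ (stab⁺ (stabiliser⁻ s∈))) (λ ε≈s → s≢ε (sym (act-faithful ε≈s))) cover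
    where
    cover : ∀ τ → τ ∈≈ stab G o → τ ≈ el ε ⊎ τ ≈ el s
    cover τ τ∈ with x , eq , fix ← stab⁻ (∈-lookup (Any.index τ∈)) | elements (stabiliser⁺ fix)
    ... | inj₁ refl = inj₁ λ i → trans (Anyₚ.lookup-index τ∈ i) (cong (_⟨$⟩ʳ i) eq)
    ... | inj₂ refl = inj₂ λ i → trans (Anyₚ.lookup-index τ∈ i) (cong (_⟨$⟩ʳ i) eq)

  -- A maximum family consists of two permutations agreeing at some i, with value j. A third element
  -- of the coset taking i to j would extend it to an intersecting family of size three, against
  -- maximality.
  strict⇐ : HasOrderTwo stabiliser → StrictEKR G
  strict⇐ two = ekr , λ S isMax → coset S isMax (ℕₚ.≤-antisym (ℕₚ.≤-trans (intersecting-bound S (proj₁ isMax)) (ℕₚ.≤-reflexive (stab-length two))) (ℕₚ.≤-trans (ℕₚ.≤-reflexive (sym (stab-length two))) (proj₂ isMax _ stab-intersecting)))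
    where
    coset : ∀ S → IsMaxIntersecting G S → length S ≡ 2 → IsStabCoset G S
    coset (π ∷ σ ∷ []) ((distinct , S⊆G , intersecting) , maximal) refl with intersecting π σ (here refl) (there (here refl))
    ... | j , fix = i , j , λ τ → mk⇔ (to τ) (from τ)
      where
      i = σ ⟨$⟩ˡ j
      σi≡j : σ ⟨$⟩ʳ i ≡ j
      σi≡j = Perm.inverseʳ σ
      to : ∀ τ → τ ∈≈ (π ∷ σ ∷ []) → τ ∈≈ G × τ ⟨$⟩ʳ i ≡ j
      to τ (here τ≈π) = ∈≈-resp π τ (λ k → sym (τ≈π k)) (S⊆G π (here refl)) , trans (τ≈π i) fix
      to τ (there (here τ≈σ)) = ∈≈-resp σ τ (λ k → sym (τ≈σ k)) (S⊆G σ (there (here refl))) , trans (τ≈σ i) σi≡j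
      from : ∀ τ → τ ∈≈ G × τ ⟨$⟩ʳ i ≡ j → τ ∈≈ (π ∷ σ ∷ [])
      from τ (τ∈ , τi≡j) with τ ∈≈? (π ∷ σ ∷ [])
      ... | yes τ∈S = τ∈S
      ... | no τ∉S = contradiction (maximal (τ ∷ π ∷ σ ∷ []) (((τ∉S ∘ here) ∷ (τ∉S ∘ there ∘ here) ∷ []) ∷ distinct , T⊆G , λ α β α∈ β∈ → agree⇒intersect α β i (trans (at-i α∈) (sym (at-i β∈))))) λ { (s≤s (s≤s ())) }
        where
        T⊆G : ∀ α → α ∈ˡ (τ ∷ π ∷ σ ∷ []) → α ∈≈ G
        T⊆G α (here refl) = τ∈
        T⊆G α (there α∈) = S⊆G α α∈
        at-i : ∀ {α} → α ∈ˡ (τ ∷ π ∷ σ ∷ []) → α ⟨$⟩ʳ i ≡ j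
        at-i (here refl) = τi≡j
        at-i (there (here refl)) = fix
        at-i (there (there (here refl))) = σi≡j

  -- Replacing one element y of the stabiliser by y ∙ k with k in the kernel keeps a transversal
  -- of the kernel, hence an intersecting family, but ε and t already determine the coset.
  private module Replacement (y : Elem) (y-fixes : act y o ≡ o) (y≢ε : y ≢ ε) (y≢t : y ≢ t) where
    k : Elem
    k = proj₁ (K-transitive p)
    k∈ : InK k
    k∈ = proj₁ (proj₂ (K-transitive p))
    twist : Elem → Elem
    twist x = if does (x Fin.≟ y) then k else ε
    twist∈ : ∀ x → InK (twist x)
    twist∈ x with does (x Fin.≟ y)
    ... | true = k∈
    ... | false = K-ε
    twist-y : twist y ≡ k
    twist-y = cong (if_then k else ε) (dec-true (y Fin.≟ y) refl)
    twist-≢ : ∀ {x} → x ≢ y → twist x ≡ ε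
    twist-≢ {x} x≢y = cong (if_then k else ε) (dec-false (x Fin.≟ y) x≢y)
    replace : Elem → Elem
    replace x = x ∙ twist x
    at-stab : ∀ a → ∃ λ x → lookup (stab G o) a ≡ el x × act x o ≡ o
    at-stab a = stab⁻ (∈-lookup a)
    x_ : Fin (length (stab G o)) → Elem
    x_ a = proj₁ (at-stab a)
    x-fixes : ∀ a → act (x_ a) o ≡ o
    x-fixes a = proj₂ (proj₂ (at-stab a))
    x-injective : ∀ {a b} → x_ a ≡ x_ b → a ≡ b
    x-injective {a} {b} eq = lookup-≈-injective stab-distinct a b λ i → cong (_⟨$⟩ʳ i) (trans (proj₁ (proj₂ (at-stab a))) (trans (cong el eq) (sym (proj₁ (proj₂ (at-stab b))))))
    S : List (Perm n)
    S = tabulate (el ∘ replace ∘ x_)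
    same : ∀ a b → InK (replace (x_ a) ∙ replace (x_ b) ⁻) → a ≡ b
    same a b q∈ = x-injective (K-transversal (x-fixes a) (x-fixes b) (twist∈ (x_ a)) (twist∈ (x_ b)) q∈)
    -- A quotient without fixed points would lie in K. The transversal property then makes the two
    -- elements equal, and their quotient is the identity after all.
    meet : ∀ a b → ∃ λ i → act (replace (x_ a) ∙ replace (x_ b) ⁻) i ≡ i
    meet a b = go (proj₂ (kernelView _))
      where
      go : ∀ {v} → KernelView (replace (x_ a) ∙ replace (x_ b) ⁻) v → ∃ λ i → act (replace (x_ a) ∙ replace (x_ b) ⁻) i ≡ i
      go (identity q≡ε) = o , trans (cong (λ q → act q o) q≡ε) (act-ε o)
      go (fixing _ i fix) = i , fix
      go (deranged q≢ε none) = contradiction (trans (cong (λ c → replace (x_ a) ∙ replace (x_ c) ⁻) (sym (same a b λ i fix → contradiction fix (none i)))) (inverseʳ _)) q≢ε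
    distinct : ∀ {a b} → a ≢ b → ¬ (el (replace (x_ a)) ≈ el (replace (x_ b)))
    distinct {a} {b} a≢b eq = a≢b (same a b (subst InK (sym (trans (cong (_∙ replace (x_ b) ⁻) (act-faithful eq)) (inverseʳ _))) K-ε))
    S⊆G : ∀ π → π ∈ˡ S → π ∈≈ G
    S⊆G π π∈ = let a , π≡ = ∈-tabulate⁻ π∈ in subst (_∈≈ G) (sym π≡) (el∈ (replace (x_ a)))
    S-meets : ∀ π σ → π ∈ˡ S → σ ∈ˡ S → Intersect π σ
    S-meets π σ π∈ σ∈ =
      let a , π≡ = ∈-tabulate⁻ π∈
          b , σ≡ = ∈-tabulate⁻ σ∈ in
      subst (λ τ → Intersect τ σ) (sym π≡) (subst (Intersect (el (replace (x_ a)))) (sym σ≡) (fixed⇒intersect (replace (x_ a)) (replace (x_ b)) (meet a b)))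
    S-intersecting : IsIntersecting G S
    S-intersecting = AllPairsₚ.tabulate⁺ distinct , S⊆G , S-meets
    S-maximal : ∀ T → IsIntersecting G T → length T ≤ length S
    S-maximal T T-int = ℕₚ.≤-trans (intersecting-bound T T-int) (ℕₚ.≤-reflexive (sym (Listₚ.length-tabulate (el ∘ replace ∘ x_))))
    replaced∈S : ∀ x → act x o ≡ o → el (replace x) ∈≈ S
    replaced∈S x fix = subst (λ z → el (replace z) ∈≈ S) (act-faithful λ i → cong (_⟨$⟩ʳ i) (trans (sym (proj₁ (proj₂ (at-stab a)))) (sym (Anyₚ.lookup-index (stab⁺ fix))))) (∈⇒∈≈ (∈-tabulate⁺ a))
      where
      a : Fin (length (stab G o))
      a = Any.index (stab⁺ fix)
    kept∈S : ∀ {x} → act x o ≡ o → x ≢ y → el x ∈≈ S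
    kept∈S {x} fix x≢y = subst (λ z → el z ∈≈ S) (trans (cong (x ∙_) (twist-≢ x≢y)) (identityʳ x)) (replaced∈S x fix)
    -- From ε one gets i = j, and then t, whose only fixed point is `o`, gives i = o. So y ∙ k would
    -- fix `o`, and k with it, whereas k takes `o` to `p`.
    no-coset : ¬ IsStabCoset G S
    no-coset (i , j , coset) = p≢o (trans (sym (proj₂ (proj₂ (K-transitive p)))) k-fixes)
      where
      maps : ∀ {x} → el x ∈≈ S → act x i ≡ j
      maps {x} x∈ = proj₂ (Equivalence.to (coset (el x)) x∈)
      i≡j : i ≡ j
      i≡j = trans (sym (act-ε i)) (maps (kept∈S (act-ε o) (y≢ε ∘ sym)))
      i≡o : i ≡ o
      i≡o = FrobeniusAction.fixed-unique action t≢ε i o (trans (maps (kept∈S t-fixes (y≢t ∘ sym))) (sym i≡j)) t-fixes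
      yk-fixes : act (y ∙ k) o ≡ o
      yk-fixes = trans (cong (act (y ∙ k)) (sym i≡o)) (trans (maps (subst (λ z → el (y ∙ z) ∈≈ S) twist-y (replaced∈S y y-fixes))) (trans (sym i≡j) i≡o))
      k-fixes : act k o ≡ o
      k-fixes = trans (sym (FrobeniusAction.act-⁻ˡ action y (act k o))) (trans (cong (act (y ⁻)) (trans (sym (act-∙ y k o)) yk-fixes)) (trans (cong (act (y ⁻)) (sym y-fixes)) (FrobeniusAction.act-⁻ˡ action y o)))

  strict⇒ : StrictEKR G → HasOrderTwo stabiliser
  strict⇒ (_ , strict) = t , stabiliser⁺ t-fixes , t≢ε , λ {x} x∈ → elements x (stabiliser⁻ x∈) (x Fin.≟ ε) (x Fin.≟ t)
    where
    elements : ∀ x → act x o ≡ o → Dec (x ≡ ε) → Dec (x ≡ t) → x ≡ ε ⊎ x ≡ t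
    elements x _ (yes x≡ε) _ = inj₁ x≡ε
    elements x _ (no _) (yes x≡t) = inj₂ x≡t
    elements x x-fixes (no x≢ε) (no x≢t) = contradiction (strict S (S-intersecting , S-maximal)) no-coset
      where open Replacement x x-fixes x≢ε x≢t

  -- Arbitrary Frobenius complements

  module _ {H : List (Perm n)} (isComplement : IsFrobeniusComplement G H) where
    open IsFrobeniusComplement isComplement renaming (malnormal to malnormal≈; proper to proper≈)
    open IsSubgroup subgroup renaming (group to H-group)
    open IsPermGroup H-group

    complement : Subgroup
    complement = record
      { mem = λ x → does (el x ∈≈? H)
      ; ε∈ = dec-true (el ε ∈≈? H) (∈≈-resp idP (el ε) (λ i → sym (act-ε i)) hasId)
      ; ∙∈ = λ {x} {y} x∈ y∈ → dec-true (el (x ∙ y) ∈≈? H) (∈≈-resp (el x · el y) (el (x ∙ y)) (λ i → sym (act-∙ x y i)) (closed· (el x) (el y) (sound x∈) (sound y∈)))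
      ; ⁻∈ = λ {x} x∈ → dec-true (el (x ⁻) ∈≈? H) (∈≈-resp (el x Defs.⁻¹) (el (x ⁻)) (λ i → sym (act-⁻ x i)) (closed⁻¹ (el x) (sound x∈)))
      }
      where
      sound : ∀ {x} → does (el x ∈≈? H) ≡ true → el x ∈≈ H
      sound {x} = does⁻ (el x ∈≈? H)

    complement⁺ : ∀ {x} → el x ∈≈ H → x ∈ complement
    complement⁺ {x} = dec-true (el x ∈≈? H)

    complement⁻ : ∀ {x} → x ∈ complement → el x ∈≈ H
    complement⁻ {x} = does⁻ (el x ∈≈? H)

    member : ∀ π → π ∈≈ H → ∃ λ x → x ∈ complement × π ≈ el x
    member π π∈ = find π (subset π π∈) , complement⁺ (∈≈-resp π (el (find π (subset π π∈))) (find-≈ π (subset π π∈)) π∈) , find-≈ π (subset π π∈)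

    complement-nontrivial : ∃ λ x → x ∈ complement × x ≢ ε
    complement-nontrivial with h , h∈ , h≉ ← nontrivial with x , x∈ , h≈x ← member h h∈ =
      x , x∈ , λ { refl → h≉ λ i → trans (h≈x i) (act-ε i) }

    complement-isMalnormal : IsMalnormal complement
    complement-isMalnormal = record
      { malnormal = malnormal
      ; proper = let g , g∈ , g∉ = proper≈ in find g g∈ , λ x∈ → g∉ (∈≈-resp (el (find g g∈)) g (λ i → sym (find-≈ g g∈ i)) (complement⁻ x∈)) }
      where
      malnormal : ∀ {h y} → h ∈ complement → h ≢ ε → y ⁻ ∙ h ∙ y ∈ complement → y ∈ complement
      malnormal {h} {y} h∈ h≢ε yhy∈ with el y ∈≈? H
      ... | yes _ = refl
      ... | no y∉ = contradiction (conj≡ε (act-faithful λ i → trans (yhy≈id i) (sym (act-ε i)))) h≢ε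
        where
        yhy≈id : el (y ⁻ ∙ h ∙ y) ≈ idP
        yhy≈id = malnormal≈ (el y) (el∈ y) y∉ (el (y ⁻ ∙ h ∙ y)) (complement⁻ yhy∈) (el h , complement⁻ h∈ , λ i → trans (act-∙ (y ⁻ ∙ h) y i) (trans (act-∙ (y ⁻) h (act y i)) (act-⁻ y (act h (act y i)))))

    order-two⇒length : HasOrderTwo complement → length H ≡ 2
    order-two⇒length (s , s∈ , s≢ε , elements) = length≡2 idP (el s) distinct hasId (complement⁻ s∈) (λ id≈s → ≢ε⇒≉ s≢ε λ i → sym (id≈s i)) cover
      where
      cover : ∀ τ → τ ∈≈ H → τ ≈ idP ⊎ τ ≈ el s
      cover τ τ∈ with x , x∈ , τ≈x ← member τ τ∈ with elements x∈
      ... | inj₁ refl = inj₁ λ i → trans (τ≈x i) (act-ε i)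
      ... | inj₂ refl = inj₂ τ≈x

    length⇒order-two : length H ≡ 2 → HasOrderTwo complement
    length⇒order-two length≡ with s , s∈ , s≢ε ← complement-nontrivial = s , s∈ , s≢ε , λ {x} x∈ → elements x x∈ (x Fin.≟ ε) (x Fin.≟ s)
      where
      elements : ∀ x → x ∈ complement → Dec (x ≡ ε) → Dec (x ≡ s) → x ≡ ε ⊎ x ≡ s
      elements x x∈ (yes x≡ε) _ = inj₁ x≡ε
      elements x x∈ (no _) (yes x≡s) = inj₂ x≡s
      elements x x∈ (no x≢ε) (no x≢s) = contradiction (Finₚ.injective⇒≤ {f = index} index-injective) (subst (λ l → ¬ (3 ≤ l)) (sym length≡) λ { (s≤s (s≤s ())) })
        where
        three : Fin 3 → Elem
        three zero = ε
        three (suc zero) = s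
        three (suc (suc zero)) = x
        three∈ : ∀ a → three a ∈ complement
        three∈ zero = ε∈ complement
        three∈ (suc zero) = s∈
        three∈ (suc (suc zero)) = x∈
        three-injective : ∀ a b → three a ≡ three b → a ≡ b
        three-injective zero zero _ = refl
        three-injective (suc zero) (suc zero) _ = refl
        three-injective (suc (suc zero)) (suc (suc zero)) _ = refl
        three-injective zero (suc zero) eq = contradiction (sym eq) s≢ε
        three-injective zero (suc (suc zero)) eq = contradiction (sym eq) x≢ε
        three-injective (suc zero) zero eq = contradiction eq s≢ε
        three-injective (suc zero) (suc (suc zero)) eq = contradiction (sym eq) x≢s
        three-injective (suc (suc zero)) zero eq = contradiction eq x≢ε
        three-injective (suc (suc zero)) (suc zero) eq = contradiction eq x≢s
        index : Fin 3 → Fin (length H)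
        index a = Any.index (complement⁻ (three∈ a))
        index-≈ : ∀ a → el (three a) ≈ lookup H (index a)
        index-≈ a = Anyₚ.lookup-index (complement⁻ (three∈ a))
        index-injective : ∀ {a b} → index a ≡ index b → a ≡ b
        index-injective {a} {b} eq = three-injective a b (act-faithful λ i → trans (index-≈ a i) (trans (cong (λ c → lookup H c ⟨$⟩ʳ i) eq) (sym (index-≈ b i))))

    strict⇔ : StrictEKR G ⇔ (length H ≡ 2)
    strict⇔ = mk⇔
      (λ strict → order-two⇒length (order-two-transfer stabiliser-isMalnormal complement-isMalnormal (strict⇒ strict) complement-nontrivial))
      (λ length≡ → strict⇐ (order-two-transfer complement-isMalnormal stabiliser-isMalnormal (length⇒order-two length≡) stabiliser-nontrivial))

theorem5p11 : ∀ (n : ℕ) (G H : List (Perm n)) →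
    IsFrobenius G → IsFrobeniusComplement G H →
    EKR G × (StrictEKR G ⇔ (length H ≡ 2))
theorem5p11 n G H isFrobenius isComplement = ekr , strict⇔ isComplement
  where open FrobeniusPermGroup isFrobenius
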